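{- Let $0\leq\varepsilon_c<\varepsilon_f\leq1$, write $g=\varepsilon_f-\varepsilon_c$, let $\delta\in(0,1/3)$, and suppose that $(f_P,f_V)$ has bounded $(\rho,\gamma)$-mismatch with respect to $D$. Define $\kappa:=\rho+(1-\rho)\gamma$ and $\eta:=g-2\kappa$. If $\eta>0$, Protocol $\Pi_{\mathrm{mis}}^{\mathrm{BB}}$ (described in the context) is an $(\varepsilon_c,\varepsilon_f)$-interactive proof with respect to $\Delta_{\mathrm{mis}}$, with completeness and soundness errors at most $\delta$. The verifier draws $m=O(\ln(1/\delta)/\eta^2)$ samples from $D$ and makes $q=O(g\ln(1/\delta)/\eta^2)$ queries to $f_V$. The honest prover draws no samples and makes at most $\min\{m,|\mathcal{X}|\}$ distinct queries to $f_P$. If a point of $\mathcal{X}$ is encoded with $\ell$ bits, the communication is $O\bigl(m\ell+q\log m\log(mK)\bigr)$ bits, and the number of rounds is $O(q\log m)$.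
   Context: Fix an integer $K\ge1$; $\mathcal{S}_K=\{0,1/K,\dots,1\}$. $D$ is a distribution over a finite domain $\mathcal{X}$ and $f_P,f_V\colon\mathcal{X}\to\mathcal{S}_K$ are the prover-side and verifier-side evaluation functions, fixed before the protocol; $\mu_P:=\mathbb{E}_{X\sim D}[f_P(X)]$. For $\rho,\gamma\in[0,1]$, $(f_P,f_V)$ has bounded $(\rho,\gamma)$-mismatch with respect to $D$ if there is $B\subseteq\mathcal{X}$ with $D(B)\le\rho$ and $|f_P(x)-f_V(x)|\le\gamma$ for all $x\notin B$. Instances $(D,f_P,f_V)$ are promised to satisfy this. The verifier has sampling access to $D$ (fresh independent samples) and query access to $f_V$; the designated honest prover has query access to $f_P$ only; a cheating prover is unbounded and may know $D,f_P,f_V$. For a claim $\sigma\in[0,1]$, $\Delta_{\mathrm{mis}}((D,f_P,f_V),\sigma):=|\mu_P-\sigma|$. An $(\varepsilon_c,\varepsilon_f)$-interactive proof with respect to $\Delta_{\mathrm{mis}}$ with errors at most $\delta$: if $\Delta_{\mathrm{mis}}\le\varepsilon_c$ the verifier accepts the honest prover with probability at least $1-\delta$; if $\Delta_{\mathrm{mis}}>\varepsilon_f$ it accepts any prover with probability at most $\delta$. Randomized comparison: for $a,b\in\mathcal{S}_K$ and $U\in[K]$, $C_K(a,b;U):=\mathbf{1}\bigl[\mathbf{1}[U\le Ka]\ne\mathbf{1}[U\le Kb]\bigr]$. Descent: $\mathcal{T}_m$ is the balanced binary interval tree over $[m]$ with root $[m]$; every nonsingleton interval $I$ has consecutive children $I_0,I_1$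 whose sizes differ by at most one. For an interval $I$, $\mathcal{W}_K(I):=\{z/K:z\in\{0,\dots,K|I|\}\}$. In one descent rooted at claim $W$, the verifier privately samples $J$ uniform in $[m]$ and follows the path from the root to $\{J\}$; at each interval $I$ on the path the prover sends claims for both children before the verifier reveals which child contains $J$; the verifier checks that each child claim is in $\mathcal{W}_K(I_b)$ (range check) and that they sum to the current claim of $I$ (additivity check), and continues with the child containing $J$ and its claim. Protocol $\Pi_{\mathrm{mis}}^{\mathrm{BB}}$: set $a:=\eta/8$, $m:=\lceil 32\ln(12/\delta)/\eta^2\rceil$, $q:=\lceil 24g\ln(12/\delta)/\eta^2\rceil$. (1) The verifier draws independent $X_1,\dots,X_m\sim D$ and sends the ordered sample. (2) The honest prover sets $p_j:=f_P(X_j)$ (querying each distinct point once) and sends $W:=\sum_jp_j$. (3) The verifier rejects unless $W\in\mathcal{W}_K([m])$ and $|W/m-\sigma|\le\varepsilon_c+a$. (4) The parties perform $q$ sequential descents of $\mathcal{T}_m$, each rooted at $W$ with fresh private index $J_t$ (the honest prover sends the true partial sums of the $p_j$). If a range or additivity check fails, the verifier rejects immediately. Otherwise descent $t$ reaches $\{J_t\}$ with claim $A_t$; the verifier queries $V_t:=f_V(X_{J_t})$, draws a fresh uniform $U_t\in[K]$ after receiving $A_t$, and sets $Z_t:=C_K(A_t,V_t;U_t)$. (5) If no check failed, the verifier accepts iff $\sum_{t=1}^qZ_t\le gq/2$. -}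

module Defs where

open import Algebra.Bundles using (CommutativeRing)
open import Algebra.Structures using (IsCommutativeRing)
import Algebra.Properties.Semiring.Exp
import Algebra.Properties.Semiring.Mult
import Algebra.Properties.Semiring.Sum
open import Data.Bool.Base using (Bool; true; false; if_then_else_; _∧_; _xor_)
open import Data.Fin.Base using (Fin; toℕ; splitAt) renaming (zero to fzero)
import Data.Fin.Properties as Fin
open import Data.Fin.Subset using (Subset; _∉_)
open import Data.List.Base as List using (List; []; _∷_; _++_; length; mapMaybe; deduplicate)
open import Data.Maybe.Base using (Maybe; just; nothing)
open import Data.Nat.Base as ℕ using (ℕ; zero; suc; NonZero; nonZero; _!; ∣_-_∣)
open import Data.Nat.ListAction using () renaming (sum to sumℕ)
open import Data.Nat.Logarithm using (⌈log₂_⌉)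
open import Data.Product.Base using (∃; _×_; _,_; proj₁; proj₂)
open import Data.Sum.Base using (inj₁; inj₂)
open import Data.Vec.Base as Vec using (Vec; []; _∷_)
open import Function.Base using (_∘_; case_of_)
open import Relation.Binary.Core using (Rel)
open import Relation.Binary.Structures using (IsDecTotalOrder)
import Relation.Binary.Construct.NonStrictToStrict as Strict
open import Relation.Nullary using (¬_; Dec; does; yes; no)
open import Level using (0ℓ)

-- The real numbers, axiomatised as a Dedekind-complete ordered field.  As in
-- classical mathematics, the order is decidable.  `_⁻¹` and `sup` are total:
-- their values at 0, respectively at sets that are empty or unbounded, are
-- unspecified.  `archimedean` follows classically from completeness; it is a
-- field because constructively it carries data, used to compute ceilings.
record RealField : Set₁ where
  infix  4 _≈_ _≤_
  infixl 6 _+_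
  infixl 7 _*_
  infix  8 -_
  infixl 9 _⁻¹
  field
    Carrier : Set
    _≈_ _≤_ : Rel Carrier 0ℓ
    _+_ _*_ : Carrier → Carrier → Carrier
    -_ _⁻¹  : Carrier → Carrier
    0# 1#   : Carrier
    sup     : (Carrier → Set) → Carrier
    isCommutativeRing : IsCommutativeRing _≈_ _+_ _*_ -_ 0# 1#
    isDecTotalOrder   : IsDecTotalOrder _≈_ _≤_
    0≉1         : ¬ (0# ≈ 1#)
    ⁻¹-inverseʳ : ∀ x → ¬ (x ≈ 0#) → x * x ⁻¹ ≈ 1#
    +-monoʳ-≤   : ∀ x y z → y ≤ z → x + y ≤ x + z
    *-nonNeg    : ∀ x y → 0# ≤ x → 0# ≤ y → 0# ≤ x * y

  commutativeRing : CommutativeRing 0ℓ 0ℓ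
  commutativeRing = record { isCommutativeRing = isCommutativeRing }

  open CommutativeRing commutativeRing public using (semiring; _-_)
  open IsDecTotalOrder isDecTotalOrder public using (_≟_; _≤?_)
  open Algebra.Properties.Semiring.Sum semiring public using (sum; sum-syntax)
  open Algebra.Properties.Semiring.Exp semiring public using (_^_)
  open Algebra.Properties.Semiring.Mult semiring public using () renaming (_×_ to _·_)
  open Strict _≈_ _≤_ public using (_<_)

  fromℕ : ℕ → Carrier
  fromℕ n = n · 1#

  UpperBound : (Carrier → Set) → Carrier → Set
  UpperBound P u = ∀ x → P x → x ≤ u

  field
    sup-upper   : ∀ P → ∃ P → ∃ (UpperBound P) → UpperBound P (sup P)
    sup-least   : ∀ P → ∃ P → ∃ (UpperBound P) → ∀ u → UpperBound P u → sup P ≤ u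
    archimedean : ∀ x → ∃ λ n → x ≤ fromℕ n

  infixl 7 _/_
  _/_ : Carrier → Carrier → Carrier
  x / y = x * y ⁻¹

  abs : Carrier → Carrier
  abs x = if does (0# ≤? x) then x else - x

  -- The least natural number at least x, given an upper bound n for it.
  ceilFrom : Carrier → (n : ℕ) → ℕ
  ceilFrom x zero    = zero
  ceilFrom x (suc n) = if does (x ≤? fromℕ n) then ceilFrom x n else suc n

  ⌈_⌉ : Carrier → ℕ
  ⌈ x ⌉ = ceilFrom x (proj₁ (archimedean x))

  expPartial : Carrier → ℕ → Carrier
  expPartial x n = ∑[ k < n ] ((x ^ toℕ k) / fromℕ (toℕ k !))

  -- For x ≥ 0 the partial sums increase, so their supremum is the sum of the
  -- exponential series; negative arguments use exp x = 1 / exp (- x).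
  exp⁺ exp : Carrier → Carrier
  exp⁺ x = sup λ s → ∃ λ n → s ≈ expPartial x n
  exp x  = if does (0# ≤? x) then exp⁺ x else exp⁺ (- x) ⁻¹

  -- The inverse of exp; meaningful for positive arguments only.
  ln : Carrier → Carrier
  ln y = sup λ x → exp x ≤ y

  record Distribution (n : ℕ) : Set where
    field
      weight : Fin n → Carrier
      nonNeg : ∀ i → 0# ≤ weight i
      total  : sum weight ≈ 1#

  open Distribution public using (weight)

  -- Finitely supported random experiments.
  data Rand (A : Set) : Set where
    pure    : A → Rand A
    choose  : ∀ {n} → Distribution n → (Fin n → Rand A) → Rand A
    uniform : ∀ n → .{{NonZero n}} → (Fin n → Rand A) → Rand A

  infixl 1 _>>=_
  _>>=_ : ∀ {A B} → Rand A → (A → Rand B) → Rand B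
  pure a      >>= f = f a
  choose d k  >>= f = choose d λ i → k i >>= f
  uniform n k >>= f = uniform n λ i → k i >>= f

  Pr : ∀ {A} → (A → Bool) → Rand A → Carrier
  Pr E (pure a)      = if E a then 1# else 0#
  Pr E (choose d k)  = sum λ i → weight d i * Pr E (k i)
  Pr E (uniform n k) = (∑[ i < n ] Pr E (k i)) / fromℕ n

  Always : ∀ {A} → (A → Set) → Rand A → Set
  Always P (pure a)      = P a
  Always P (choose d k)  = ∀ i → Always P (k i)
  Always P (uniform n k) = ∀ i → Always P (k i)

-- Interval trees over s consecutive points: the first child covers the first
-- a points and the second child the remaining b.
data BalancedTree : ℕ → Set where
  leaf : BalancedTree 1
  node : ∀ {a b} → ∣ a - b ∣ ℕ.≤ 1 → BalancedTree a → BalancedTree b → BalancedTree (a ℕ.+ b)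

size-nonZero : ∀ {s} → BalancedTree s → NonZero s
size-nonZero leaf = nonZero
size-nonZero (node {zero}  _ l r) = size-nonZero r
size-nonZero (node {suc _} _ l r) = nonZero

record Parameters {{ℜ : RealField}} : Set where
  open RealField ℜ
  field
    ε-c ε-f δ ρ γ : Carrier

  g κ η a L : Carrier
  g = ε-f - ε-c
  κ = ρ + (1# - ρ) * γ
  η = g - fromℕ 2 * κ
  a = η / fromℕ 8
  L = ln (fromℕ 12 / δ)

  m q : ℕ
  m = ⌈ fromℕ 32 * L / (η ^ 2) ⌉
  q = ⌈ fromℕ 24 * g * L / (η ^ 2) ⌉

-- The domain is 𝒳 = Fin N, and k : Fin (suc K) stands for k / K in 𝒮_K.
module Model {{ℜ : RealField}} (N K : ℕ) .{{_ : NonZero K}} where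

  open RealField ℜ

  ℝ : Set
  ℝ = Carrier

  val : Fin (suc K) → ℝ
  val k = fromℕ (toℕ k) / fromℕ K

  InGrid : ℕ → ℝ → Set
  InGrid s w = ∃ λ (z : Fin (suc (K ℕ.* s))) → w ≈ fromℕ (toℕ z) / fromℕ K

  inGrid? : ∀ s w → Dec (InGrid s w)
  inGrid? s w = Fin.any? λ z → w ≟ fromℕ (toℕ z) / fromℕ K

  -- u : Fin K stands for U = u + 1 in [K].
  compare : ℝ → ℝ → Fin K → Bool
  compare a b u = does (U ≤? fromℕ K * a) xor does (U ≤? fromℕ K * b)
    where
    U : ℝ
    U = fromℕ (suc (toℕ u))

  record Instance : Set where
    field
      D   : Distribution N
      f-P : Fin N → Fin (suc K)
      f-V : Fin N → Fin (suc K)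

    μ-P : ℝ
    μ-P = ∑[ x < N ] (weight D x * val (f-P x))

    mass : Subset N → ℝ
    mass B = ∑[ x < N ] (if Vec.lookup B x then weight D x else 0#)

  BoundedMismatch : ℝ → ℝ → Instance → Set
  BoundedMismatch ρ γ I = ∃ λ (B : Subset N) →
    mass B ≤ ρ × (∀ x → x ∉ B → abs (val (f-P x) - val (f-V x)) ≤ γ)
    where open Instance I

  Δ-mis : Instance → ℝ → ℝ
  Δ-mis I σ = abs (Instance.μ-P I - σ)

  data VerifierMsg : Set where
    sample : List (Fin N) → VerifierMsg
    reveal : Bool → VerifierMsg           -- true: the first child contains J

  -- What the prover is asked for; always determined by the messages so far.
  -- `children lo a b` asks for claims for the children of the interval of
  -- positions lo, …, lo + a + b - 1, of sizes a and b.
  data Prompt : Set where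
    root     : (m : ℕ) → Prompt
    children : (lo a b : ℕ) → Prompt

  Reply : Prompt → Set
  Reply (root _)         = ℝ
  Reply (children _ _ _) = ℝ × ℝ

  data Event : Set where
    V-draws V-queries P-draws P-queries : Fin N → Event
    V-sends : VerifierMsg → Event
    P-sends : (p : Prompt) → Reply p → Event

  -- The verifier may draw from D, toss private coins, query f_V, and exchange
  -- messages; it has no other access to the instance.
  data Verifier : Set where
    halt  : Bool → Verifier
    draw  : (Fin N → Verifier) → Verifier
    coin  : ∀ n → .{{NonZero n}} → (Fin n → Verifier) → Verifier
    query : Fin N → (Fin (suc K) → Verifier) → Verifier
    send  : VerifierMsg → Verifier → Verifier
    recv  : (p : Prompt) → (Reply p → Verifier) → Verifier

  data ProverComp (A : Set) : Set where
    return : A → ProverComp A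
    draw   : (Fin N → ProverComp A) → ProverComp A
    query  : Fin N → (Fin (suc K) → ProverComp A) → ProverComp A
    toss   : ∀ {n} → Distribution n → (Fin n → ProverComp A) → ProverComp A

  mapComp : ∀ {A B} → (A → B) → ProverComp A → ProverComp B
  mapComp f (return a)  = return (f a)
  mapComp f (draw k)    = draw λ x → mapComp f (k x)
  mapComp f (query x k) = query x λ v → mapComp f (k v)
  mapComp f (toss d k)  = toss d λ i → mapComp f (k i)

  -- An arbitrary prover: unbounded state and computation, private coins.  A
  -- cheating prover may depend on the whole instance, since it is quantified
  -- after it.
  record Prover : Set₁ where
    field
      State   : Set
      start   : State
      observe : VerifierMsg → State → ProverComp State
      answer  : (p : Prompt) → State → ProverComp (State × Reply p)

  module Execution (I : Instance) (P : Prover) where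
    open Instance I
    open Prover P

    log : ∀ {A} → List Event → Rand (A × List Event) → Rand (A × List Event)
    log es r = r >>= λ (a , es′) → pure (a , es ++ es′)

    runComp : ∀ {A} → ProverComp A → Rand (A × List Event)
    runComp (return a)  = pure (a , [])
    runComp (draw k)    = choose D λ x → log (P-draws x ∷ []) (runComp (k x))
    runComp (query x k) = log (P-queries x ∷ []) (runComp (k (f-P x)))
    runComp (toss d k)  = choose d λ i → runComp (k i)

    run : Verifier → State → Rand (Bool × List Event)
    run (halt b)    st = pure (b , [])
    run (draw k)    st = choose D λ x → log (V-draws x ∷ []) (run (k x) st)
    run (coin n k)  st = uniform n λ i → run (k i) st
    run (query x k) st = log (V-queries x ∷ []) (run (k (f-V x)) st)
    run (send msg v) st =
      runComp (observe msg st) >>= λ (st′ , es) →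
      log (V-sends msg ∷ es) (run v st′)
    run (recv p k) st =
      runComp (answer p st) >>= λ ((st′ , r) , es) →
      log (es ++ P-sends p r ∷ []) (run (k r) st′)

  execute : Instance → Verifier → Prover → Rand (Bool × List Event)
  execute I V P = Execution.run I P V (Prover.start P)

  acceptPr : Instance → Verifier → Prover → ℝ
  acceptPr I V P = Pr proj₁ (execute I V P)

  IsInteractiveProof : (Promise : Instance → Set) (Δ : Instance → ℝ → ℝ)
                       (ε-c ε-f δ : ℝ) (V : ℝ → Verifier) (honest : Prover) → Set₁
  IsInteractiveProof Promise Δ ε-c ε-f δ V honest =
    ∀ I → Promise I → ∀ σ → 0# ≤ σ → σ ≤ 1# →
      (Δ I σ ≤ ε-c → 1# - δ ≤ acceptPr I (V σ) honest) ×
      (ε-f < Δ I σ → (P : Prover) → acceptPr I (V σ) P ≤ δ)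

  V-drawn V-queried P-drawn P-queried : List Event → List (Fin N)
  V-drawn   = mapMaybe λ { (V-draws x)   → just x ; _ → nothing }
  V-queried = mapMaybe λ { (V-queries x) → just x ; _ → nothing }
  P-drawn   = mapMaybe λ { (P-draws x)   → just x ; _ → nothing }
  P-queried = mapMaybe λ { (P-queries x) → just x ; _ → nothing }

  -- Length of a fixed-length code for a claim about an interval of size s: one
  -- codeword for each of the K s + 1 elements of 𝒲_K, and one shared by all
  -- malformed claims, which the verifier treats alike.
  claimBits : ℕ → ℕ
  claimBits s = ⌈log₂ (K ℕ.* s ℕ.+ 2) ⌉

  -- ℓ is the number of bits encoding a point of the domain.
  messageBits : (ℓ : ℕ) → Event → Maybe ℕ
  messageBits ℓ (V-sends (sample xs))           = just (length xs ℕ.* ℓ)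
  messageBits ℓ (V-sends (reveal _))            = just 1
  messageBits ℓ (P-sends (root m) _)            = just (claimBits m)
  messageBits ℓ (P-sends (children _ a b) _)    = just (claimBits a ℕ.+ claimBits b)
  messageBits ℓ _                               = nothing

  communication : ℕ → List Event → ℕ
  communication ℓ es = sumℕ (mapMaybe (messageBits ℓ) es)

  -- Every message, in either direction, counts as a round.
  rounds : List Event → ℕ
  rounds = length ∘ mapMaybe (messageBits 0)

  queryAll : List (Fin N) → ProverComp (Fin N → Fin (suc K))
  queryAll []       = return λ _ → fzero
  queryAll (x ∷ xs) = query x λ v →
    mapComp (λ f y → if does (x Fin.≟ y) then v else f y) (queryAll xs)

  total : List (Fin (suc K)) → ℝ
  total = List.foldr (λ p w → val p + w) 0#

  -- The state is the list p_1, …, p_m, empty before the sample arrives.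
  honestProver : Prover
  honestProver = record
    { State   = List (Fin (suc K))
    ; start   = []
    ; observe = λ where
        (sample xs) _  → mapComp (λ f → List.map f xs) (queryAll (deduplicate Fin._≟_ xs))
        (reveal _)  ps → return ps
    ; answer  = λ where
        (root _) ps          → return (ps , total ps)
        (children lo a b) ps → return (ps ,
          total (List.take a (List.drop lo ps)) ,
          total (List.take b (List.drop (lo ℕ.+ a) ps)))
    }

  descend : ∀ {s} → BalancedTree s → (lo : ℕ) → Fin s → ℝ → (ℝ → Verifier) → Verifier
  descend leaf lo j w k = k w
  descend (node {a} {b} _ l r) lo j w k = recv (children lo a b) λ (w₀ , w₁) →
    if does (inGrid? a w₀) ∧ does (inGrid? b w₁) ∧ does (w₀ + w₁ ≟ w)
    then (case splitAt a j of λ where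
      (inj₁ i) → send (reveal true)  (descend l lo i w₀ k)
      (inj₂ i) → send (reveal false) (descend r (lo ℕ.+ a) i w₁ k))
    else halt false

  drawMany : ∀ n → (Vec (Fin N) n → Verifier) → Verifier
  drawMany zero    k = k []
  drawMany (suc n) k = draw λ x → drawMany n λ xs → k (x ∷ xs)

  module Protocol {{p : Parameters}} (T : BalancedTree (Parameters.m p)) where

    open Parameters p

    -- t descents remain and Z is the sum of the outcomes so far.
    descents : Vec (Fin N) m → (W : ℝ) → (t Z : ℕ) → Verifier
    descents xs W zero    Z = halt (does (fromℕ Z ≤? g * fromℕ q / fromℕ 2))
    descents xs W (suc t) Z =
      coin m {{size-nonZero T}} λ J →
      descend T 0 J W λ A →
      query (Vec.lookup xs J) λ v →
      coin K λ U →
      descents xs W t (if compare A (val v) U then suc Z else Z)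

    verifier : (σ : ℝ) → Verifier
    verifier σ =
      drawMany m λ xs →
      send (sample (Vec.toList xs)) (
      recv (root m) λ W →
      if does (inGrid? m W) ∧ does (abs (W / fromℕ m - σ) ≤? ε-c + a)
      then descents xs W q 0
      else halt false)

{-# OPTIONS --safe #-}

-- Soundness compares the root claim W with f-V rather than with f-P: a mismatch
-- bounded by (ρ, γ) gives |μ-P − μ-V| ≤ κ, and sample means stray from their
-- expectations by more than η / 8 with probability at most exp (− L) = δ / 12, by
-- Hoeffding's inequality with its sharp constant.  So in a typical sample W / m
-- differs from the mean of f-V by at least κ + 3 η / 4 = g / 2 + η / 4.  The prover
-- must commit to the claims of both children before the path is revealed, so that
-- in each descent the leaf claims add up to W; since randomized comparison detects
-- a difference d with probability |d|, every descent raises the count with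
-- conditional probability at least g / 2 + η / 4, and the lower Chernoff bound with
-- exponent η / (3 g) puts the count below g q / 2 with probability at most exp (− L).
-- For the honest prover the detection rate is the mean mismatch of the sample, at
-- most κ + η / 8 = g / 2 − 3 η / 8, and the upper Chernoff bound with exponent
-- η / (4 g) applies.
--
-- Hoeffding's lemma 1 − p + p eᵗ ≤ exp (p t + t² / 8) is obtained without calculus,
-- from 1 + x ≤ exp x: raising the parameter from t to t + 2 s multiplies the left
-- side by its value at 2 s for a bias tilted by at most tanh (s / 2), and t is reached
-- in n equal steps with n → ∞.
module Submission where

open import Defs
open import Algebra.Bundles using (CommutativeRing)
import Algebra.Properties.Ring as RingProperties
import Algebra.Properties.Semiring.Exp as ExpProperties
import Algebra.Properties.Semiring.Mult as MultProperties
import Algebra.Properties.Semiring.Sum as SumProperties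
import Algebra.Solver.Ring as RingSolver
open import Algebra.Solver.Ring.AlmostCommutativeRing
  using (fromCommutativeRing; _-Raw-AlmostCommutative⟶_)
open import Data.Bool.Base using (Bool; true; false; if_then_else_; _∧_; _xor_) renaming (T to So)
open import Data.Bool.Properties using (xor-comm)
open import Data.Empty using (⊥)
open import Data.Fin.Base as Fin using (Fin; toℕ; fromℕ<; splitAt; _↑ˡ_; _↑ʳ_) renaming (zero to fzero; suc to fsuc)
import Data.Fin.Properties as Fin
open import Data.Integer.Base as ℤ using (ℤ)
import Data.Integer.Properties as ℤ
open import Data.List.Base as List using (List; []; _∷_; _++_; length; mapMaybe)
open import Data.List.Membership.Propositional using (_∈_)
open import Data.List.Membership.Propositional.Properties using (∈-deduplicate⁺; ∈-lookup)
import Data.List.Properties as List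
open import Data.List.Relation.Unary.All as All using (_∷_)
open import Data.List.Relation.Unary.AllPairs using ([]; _∷_)
open import Data.List.Relation.Unary.Any using (here; there)
open import Data.List.Relation.Unary.Unique.DecPropositional.Properties using (deduplicate-!)
open import Data.List.Relation.Unary.Unique.Propositional using (Unique)
open import Data.Maybe.Base using (Maybe; just; nothing)
open import Data.Nat.Base as ℕ using (ℕ; zero; suc; NonZero; _⊓_; _!)
open import Data.Nat.Induction using (<-rec)
open import Data.Nat.ListAction using () renaming (sum to sumℕ)
open import Data.Nat.ListAction.Properties using () renaming (sum-++ to sumℕ-++)
open import Data.Nat.Logarithm
import Data.Nat.Properties as ℕ
import Data.Nat.Solver
open import Data.Product.Base using (∃; ∃-syntax; _×_; _,_; proj₁; proj₂)
import Data.Sign.Base as Sign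
open import Data.Sum.Base using (_⊎_; inj₁; inj₂)
open import Data.Unit.Base using (⊤)
open import Data.Vec.Base as Vec using (Vec; []; _∷_)
import Data.Vec.Properties as Vec
open import Function.Base using (_∘_)
open import Function.Bundles using (_↣_)
open import Level using (0ℓ)
open import Relation.Binary.Bundles using (Poset)
open import Relation.Binary.PropositionalEquality.Core as ≡ using (_≡_)
import Relation.Binary.Reasoning.PartialOrder as PartialOrderReasoning
import Relation.Binary.Reasoning.Setoid as SetoidReasoning
open import Relation.Binary.Structures using (IsDecTotalOrder)
open import Relation.Nullary using (¬_; Dec; does; yes; no; contradiction)
open import Relation.Nullary.Decidable using (dec-true)

-- The sample counts force two kinds of tail bound. The size `m` leaves no slack: a deviation of η /
-- 8 earns 2 (η / 8)² = η² / 32 per sample, so 32 L / η² samples reach exactly L. The number `q`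
-- carries an extra factor `g`; for small `g` Hoeffding's bound would be too weak there, and the
-- multiplicative Chernoff form is used because the rates compared are of order `g`. The prover
-- adapts, tosses coins and keeps state, so the outcomes of the descents are not independent.
-- Instead of conditioning, the acceptance probability from an arbitrary state is bounded by an
-- exponential weight in the current count, by induction on the remaining descents. Within a descent
-- the sum over the hidden index is moved inside the prover's experiment, where only quantities
-- additive over the leaves survive. An absolute difference is not additive, so the difference from
-- f-V is taken with one sign, fixed by the side on which σ misses μ-P. Atypical samples are charged
-- by adding their own Chernoff weights to the bound.

-- Ring arithmetic over the reals with integer coefficients

module OrderedField (ℜ : RealField) where

  open import Data.Integer.Base using (+_; -[1+_])
  open RealField ℜ public

  open CommutativeRing commutativeRing public
    using (setoid; +-cong; +-congˡ; +-congʳ; *-cong; *-congˡ; *-congʳ; -‿cong; +-comm; +-assoc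
          ; *-comm; *-assoc; +-identityˡ; +-identityʳ; *-identityˡ; *-identityʳ; zeroˡ; zeroʳ
          ; distribˡ; distribʳ; -‿inverseˡ; -‿inverseʳ; ring)
    renaming (refl to ≈-refl; sym to ≈-sym; trans to ≈-trans; reflexive to ≈-reflexive)
  open ExpProperties semiring public using (^-congˡ)
  open MultProperties semiring public using () renaming (×-homo-+ to ·-homo-+; ×1-homo-* to ·1-homo-*)
  open SumProperties semiring public
    using (sum-cong-≋; ∑-distrib-+; *-distribˡ-sum; *-distribʳ-sum; sum-replicate)

  private module Rng = RingProperties ring

  open IsDecTotalOrder isDecTotalOrder public using () renaming (total to ≤-total)

  poset : Poset 0ℓ 0ℓ 0ℓ
  poset = record { isPartialOrder = IsDecTotalOrder.isPartialOrder isDecTotalOrder }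

  open Poset poset public using ()
    renaming (refl to ≤-refl; trans to ≤-trans; antisym to ≤-antisym; reflexive to ≤-reflexive
             ; ≤-respˡ-≈ to ≤-respˡ; ≤-respʳ-≈ to ≤-respʳ)
  module ≤-Reasoning = PartialOrderReasoning poset

  module ≈-Reasoning = SetoidReasoning setoid

  private
    open ≈-Reasoning

    ⟦_⟧ℤ : ℤ → Carrier
    ⟦ + n      ⟧ℤ = fromℕ n
    ⟦ -[1+ n ] ⟧ℤ = - fromℕ (suc n)

    fromℕ-+ : ∀ m n → fromℕ (m ℕ.+ n) ≈ fromℕ m + fromℕ n
    fromℕ-+ = ·-homo-+ 1#

    cancel-1 : ∀ x y → x - y ≈ (1# + x) - (1# + y)
    cancel-1 x y = begin
      x + - y                     ≈⟨ +-congʳ (+-identityʳ x) ⟨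
      x + 0# + - y                ≈⟨ +-congʳ (+-congˡ (-‿inverseʳ 1#)) ⟨
      x + (1# + - 1#) + - y       ≈⟨ +-congʳ (+-assoc x 1# (- 1#)) ⟨
      x + 1# + - 1# + - y         ≈⟨ +-assoc (x + 1#) (- 1#) (- y) ⟩
      x + 1# + (- 1# + - y)       ≈⟨ +-cong (+-comm x 1#) (Rng.-‿+-comm 1# y) ⟩
      1# + x + - (1# + y)         ∎

    ⟦⟧-⊖ : ∀ m n → ⟦ m ℤ.⊖ n ⟧ℤ ≈ fromℕ m - fromℕ n
    ⟦⟧-⊖ m       zero    = ≈-sym (≈-trans (+-congˡ Rng.-0#≈0#) (+-identityʳ _))
    ⟦⟧-⊖ zero    (suc n) = ≈-sym (+-identityˡ _)
    ⟦⟧-⊖ (suc m) (suc n) = begin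
      ⟦ suc m ℤ.⊖ suc n ⟧ℤ         ≡⟨ ≡.cong ⟦_⟧ℤ (ℤ.[1+m]⊖[1+n]≡m⊖n m n) ⟩
      ⟦ m ℤ.⊖ n ⟧ℤ                 ≈⟨ ⟦⟧-⊖ m n ⟩
      fromℕ m - fromℕ n            ≈⟨ cancel-1 _ _ ⟩
      fromℕ (suc m) - fromℕ (suc n) ∎

    ⟦⟧-+ : ∀ i j → ⟦ i ℤ.+ j ⟧ℤ ≈ ⟦ i ⟧ℤ + ⟦ j ⟧ℤ
    ⟦⟧-+ (+ m)      (+ n)      = fromℕ-+ m n
    ⟦⟧-+ (+ m)      -[1+ n ]   = ⟦⟧-⊖ m (suc n)
    ⟦⟧-+ -[1+ m ]   (+ n)      = ≈-trans (⟦⟧-⊖ n (suc m)) (+-comm _ _)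
    ⟦⟧-+ -[1+ m ]   -[1+ n ]   = begin
      - fromℕ (suc (suc (m ℕ.+ n)))        ≡⟨ ≡.cong (λ k → - fromℕ (suc k)) (ℕ.+-suc m n) ⟨
      - fromℕ (suc m ℕ.+ suc n)            ≈⟨ -‿cong (fromℕ-+ (suc m) (suc n)) ⟩
      - (fromℕ (suc m) + fromℕ (suc n))    ≈⟨ Rng.-‿+-comm _ _ ⟨
      - fromℕ (suc m) + - fromℕ (suc n)    ∎

    ⟦⟧-neg : ∀ i → ⟦ ℤ.- i ⟧ℤ ≈ - ⟦ i ⟧ℤ
    ⟦⟧-neg (+ zero)  = ≈-sym Rng.-0#≈0#
    ⟦⟧-neg (+ suc n) = ≈-refl
    ⟦⟧-neg -[1+ n ]  = ≈-sym (Rng.-‿involutive _)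

    ⟦⟧-*ℕ : ∀ m n → ⟦ + (m ℕ.* n) ⟧ℤ ≈ fromℕ m * fromℕ n
    ⟦⟧-*ℕ = ·1-homo-*

    ⟦⟧-◃+ : ∀ n → ⟦ Sign.+ ℤ.◃ n ⟧ℤ ≈ fromℕ n
    ⟦⟧-◃+ n = ≈-reflexive (≡.cong ⟦_⟧ℤ (ℤ.+◃n≡+n n))

    ⟦⟧-◃- : ∀ n → ⟦ Sign.- ℤ.◃ n ⟧ℤ ≈ - fromℕ n
    ⟦⟧-◃- n = ≈-trans (≈-reflexive (≡.cong ⟦_⟧ℤ (ℤ.-◃n≡-n n))) (⟦⟧-neg (+ n))

    ⟦⟧-* : ∀ i j → ⟦ i ℤ.* j ⟧ℤ ≈ ⟦ i ⟧ℤ * ⟦ j ⟧ℤ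
    ⟦⟧-* (+ m)    (+ n)    = ≈-trans (⟦⟧-◃+ (m ℕ.* n)) (⟦⟧-*ℕ m n)
    ⟦⟧-* (+ m)    -[1+ n ] = begin
      ⟦ Sign.- ℤ.◃ (m ℕ.* suc n) ⟧ℤ   ≈⟨ ⟦⟧-◃- (m ℕ.* suc n) ⟩
      - fromℕ (m ℕ.* suc n)           ≈⟨ -‿cong (⟦⟧-*ℕ m (suc n)) ⟩
      - (fromℕ m * fromℕ (suc n))     ≈⟨ Rng.-‿distribʳ-* _ _ ⟩
      fromℕ m * - fromℕ (suc n)       ∎
    ⟦⟧-* -[1+ m ] (+ n)    = begin
      ⟦ Sign.- ℤ.◃ (suc m ℕ.* n) ⟧ℤ   ≈⟨ ⟦⟧-◃- (suc m ℕ.* n) ⟩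
      - fromℕ (suc m ℕ.* n)           ≈⟨ -‿cong (⟦⟧-*ℕ (suc m) n) ⟩
      - (fromℕ (suc m) * fromℕ n)     ≈⟨ Rng.-‿distribˡ-* _ _ ⟩
      - fromℕ (suc m) * fromℕ n       ∎
    ⟦⟧-* -[1+ m ] -[1+ n ] = begin
      ⟦ Sign.+ ℤ.◃ (suc m ℕ.* suc n) ⟧ℤ     ≈⟨ ⟦⟧-◃+ (suc m ℕ.* suc n) ⟩
      fromℕ (suc m ℕ.* suc n)               ≈⟨ ⟦⟧-*ℕ (suc m) (suc n) ⟩
      fromℕ (suc m) * fromℕ (suc n)         ≈⟨ Rng.-‿involutive _ ⟨
      - - (fromℕ (suc m) * fromℕ (suc n))   ≈⟨ -‿cong (Rng.-‿distribʳ-* _ _) ⟩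
      - (fromℕ (suc m) * - fromℕ (suc n))   ≈⟨ Rng.-‿distribˡ-* _ _ ⟩
      - fromℕ (suc m) * - fromℕ (suc n)     ∎

    -- The solver interprets the constant 1 as 1# rather than as fromℕ 1 = 1# + 0#.
    ⟦_⟧ : ℤ → Carrier
    ⟦ + 1 ⟧ = 1#
    ⟦ i   ⟧ = ⟦ i ⟧ℤ

    ⟦⟧≈ : ∀ i → ⟦ i ⟧ ≈ ⟦ i ⟧ℤ
    ⟦⟧≈ (+ zero)        = ≈-refl
    ⟦⟧≈ (+ suc zero)    = ≈-sym (+-identityʳ 1#)
    ⟦⟧≈ (+ suc (suc n)) = ≈-refl
    ⟦⟧≈ -[1+ n ]        = ≈-refl

    -- Integer coefficients have decidable equality that computes, so the solver can cancel numerals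
    -- of either sign, which equality in the abstract field does not allow.
    ℤ-homomorphism : ℤ.+-*-rawRing -Raw-AlmostCommutative⟶ fromCommutativeRing commutativeRing
    ℤ-homomorphism = record
      { ⟦_⟧    = ⟦_⟧
      ; +-homo = λ i j → ≈-trans (⟦⟧≈ (i ℤ.+ j)) (≈-trans (⟦⟧-+ i j) (≈-sym (+-cong (⟦⟧≈ i) (⟦⟧≈ j))))
      ; *-homo = λ i j → ≈-trans (⟦⟧≈ (i ℤ.* j)) (≈-trans (⟦⟧-* i j) (≈-sym (*-cong (⟦⟧≈ i) (⟦⟧≈ j))))
      ; -‿homo = λ i → ≈-trans (⟦⟧≈ (ℤ.- i)) (≈-trans (⟦⟧-neg i) (≈-sym (-‿cong (⟦⟧≈ i))))
      ; 0-homo = ≈-refl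
      ; 1-homo = ≈-refl
      }

    _coeff≟_ : (i j : ℤ) → Maybe (⟦ i ⟧ ≈ ⟦ j ⟧)
    i coeff≟ j with i ℤ.≟ j
    ... | yes i≡j = just (≈-reflexive (≡.cong ⟦_⟧ i≡j))
    ... | no  _   = nothing

  open RingSolver ℤ.+-*-rawRing (fromCommutativeRing commutativeRing) ℤ-homomorphism _coeff≟_ public
    using (solve; _:=_; _:+_; _:*_; _:-_; :-_; _:^_; con; Polynomial)

  infix 10 #_
  #_ : ∀ {k} → ℕ → Polynomial k
  # n = con (+ n)

-- Ordered-field inequalities, division, powers and absolute value

module OrderLemmas (ℜ : RealField) where

  open OrderedField ℜ public

  private variable
    w x y z : Carrier

  <⇒≤ : x < y → x ≤ y
  <⇒≤ = proj₁

  ≰⇒> : ¬ (x ≤ y) → y < x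
  ≰⇒> {x} {y} x≰y with ≤-total x y
  ... | inj₁ x≤y = contradiction x≤y x≰y
  ... | inj₂ y≤x = y≤x , λ y≈x → x≰y (≤-reflexive (≈-sym y≈x))

  <⇒≱ : x < y → ¬ (y ≤ x)
  <⇒≱ (x≤y , x≉y) y≤x = x≉y (≤-antisym x≤y y≤x)

  <-≤-trans : x < y → y ≤ z → x < z
  <-≤-trans (x≤y , x≉y) y≤z = ≤-trans x≤y y≤z , λ x≈z → x≉y (≤-antisym x≤y (≤-respʳ (≈-sym x≈z) y≤z))

  ≤-<-trans : x ≤ y → y < z → x < z
  ≤-<-trans x≤y (y≤z , y≉z) = ≤-trans x≤y y≤z , λ x≈z → y≉z (≤-antisym y≤z (≤-respˡ x≈z x≤y))

  <-respʳ : y ≈ z → x < y → x < z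
  <-respʳ y≈z x<y = <-≤-trans x<y (≤-reflexive y≈z)

  +-mono-≤ : w ≤ x → y ≤ z → w + y ≤ x + z
  +-mono-≤ {w} {x} {y} {z} w≤x y≤z =
    ≤-trans (+-monoʳ-≤ w y z y≤z) (≤-respˡ (+-comm z w) (≤-respʳ (+-comm z x) (+-monoʳ-≤ z w x w≤x)))

  +-monoˡ-≤ : ∀ z → x ≤ y → x + z ≤ y + z
  +-monoˡ-≤ z x≤y = +-mono-≤ x≤y ≤-refl

  0≤-diff : x ≤ y → 0# ≤ y - x
  0≤-diff {x} {y} x≤y = ≤-respˡ (-‿inverseʳ x) (+-monoˡ-≤ (- x) x≤y)

  ≤-by-diff : 0# ≤ z → x + z ≈ y → x ≤ y
  ≤-by-diff {z} {x} 0≤z x+z≈y = ≤-respˡ (+-identityʳ x) (≤-respʳ x+z≈y (+-monoʳ-≤ x 0# z 0≤z))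

  diff-0≤ : 0# ≤ y - x → x ≤ y
  diff-0≤ {y} {x} h = ≤-by-diff h (solve 2 (λ x y → x :+ (y :- x) := y) ≈-refl x y)

  x≤x+y : 0# ≤ y → x ≤ x + y
  x≤x+y 0≤y = ≤-by-diff 0≤y ≈-refl

  x≤y+x : 0# ≤ y → x ≤ y + x
  x≤y+x 0≤y = ≤-by-diff 0≤y (+-comm _ _)

  neg-anti-≤ : x ≤ y → - y ≤ - x
  neg-anti-≤ {x} {y} x≤y = ≤-by-diff (0≤-diff x≤y) (solve 2 (λ x y → :- y :+ (y :- x) := :- x) ≈-refl x y)

  -0≈0 : - 0# ≈ 0#
  -0≈0 = solve 0 (:- # 0 := # 0) ≈-refl

  0≤-neg : x ≤ 0# → 0# ≤ - x
  0≤-neg x≤0 = ≤-respˡ -0≈0 (neg-anti-≤ x≤0)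

  neg-≤0 : 0# ≤ x → - x ≤ 0#
  neg-≤0 0≤x = ≤-respʳ -0≈0 (neg-anti-≤ 0≤x)

  0≤-+ : 0# ≤ x → 0# ≤ y → 0# ≤ x + y
  0≤-+ 0≤x 0≤y = ≤-respˡ (+-identityˡ 0#) (+-mono-≤ 0≤x 0≤y)

  0≤-* : 0# ≤ x → 0# ≤ y → 0# ≤ x * y
  0≤-* = *-nonNeg _ _

  *-monoˡ-≤ : ∀ {c} → 0# ≤ c → x ≤ y → c * x ≤ c * y
  *-monoˡ-≤ {x} {y} {c} 0≤c x≤y =
    ≤-by-diff (0≤-* 0≤c (0≤-diff x≤y)) (solve 3 (λ c x y → c :* x :+ c :* (y :- x) := c :* y) ≈-refl c x y)

  *-monoʳ-≤ : ∀ {c} → 0# ≤ c → x ≤ y → x * c ≤ y * c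
  *-monoʳ-≤ {x} {y} {c} 0≤c x≤y = ≤-respˡ (*-comm c x) (≤-respʳ (*-comm c y) (*-monoˡ-≤ 0≤c x≤y))

  *-mono-≤ : 0# ≤ w → w ≤ x → 0# ≤ y → y ≤ z → w * y ≤ x * z
  *-mono-≤ 0≤w w≤x 0≤y y≤z = ≤-trans (*-monoʳ-≤ 0≤y w≤x) (*-monoˡ-≤ (≤-trans 0≤w w≤x) y≤z)

  0≤-sq : ∀ x → 0# ≤ x * x
  0≤-sq x with ≤-total 0# x
  ... | inj₁ 0≤x = 0≤-* 0≤x 0≤x
  ... | inj₂ x≤0 = ≤-respʳ (solve 1 (λ x → :- x :* :- x := x :* x) ≈-refl x) (0≤-* 0≤-x 0≤-x)
    where
    0≤-x : 0# ≤ - x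
    0≤-x = 0≤-neg x≤0

  0≤1 : 0# ≤ 1#
  0≤1 = ≤-respʳ (*-identityˡ 1#) (0≤-sq 1#)

  0<1 : 0# < 1#
  0<1 = 0≤1 , 0≉1

  0≤fromℕ : ∀ n → 0# ≤ fromℕ n
  0≤fromℕ zero    = ≤-refl
  0≤fromℕ (suc n) = 0≤-+ 0≤1 (0≤fromℕ n)

  0<fromℕ-suc : ∀ n → 0# < fromℕ (suc n)
  0<fromℕ-suc n = <-≤-trans 0<1 (≤-respˡ (+-identityʳ 1#) (+-monoʳ-≤ 1# 0# (fromℕ n) (0≤fromℕ n)))

  0<fromℕ : ∀ n → .{{NonZero n}} → 0# < fromℕ n
  0<fromℕ (suc n) = 0<fromℕ-suc n

  fromℕ-mono : ∀ {m n} → m ℕ.≤ n → fromℕ m ≤ fromℕ n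
  fromℕ-mono {n = n} ℕ.z≤n = 0≤fromℕ n
  fromℕ-mono (ℕ.s≤s m≤n) = +-monoʳ-≤ 1# _ _ (fromℕ-mono m≤n)

  fromℕ-+ : ∀ m n → fromℕ (m ℕ.+ n) ≈ fromℕ m + fromℕ n
  fromℕ-+ = ·-homo-+ 1#

  fromℕ-* : ∀ m n → fromℕ (m ℕ.* n) ≈ fromℕ m * fromℕ n
  fromℕ-* = ·1-homo-*

  fromℕ-1 : fromℕ 1 ≈ 1#
  fromℕ-1 = +-identityʳ 1#

  fromℕ-cancel : ∀ {m n} → fromℕ m ≤ fromℕ n → m ℕ.≤ n
  fromℕ-cancel {m} {n} h with m ℕ.≤? n
  ... | yes m≤n = m≤n
  ... | no  m≰n = contradiction h (<⇒≱ (<-≤-trans n<1+n (fromℕ-mono (ℕ.≰⇒> m≰n))))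
    where
    n<1+n : fromℕ n < fromℕ (suc n)
    n<1+n = x≤y+x 0≤1
          , λ eq → 0≉1 (≈-trans (≈-sym (-‿inverseʳ (fromℕ n)))
              (≈-trans (+-congʳ eq) (solve 2 (λ o n → (o :+ n) :- n := o) ≈-refl 1# (fromℕ n))))

  0<⇒≉0 : 0# < x → ¬ (x ≈ 0#)
  0<⇒≉0 (_ , 0≉x) x≈0 = 0≉x (≈-sym x≈0)

  inverseʳ : 0# < x → x * x ⁻¹ ≈ 1#
  inverseʳ 0<x = ⁻¹-inverseʳ _ (0<⇒≉0 0<x)

  inverseˡ : 0# < x → x ⁻¹ * x ≈ 1#
  inverseˡ 0<x = ≈-trans (*-comm _ _) (inverseʳ 0<x)

  -- The inverse equals (x⁻¹)² x, a square times a positive number.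
  0≤⁻¹ : 0# < x → 0# ≤ x ⁻¹
  0≤⁻¹ {x} 0<x = ≤-respʳ (begin
      x ⁻¹ * x ⁻¹ * x    ≈⟨ *-assoc _ _ _ ⟩
      x ⁻¹ * (x ⁻¹ * x)  ≈⟨ *-congˡ (inverseˡ 0<x) ⟩
      x ⁻¹ * 1#          ≈⟨ *-identityʳ _ ⟩
      x ⁻¹               ∎) (0≤-* (0≤-sq (x ⁻¹)) (<⇒≤ 0<x))
    where open ≈-Reasoning

  *-cancelˡ-≤ : ∀ {c} → 0# < c → c * x ≤ c * y → x ≤ y
  *-cancelˡ-≤ {x} {y} {c} 0<c h = ≤-respˡ (eq x) (≤-respʳ (eq y) (*-monoˡ-≤ (0≤⁻¹ 0<c) h))
    where
    eq : ∀ z → c ⁻¹ * (c * z) ≈ z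
    eq z = ≈-trans (≈-sym (*-assoc _ _ _)) (≈-trans (*-congʳ (inverseˡ 0<c)) (*-identityˡ z))

  *-cancelˡ-≈ : ∀ {c} → 0# < c → c * x ≈ c * y → x ≈ y
  *-cancelˡ-≈ 0<c h = ≤-antisym (*-cancelˡ-≤ 0<c (≤-reflexive h)) (*-cancelˡ-≤ 0<c (≤-reflexive (≈-sym h)))

  *-cancelʳ-≤ : ∀ {c} → 0# < c → x * c ≤ y * c → x ≤ y
  *-cancelʳ-≤ 0<c h = *-cancelˡ-≤ 0<c (≤-respˡ (*-comm _ _) (≤-respʳ (*-comm _ _) h))

  0<-* : 0# < x → 0# < y → 0# < x * y
  0<-* {x} {y} 0<x 0<y = 0≤-* (<⇒≤ 0<x) (<⇒≤ 0<y)
    , λ 0≈xy → 0<⇒≉0 0<y (*-cancelˡ-≈ 0<x (≈-trans (≈-sym 0≈xy) (≈-sym (zeroʳ x))))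

  0<⁻¹ : 0# < x → 0# < x ⁻¹
  0<⁻¹ {x} 0<x = 0≤⁻¹ 0<x , λ 0≈x⁻¹ →
    0≉1 (≈-trans (≈-sym (zeroʳ x)) (≈-trans (*-congˡ 0≈x⁻¹) (inverseʳ 0<x)))

  0<-+ : 0# < x → 0# ≤ y → 0# < x + y
  0<-+ {x} {y} 0<x 0≤y = <-≤-trans 0<x (x≤x+y 0≤y)

  ⁻¹-unique : 0# < x → x * y ≈ 1# → y ≈ x ⁻¹
  ⁻¹-unique 0<x xy≈1 = *-cancelˡ-≈ 0<x (≈-trans xy≈1 (≈-sym (inverseʳ 0<x)))

  /-*-cancel : 0# < y → x / y * y ≈ x
  /-*-cancel 0<y = ≈-trans (*-assoc _ _ _) (≈-trans (*-congˡ (inverseˡ 0<y)) (*-identityʳ _))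

  ≤-/ : 0# < z → x * z ≤ y → x ≤ y / z
  ≤-/ 0<z h = *-cancelʳ-≤ 0<z (≤-respʳ (≈-sym (/-*-cancel 0<z)) h)

  /-≤ : 0# < z → x ≤ y * z → x / z ≤ y
  /-≤ 0<z h = *-cancelʳ-≤ 0<z (≤-respˡ (≈-sym (/-*-cancel 0<z)) h)

  /-≤⁻¹ : 0# < z → x / z ≤ y → x ≤ y * z
  /-≤⁻¹ 0<z h = ≤-respˡ (/-*-cancel 0<z) (*-monoʳ-≤ (<⇒≤ 0<z) h)

  /-unique : 0# < z → x * z ≈ y → x ≈ y / z
  /-unique 0<z h = ≤-antisym (≤-/ 0<z (≤-reflexive h))
      (*-cancelʳ-≤ 0<z (≤-reflexive (≈-trans (/-*-cancel 0<z) (≈-sym h))))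

  0≤-/ : 0# ≤ x → 0# < y → 0# ≤ x / y
  0≤-/ 0≤x 0<y = 0≤-* 0≤x (0≤⁻¹ 0<y)

  0<-/ : 0# < x → 0# < y → 0# < x / y
  0<-/ 0<x 0<y = 0<-* 0<x (0<⁻¹ 0<y)

  -- Otherwise half of the gap x - y is an ε that violates the hypothesis.
  ≤-+ε⇒≤ : (∀ ε → 0# < ε → x ≤ y + ε) → x ≤ y
  ≤-+ε⇒≤ {x} {y} h with x ≤? y
  ... | yes x≤y = x≤y
  ... | no  x≰y = contradiction (h ε 0<ε) (<⇒≱ y+ε<x)
    where
    h½ ε : Carrier
    h½ = fromℕ 2 ⁻¹
    ε = (x - y) * h½
    0<x-y : 0# < x - y
    0<x-y = 0≤-diff (<⇒≤ (≰⇒> x≰y)) , λ eq → x≰y (diff-0≤ (≤-respʳ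
      (solve 2 (λ x y → :- (x :- y) := y :- x) ≈-refl x y)
      (≤-reflexive (≈-trans (solve 0 (# 0 := :- # 0) ≈-refl) (-‿cong eq)))))
    0<ε : 0# < ε
    0<ε = 0<-* 0<x-y (0<⁻¹ (0<fromℕ-suc 1))
    y+ε+ε : y + ε + ε ≈ x
    y+ε+ε = begin
      y + ε + ε                  ≈⟨ solve 3 (λ x y i → y :+ (x :- y) :* i :+ (x :- y) :* i
                                       := y :+ (x :- y) :* (# 2 :* i)) ≈-refl x y h½ ⟩
      y + (x - y) * (fromℕ 2 * h½) ≈⟨ +-congˡ (*-congˡ (inverseʳ (0<fromℕ-suc 1))) ⟩
      y + (x - y) * 1#           ≈⟨ +-congˡ (*-identityʳ _) ⟩
      y + (x - y)                ≈⟨ solve 2 (λ x y → y :+ (x :- y) := x) ≈-refl x y ⟩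
      x                          ∎
      where open ≈-Reasoning
    y+ε<x : y + ε < x
    y+ε<x = ≤-by-diff (<⇒≤ 0<ε) y+ε+ε , λ eq → 0<⇒≉0 0<ε (begin
      ε                      ≈⟨ solve 2 (λ a e → e := (a :+ e) :- a) ≈-refl (y + ε) ε ⟩
      (y + ε + ε) - (y + ε)  ≈⟨ +-cong y+ε+ε (-‿cong eq) ⟩
      x - x                  ≈⟨ -‿inverseʳ x ⟩
      0#                     ∎)
      where open ≈-Reasoning

  0≤-^ : 0# ≤ x → ∀ n → 0# ≤ x ^ n
  0≤-^ 0≤x zero    = 0≤1
  0≤-^ 0≤x (suc n) = 0≤-* 0≤x (0≤-^ 0≤x n)

  0<-^ : 0# < x → ∀ n → 0# < x ^ n
  0<-^ 0<x zero    = 0<1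
  0<-^ 0<x (suc n) = 0<-* 0<x (0<-^ 0<x n)

  ^-mono-≤ : 0# ≤ x → x ≤ y → ∀ n → x ^ n ≤ y ^ n
  ^-mono-≤ 0≤x x≤y zero    = ≤-refl
  ^-mono-≤ 0≤x x≤y (suc n) = *-mono-≤ 0≤x x≤y (0≤-^ 0≤x n) (^-mono-≤ 0≤x x≤y n)

  1^n≈1 : ∀ n → 1# ^ n ≈ 1#
  1^n≈1 zero    = ≈-refl
  1^n≈1 (suc n) = ≈-trans (*-identityˡ _) (1^n≈1 n)

  sum-mono-≤ : ∀ {n} {f g : Fin n → Carrier} → (∀ i → f i ≤ g i) → sum f ≤ sum g
  sum-mono-≤ {zero}  f≤g = ≤-refl
  sum-mono-≤ {suc n} f≤g = +-mono-≤ (f≤g fzero) (sum-mono-≤ (f≤g ∘ fsuc))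

  0≤-sum : ∀ {n} {f : Fin n → Carrier} → (∀ i → 0# ≤ f i) → 0# ≤ sum f
  0≤-sum {zero}  0≤f = ≤-refl
  0≤-sum {suc n} 0≤f = 0≤-+ (0≤f fzero) (0≤-sum (0≤f ∘ fsuc))

  sum-≤-size : ∀ {n} {f : Fin n → Carrier} → (∀ i → f i ≤ 1#) → sum f ≤ fromℕ n
  sum-≤-size {n} f≤1 = ≤-respʳ (sum-replicate n) (sum-mono-≤ f≤1)

  ≤-abs : ∀ x → x ≤ abs x
  ≤-abs x with 0# ≤? x
  ... | yes _   = ≤-refl
  ... | no  0≰x = ≤-trans x≤0 (0≤-neg x≤0)
    where
    x≤0 : x ≤ 0#
    x≤0 = <⇒≤ (≰⇒> 0≰x)

  neg-≤-abs : ∀ x → - x ≤ abs x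
  neg-≤-abs x with 0# ≤? x
  ... | yes 0≤x = ≤-trans (neg-≤0 0≤x) 0≤x
  ... | no  _   = ≤-refl

  abs-≤ : x ≤ y → - x ≤ y → abs x ≤ y
  abs-≤ {x} x≤y -x≤y with 0# ≤? x
  ... | yes _ = x≤y
  ... | no  _ = -x≤y

  abs-cases : ∀ x → abs x ≈ x ⊎ abs x ≈ - x
  abs-cases x with 0# ≤? x
  ... | yes _ = inj₁ ≈-refl
  ... | no  _ = inj₂ ≈-refl

-- Partial sums and Cauchy products of nonnegative sequences

module Convolution (ℜ : RealField) where

  open OrderLemmas ℜ

  private variable
    f g : ℕ → Carrier

  S : (ℕ → Carrier) → ℕ → Carrier
  S f n = ∑[ k < n ] f (toℕ k)

  conv : (ℕ → Carrier) → (ℕ → Carrier) → ℕ → Carrier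
  conv f g zero    = f 0 * g 0
  conv f g (suc n) = f 0 * g (suc n) + conv (f ∘ suc) g n

  NonNegative : (ℕ → Carrier) → Set
  NonNegative f = ∀ k → 0# ≤ f k

  S-mono : NonNegative f → ∀ {m n} → m ℕ.≤ n → S f m ≤ S f n
  S-mono f≥0 {n = n} ℕ.z≤n = 0≤-sum {n} (λ i → f≥0 (toℕ i))
  S-mono f≥0 (ℕ.s≤s m≤n) = +-monoʳ-≤ _ _ _ (S-mono (f≥0 ∘ suc) m≤n)

  -- The geometric series bound in telescoped form: with 1 - r kept as a factor nothing is divided,
  -- and r = 1 is allowed.
  S-geometric : ∀ {r} → NonNegative f → (∀ k → f (suc k) ≤ r * f k) → r ≤ 1# →
                ∀ n → S f n * (1# - r) ≤ f 0
  S-geometric f≥0 ratio r≤1 zero = ≤-respˡ (≈-sym (zeroˡ _)) (f≥0 0)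
  S-geometric {f} {r} f≥0 ratio r≤1 (suc n) = begin
    (f 0 + S (f ∘ suc) n) * (1# - r)         ≈⟨ distribʳ _ _ _ ⟩
    f 0 * (1# - r) + S (f ∘ suc) n * (1# - r)
      ≤⟨ +-monoʳ-≤ _ _ _ (≤-trans (S-geometric (f≥0 ∘ suc) (ratio ∘ suc) r≤1 n) (ratio 0)) ⟩
    f 0 * (1# - r) + r * f 0                 ≈⟨ solve 3 (λ o a r → a :* (o :- r) :+ r :* a := a :* o) ≈-refl 1#
        (f 0) r ⟩
    f 0 * 1#                                 ≈⟨ *-identityʳ _ ⟩
    f 0                                      ∎
    where open ≤-Reasoning

  S-conv-suc : ∀ f g n → S (conv f g) (suc n) ≈ f 0 * S g (suc n) + S (conv (f ∘ suc) g) n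
  S-conv-suc f g n = begin
    f 0 * g 0 + ∑[ k < n ] (f 0 * g (suc (toℕ k)) + conv (f ∘ suc) g (toℕ k))
      ≈⟨ +-congˡ (∑-distrib-+ {n} (λ k → f 0 * g (suc (toℕ k))) (λ k → conv (f ∘ suc) g (toℕ k))) ⟩
    f 0 * g 0 + (∑[ k < n ] (f 0 * g (suc (toℕ k))) + S (conv (f ∘ suc) g) n)
      ≈⟨ +-congˡ (+-congʳ (*-distribˡ-sum {n} (f 0) (λ k → g (suc (toℕ k))))) ⟨
    f 0 * g 0 + (f 0 * S (g ∘ suc) n + S (conv (f ∘ suc) g) n)
      ≈⟨ solve 4 (λ a b c d → a :* b :+ (a :* c :+ d) := a :* (b :+ c) :+ d) ≈-refl _ _ _ _ ⟩
    f 0 * S g (suc n) + S (conv (f ∘ suc) g) n ∎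
    where open ≈-Reasoning

  -- The triangle i + j < n lies inside the rectangle i < n, j < N, and all products are
  -- nonnegative. Separating N from n lets the induction shrink the triangle while the factor
  -- `S g N` stays fixed.
  S-conv-≤ : NonNegative f → NonNegative g → ∀ {n N} → n ℕ.≤ N → S (conv f g) n ≤ S f n * S g N
  S-conv-≤ f≥0 g≥0 {zero} {N} _ = ≤-reflexive (≈-sym (zeroˡ _))
  S-conv-≤ {f} {g} f≥0 g≥0 {suc n} {N} n≤N = begin
    S (conv f g) (suc n)                             ≈⟨ S-conv-suc f g n ⟩
    f 0 * S g (suc n) + S (conv (f ∘ suc) g) n
      ≤⟨ +-mono-≤ (*-monoˡ-≤ (f≥0 0) (S-mono g≥0 n≤N)) (S-conv-≤ (f≥0 ∘ suc) g≥0 (ℕ.<⇒≤ n≤N)) ⟩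
    f 0 * S g N + S (f ∘ suc) n * S g N              ≈⟨ distribʳ _ _ _ ⟨
    S f (suc n) * S g N                              ∎
    where open ≤-Reasoning

  -- Conversely, the rectangle i < n, j < k lies inside the triangle i + j < n + k.
  ≤-S-conv : NonNegative f → NonNegative g → ∀ n k → S f n * S g k ≤ S (conv f g) (n ℕ.+ k)
  ≤-S-conv {f} {g} f≥0 g≥0 zero k = ≤-respˡ (≈-sym (zeroˡ _)) (0≤-sum {k} (λ i → conv≥0 f≥0 (toℕ i)))
    where
    conv≥0 : ∀ {f} → NonNegative f → NonNegative (conv f g)
    conv≥0 f≥0 zero    = 0≤-* (f≥0 0) (g≥0 0)
    conv≥0 f≥0 (suc n) = 0≤-+ (0≤-* (f≥0 0) (g≥0 (suc n))) (conv≥0 (f≥0 ∘ suc) n)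
  ≤-S-conv {f} {g} f≥0 g≥0 (suc n) k = begin
    S f (suc n) * S g k                              ≈⟨ distribʳ _ _ _ ⟩
    f 0 * S g k + S (f ∘ suc) n * S g k
      ≤⟨ +-mono-≤ (*-monoˡ-≤ (f≥0 0) (S-mono g≥0 (ℕ.m≤n+m k (suc n)))) (≤-S-conv (f≥0 ∘ suc) g≥0 n k) ⟩
    f 0 * S g (suc (n ℕ.+ k)) + S (conv (f ∘ suc) g) (n ℕ.+ k) ≈⟨ S-conv-suc f g (n ℕ.+ k) ⟨
    S (conv f g) (suc n ℕ.+ k)                       ∎
    where open ≤-Reasoning

  conv-cong : ∀ {f f′ g g′} → (∀ k → f k ≈ f′ k) → (∀ k → g k ≈ g′ k) → ∀ n → conv f g n ≈ conv f′ g′ n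
  conv-cong f≈ g≈ zero    = *-cong (f≈ 0) (g≈ 0)
  conv-cong f≈ g≈ (suc n) = +-cong (*-cong (f≈ 0) (g≈ (suc n))) (conv-cong (f≈ ∘ suc) g≈ n)

  conv-*ˡ : ∀ c f g n → conv (λ k → c * f k) g n ≈ c * conv f g n
  conv-*ˡ c f g zero    = *-assoc _ _ _
  conv-*ˡ c f g (suc n) = ≈-trans (+-cong (*-assoc _ _ _) (conv-*ˡ c (f ∘ suc) g n)) (≈-sym (distribˡ _ _ _))

  conv-*ʳ : ∀ c f g n → conv f (λ k → c * g k) n ≈ c * conv f g n
  conv-*ʳ c f g zero    = solve 3 (λ a b c → a :* (c :* b) := c :* (a :* b)) ≈-refl _ _ _
  conv-*ʳ c f g (suc n) = ≈-trans
    (+-cong (solve 3 (λ a b c → a :* (c :* b) := c :* (a :* b)) ≈-refl _ _ _) (conv-*ʳ c (f ∘ suc) g n))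
    (≈-sym (distribˡ _ _ _))

  conv-last : ∀ f g n → conv f g (suc n) ≈ conv f (g ∘ suc) n + f (suc n) * g 0
  conv-last f g zero    = ≈-refl
  conv-last f g (suc n) = ≈-trans (+-congˡ (conv-last (f ∘ suc) g n)) (≈-sym (+-assoc _ _ _))

  -- Every product in the convolution has i + j = n, so the weights c + i and j add up to c + n. The
  -- offset c absorbs the index shift of the recursion.
  conv-weights : ∀ c f g n →
    conv (λ i → (c + fromℕ i) * f i) g n + conv f (λ j → fromℕ j * g j) n ≈ (c + fromℕ n) * conv f g n
  conv-weights c f g zero =
    solve 3 (λ c a b → (c :+ # 0) :* a :* b :+ a :* (# 0 :* b) := (c :+ # 0) :* (a :* b))
      ≈-refl c (f 0) (g 0)
  conv-weights c f g (suc n) = begin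
    ((c + 0#) * f 0 * g (suc n) + X′) + (f 0 * (fromℕ (suc n) * g (suc n)) + Y)
      ≈⟨ solve 6 (λ c a b X Y n → ((c :+ # 0) :* a :* b :+ X) :+ (a :* (n :* b) :+ Y)
                   := (c :+ n) :* (a :* b) :+ (X :+ Y)) ≈-refl c (f 0) (g (suc n)) X′ Y (fromℕ (suc n)) ⟩
    (c + fromℕ (suc n)) * (f 0 * g (suc n)) + (X′ + Y)
      ≈⟨ +-congˡ (+-congʳ (conv-cong (λ i → *-congʳ (≈-sym (+-assoc c 1# (fromℕ i)))) (λ _ → ≈-refl) n)) ⟩
    (c + fromℕ (suc n)) * (f 0 * g (suc n)) + (X + Y)
      ≈⟨ +-congˡ (conv-weights (c + 1#) (f ∘ suc) g n) ⟩
    (c + fromℕ (suc n)) * (f 0 * g (suc n)) + (c + 1# + fromℕ n) * conv (f ∘ suc) g n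
      ≈⟨ +-congˡ (*-congʳ (+-assoc c 1# (fromℕ n))) ⟩
    (c + fromℕ (suc n)) * (f 0 * g (suc n)) + (c + fromℕ (suc n)) * conv (f ∘ suc) g n
      ≈⟨ distribˡ _ _ _ ⟨
    (c + fromℕ (suc n)) * conv f g (suc n) ∎
    where
    open ≈-Reasoning
    X′ X Y : Carrier
    X′ = conv (λ i → (c + fromℕ (suc i)) * f (suc i)) g n
    X  = conv (λ i → (c + 1# + fromℕ i) * f (suc i)) g n
    Y  = conv (f ∘ suc) (λ j → fromℕ j * g j) n

-- The exponential function

module Exponential (ℜ : RealField) where

  open OrderLemmas ℜ
  open Convolution ℜ

  private variable
    x y t : Carrier

  term : Carrier → ℕ → Carrier
  term x k = (x ^ k) / fromℕ (k !)

  private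
    0<! : ∀ k → 0# < fromℕ (k !)
    0<! k = 0<fromℕ (k !) {{ℕ._!≢0 k}}

  term-suc : ∀ x k → fromℕ (suc k) * term x (suc k) ≈ x * term x k
  term-suc x k = begin
    fromℕ (suc k) * (x * x ^ k * fromℕ (suc k !) ⁻¹)   ≈⟨ *-congˡ (/-unique-sym) ⟩
    fromℕ (suc k) * (x * term x k * fromℕ (suc k) ⁻¹)  ≈⟨ solve 3 (λ a b c → a :* (b :* c) := b :* (c :* a))
        ≈-refl _ _ _ ⟩
    x * term x k * (fromℕ (suc k) ⁻¹ * fromℕ (suc k))  ≈⟨ *-congˡ (inverseˡ (0<fromℕ-suc k)) ⟩
    x * term x k * 1#                                  ≈⟨ *-identityʳ _ ⟩
    x * term x k                                       ∎
    where
    open ≈-Reasoning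
    /-unique-sym : x * x ^ k * fromℕ (suc k !) ⁻¹ ≈ x * term x k * fromℕ (suc k) ⁻¹
    /-unique-sym = ≈-sym (/-unique (0<! (suc k)) (begin
      x * (x ^ k * fromℕ (k !) ⁻¹) * fromℕ (suc k) ⁻¹ * fromℕ (suc k ℕ.* k !)
        ≈⟨ *-congˡ (fromℕ-* (suc k) (k !)) ⟩
      x * (x ^ k * fromℕ (k !) ⁻¹) * fromℕ (suc k) ⁻¹ * (fromℕ (suc k) * fromℕ (k !))
        ≈⟨ solve 6 (λ x xk i j a b → x :* (xk :* i) :* j :* (a :* b) := x :* xk :* ((i :* b) :* (j :* a)))
             ≈-refl x (x ^ k) (fromℕ (k !) ⁻¹) (fromℕ (suc k) ⁻¹) (fromℕ (suc k)) (fromℕ (k !)) ⟩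
      x * x ^ k * ((fromℕ (k !) ⁻¹ * fromℕ (k !)) * (fromℕ (suc k) ⁻¹ * fromℕ (suc k)))
        ≈⟨ *-congˡ (*-cong (inverseˡ (0<! k)) (inverseˡ (0<fromℕ-suc k))) ⟩
      x * x ^ k * (1# * 1#)  ≈⟨ *-congˡ (*-identityˡ 1#) ⟩
      x * x ^ k * 1#         ≈⟨ *-identityʳ _ ⟩
      x * x ^ k              ∎))

  term-0 : ∀ x → term x 0 ≈ 1#
  term-0 x = ≈-sym (/-unique (0<! 0) (≈-trans (*-identityˡ _) fromℕ-1))

  term-cong : x ≈ y → ∀ k → term x k ≈ term y k
  term-cong x≈y k = *-congʳ (^-congˡ k x≈y)

  0≤-term : 0# ≤ x → NonNegative (term x)
  0≤-term 0≤x k = 0≤-/ (0≤-^ 0≤x k) (0<! k)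

  -- The binomial theorem without binomial coefficients: both sides satisfy (n + 1) aₙ₊₁ = (x + y)
  -- aₙ. For the convolution, `conv-weights` splits n + 1 into the two indices, and each of them is
  -- consumed by `term-suc`.
  term-+ : ∀ x y n → term (x + y) n ≈ conv (term x) (term y) n
  term-+ x y zero = begin
    term (x + y) 0         ≈⟨ term-0 (x + y) ⟩
    1#                     ≈⟨ *-identityˡ 1# ⟨
    1# * 1#                ≈⟨ *-cong (term-0 x) (term-0 y) ⟨
    term x 0 * term y 0    ∎
    where open ≈-Reasoning
  term-+ x y (suc n) = *-cancelˡ-≈ (0<fromℕ-suc n) (begin
    fromℕ (suc n) * term (x + y) (suc n)          ≈⟨ term-suc (x + y) n ⟩
    (x + y) * term (x + y) n                      ≈⟨ *-congˡ (term-+ x y n) ⟩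
    (x + y) * conv (term x) (term y) n            ≈⟨ distribʳ _ _ _ ⟩
    x * conv (term x) (term y) n + y * conv (term x) (term y) n
      ≈⟨ +-cong (≈-trans (conv-cong (term-suc x) (λ _ → ≈-refl) n) (conv-*ˡ x (term x) (term y) n))
                (≈-trans (conv-cong {term x} (λ _ → ≈-refl) (term-suc y) n) (conv-*ʳ y (term x) (term y) n)) ⟨
    conv (λ i → fromℕ (suc i) * term x (suc i)) (term y) n
      + conv (term x) (λ j → fromℕ (suc j) * term y (suc j)) n
      ≈⟨ +-cong first second ⟨
    conv (λ i → (0# + fromℕ i) * term x i) (term y) (suc n)
      + conv (term x) (λ j → fromℕ j * term y j) (suc n)
      ≈⟨ conv-weights 0# (term x) (term y) (suc n) ⟩
    (0# + fromℕ (suc n)) * conv (term x) (term y) (suc n)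
      ≈⟨ *-congʳ (+-identityˡ _) ⟩
    fromℕ (suc n) * conv (term x) (term y) (suc n) ∎)
    where
    open ≈-Reasoning
    first : conv (λ i → (0# + fromℕ i) * term x i) (term y) (suc n)
          ≈ conv (λ i → fromℕ (suc i) * term x (suc i)) (term y) n
    first = begin
      (0# + 0#) * term x 0 * term y (suc n) + conv (λ i → (0# + fromℕ (suc i)) * term x (suc i)) (term y) n
        ≈⟨ +-cong (solve 2 (λ a b → (# 0 :+ # 0) :* a :* b := # 0) ≈-refl _ _)
                  (conv-cong (λ i → *-congʳ (+-identityˡ _)) (λ _ → ≈-refl) n) ⟩
      0# + conv (λ i → fromℕ (suc i) * term x (suc i)) (term y) n ≈⟨ +-identityˡ _ ⟩
      conv (λ i → fromℕ (suc i) * term x (suc i)) (term y) n ∎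
    second : conv (term x) (λ j → fromℕ j * term y j) (suc n)
           ≈ conv (term x) (λ j → fromℕ (suc j) * term y (suc j)) n
    second = begin
      conv (term x) (λ j → fromℕ j * term y j) (suc n)
        ≈⟨ conv-last (term x) (λ j → fromℕ j * term y j) n ⟩
      Z + term x (suc n) * (0# * term y 0)
        ≈⟨ solve 3 (λ z a b → z :+ a :* (# 0 :* b) := z) ≈-refl Z (term x (suc n)) (term y 0) ⟩
      Z ∎
      where
      Z : Carrier
      Z = conv (term x) (λ j → fromℕ (suc j) * term y (suc j)) n

  private
    P : Carrier → ℕ → Carrier
    P = expPartial

    P-cong : x ≈ y → ∀ n → P x n ≈ P y n
    P-cong x≈y n = sum-cong-≋ {n} (λ i → term-cong x≈y (toℕ i))

    P-+ : ∀ x y n → P (x + y) n ≈ S (conv (term x) (term y)) n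
    P-+ x y n = sum-cong-≋ {n} (λ i → term-+ x y (toℕ i))

    P-+-≤ : 0# ≤ x → 0# ≤ y → ∀ n → P (x + y) n ≤ P x n * P y n
    P-+-≤ 0≤x 0≤y n = ≤-respˡ (≈-sym (P-+ _ _ n)) (S-conv-≤ (0≤-term 0≤x) (0≤-term 0≤y) {n} ℕ.≤-refl)

    ≤-P-+ : 0# ≤ x → 0# ≤ y → ∀ n k → P x n * P y k ≤ P (x + y) (n ℕ.+ k)
    ≤-P-+ 0≤x 0≤y n k = ≤-respʳ (≈-sym (P-+ _ _ (n ℕ.+ k))) (≤-S-conv (0≤-term 0≤x) (0≤-term 0≤y) n k)

    0≤P : 0# ≤ x → ∀ n → 0# ≤ P x n
    0≤P 0≤x n = 0≤-sum {n} (λ i → 0≤-term 0≤x (toℕ i))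

    P-geometric : 0# ≤ x → x ≤ 1# → ∀ n → P x n * (1# - x) ≤ 1#
    P-geometric {x} 0≤x x≤1 n = ≤-respʳ (term-0 x) (S-geometric (0≤-term 0≤x) ratio x≤1 n)
      where
      ratio : ∀ k → term x (suc k) ≤ x * term x k
      ratio k = ≤-respʳ (term-suc x k) (≤-by-diff (0≤-* (0≤fromℕ k) (0≤-term 0≤x (suc k)))
        (≈-trans (+-congʳ (≈-sym (*-identityˡ _))) (≈-sym (distribʳ _ _ _))))

    ½ : Carrier
    ½ = fromℕ 2 ⁻¹

    0<½ : 0# < ½
    0<½ = 0<⁻¹ (0<fromℕ-suc 1)

    1-½ : 1# - ½ ≈ ½
    1-½ = ≈-trans (+-congʳ (≈-sym (inverseʳ (0<fromℕ-suc 1)))) (solve 1 (λ h → # 2 :* h :- h := h) ≈-refl ½)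

    ½≤1 : ½ ≤ 1#
    ½≤1 = diff-0≤ (≤-respʳ (≈-sym 1-½) (<⇒≤ 0<½))

    P-½ : 0# ≤ x → x ≤ ½ → ∀ n → P x n ≤ fromℕ 2
    P-½ {x} 0≤x x≤½ n = *-cancelʳ-≤ 0<½ (begin
      P x n * ½         ≤⟨ *-monoˡ-≤ (0≤P 0≤x n) (≤-respˡ 1-½ (+-monoʳ-≤ 1# _ _ (neg-anti-≤ x≤½))) ⟩
      P x n * (1# - x)  ≤⟨ P-geometric 0≤x (≤-trans x≤½ ½≤1) n ⟩
      1#                ≈⟨ inverseʳ (0<fromℕ-suc 1) ⟨
      fromℕ 2 * ½       ∎)
      where open ≤-Reasoning

    -- `sup` is only specified on bounded sets, so a bound on the partial sums must come before
    -- anything about exp. The geometric series gives 2 on [0, ½], and the submultiplicativity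
    -- `P-+-≤` extends the bound in steps of ½.
    P-bounded-by : ∀ M → 0# ≤ x → x ≤ fromℕ M * ½ → ∃ λ u → 0# ≤ u × (∀ n → P x n ≤ u)
    P-bounded-by zero 0≤x x≤ = fromℕ 2 , 0≤fromℕ 2 ,
      P-½ 0≤x (≤-trans x≤ (≤-respˡ (≈-sym (zeroˡ ½)) (<⇒≤ 0<½)))
    P-bounded-by {x} (suc M) 0≤x x≤ with ≤-total x ½
    ... | inj₁ x≤½ = fromℕ 2 , 0≤fromℕ 2 , P-½ 0≤x x≤½
    ... | inj₂ ½≤x = u * fromℕ 2 , 0≤-* (proj₁ (proj₂ bound)) (0≤fromℕ 2) , λ n → begin
      P x n              ≈⟨ P-cong (solve 2 (λ x h → x := (x :- h) :+ h) ≈-refl x ½) n ⟩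
      P (x - ½ + ½) n    ≤⟨ P-+-≤ (0≤-diff ½≤x) (<⇒≤ 0<½) n ⟩
      P (x - ½) n * P ½ n ≤⟨ *-mono-≤ (0≤P (0≤-diff ½≤x) n) (P≤u n) (0≤P (<⇒≤ 0<½) n) (P-½ (<⇒≤ 0<½) ≤-refl n) ⟩
      u * fromℕ 2        ∎
      where
      open ≤-Reasoning
      bound : ∃ λ u → 0# ≤ u × (∀ n → P (x - ½) n ≤ u)
      bound = P-bounded-by M (0≤-diff ½≤x) (≤-respʳ
        (solve 3 (λ o h m → (o :+ m) :* h :- o :* h := m :* h) ≈-refl 1# ½ (fromℕ M))
        (+-mono-≤ x≤ (neg-anti-≤ (≤-reflexive (*-identityˡ ½)))))
      u : Carrier
      u = proj₁ bound
      P≤u : ∀ n → P (x - ½) n ≤ u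
      P≤u = proj₂ (proj₂ bound)

    P-bounded : 0# ≤ x → ∃ λ u → ∀ n → P x n ≤ u
    P-bounded {x} 0≤x =
      let M , x2≤M    = archimedean (x * fromℕ 2)
          u , _ , P≤u = P-bounded-by M 0≤x (≤-/ (0<fromℕ-suc 1) x2≤M)
      in u , P≤u

    Sums : Carrier → Carrier → Set
    Sums x s = ∃ λ n → s ≈ P x n

    Sums-bounded : 0# ≤ x → ∃ (UpperBound (Sums x))
    Sums-bounded 0≤x = proj₁ (P-bounded 0≤x) ,
      λ { s (n , s≈P) → ≤-respˡ (≈-sym s≈P) (proj₂ (P-bounded 0≤x) n) }

  P≤exp⁺ : 0# ≤ x → ∀ n → P x n ≤ exp⁺ x
  P≤exp⁺ {x} 0≤x n = sup-upper (Sums x) (P x 0 , 0 , ≈-refl) (Sums-bounded 0≤x) (P x n) (n , ≈-refl)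

  exp⁺≤ : 0# ≤ x → (∀ n → P x n ≤ y) → exp⁺ x ≤ y
  exp⁺≤ {x} {y} 0≤x P≤y = sup-least (Sums x) (P x 0 , 0 , ≈-refl) (Sums-bounded 0≤x) y
    λ { s (n , s≈P) → ≤-respˡ (≈-sym s≈P) (P≤y n) }

  private
    0≤exp⁺ : 0# ≤ x → 0# ≤ exp⁺ x
    0≤exp⁺ 0≤x = P≤exp⁺ 0≤x 0

    term-1 : ∀ x → term x 1 ≈ x
    term-1 x = begin
      term x 1              ≈⟨ *-identityˡ _ ⟨
      1# * term x 1         ≈⟨ *-congʳ fromℕ-1 ⟨
      fromℕ 1 * term x 1    ≈⟨ term-suc x 0 ⟩
      x * term x 0          ≈⟨ *-congˡ (term-0 x) ⟩
      x * 1#                ≈⟨ *-identityʳ x ⟩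
      x                     ∎
      where open ≈-Reasoning

    1+x≤exp⁺ : 0# ≤ x → 1# + x ≤ exp⁺ x
    1+x≤exp⁺ {x} 0≤x = ≤-respˡ (+-cong (term-0 x) (≈-trans (+-identityʳ _) (term-1 x))) (P≤exp⁺ 0≤x 2)

    quadratic≤exp⁺ : 0# ≤ x → fromℕ 2 + fromℕ 2 * x + x * x ≤ fromℕ 2 * exp⁺ x
    quadratic≤exp⁺ {x} 0≤x = begin
      fromℕ 2 + fromℕ 2 * x + x * x
        ≈⟨ +-cong (+-cong (≈-trans (≈-sym (*-identityʳ _)) (*-congˡ (≈-sym (term-0 x))))
            (*-congˡ (≈-sym (term-1 x))))
                  (≈-trans (*-congˡ (≈-sym (term-1 x))) (≈-sym (term-suc x 1))) ⟩
      fromℕ 2 * term x 0 + fromℕ 2 * term x 1 + fromℕ 2 * term x 2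
        ≈⟨ solve 3 (λ a b c → # 2 :* a :+ # 2 :* b :+ # 2 :* c
                      := # 2 :* (a :+ (b :+ (c :+ # 0)))) ≈-refl _ _ _ ⟩
      fromℕ 2 * P x 3      ≤⟨ *-monoˡ-≤ (0≤fromℕ 2) (P≤exp⁺ 0≤x 3) ⟩
      fromℕ 2 * exp⁺ x     ∎
      where open ≤-Reasoning

    0<exp⁺ : 0# ≤ x → 0# < exp⁺ x
    0<exp⁺ 0≤x = <-≤-trans (0<-+ 0<1 0≤x) (1+x≤exp⁺ 0≤x)

    exp⁺-cong : 0# ≤ x → x ≈ y → exp⁺ x ≈ exp⁺ y
    exp⁺-cong 0≤x x≈y = ≤-antisym
      (exp⁺≤ 0≤x λ n → ≤-respˡ (P-cong (≈-sym x≈y) n) (P≤exp⁺ 0≤y n))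
      (exp⁺≤ 0≤y λ n → ≤-respˡ (P-cong x≈y n) (P≤exp⁺ 0≤x n))
      where
      0≤y = ≤-respʳ x≈y 0≤x

    -- For the lower bound on exp⁺ (x + y) the two suprema are taken one after the other, each time
    -- after dividing by the positive other factor. The empty partial sum is 0 and cannot be divided
    -- by, hence the separate case in `lower`.
    exp⁺-+ : 0# ≤ x → 0# ≤ y → exp⁺ (x + y) ≈ exp⁺ x * exp⁺ y
    exp⁺-+ {x} {y} 0≤x 0≤y = ≤-antisym
      (exp⁺≤ 0≤x+y λ n → ≤-trans (P-+-≤ 0≤x 0≤y n)
        (*-mono-≤ (0≤P 0≤x n) (P≤exp⁺ 0≤x n) (0≤P 0≤y n) (P≤exp⁺ 0≤y n)))
      (≤-respˡ (*-comm _ _)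
          (/-≤⁻¹′ (0<exp⁺ 0≤x) (exp⁺≤ 0≤y λ k → ≤-/ (0<exp⁺ 0≤x) (≤-respˡ (*-comm _ _) (lower k)))))
      where
      0≤x+y : 0# ≤ x + y
      0≤x+y = 0≤-+ 0≤x 0≤y
      /-≤⁻¹′ : ∀ {a b c} → 0# < c → a ≤ b / c → a * c ≤ b
      /-≤⁻¹′ 0<c h = ≤-respʳ (/-*-cancel 0<c) (*-monoʳ-≤ (<⇒≤ 0<c) h)
      0<P-suc : ∀ k → 0# < P y (suc k)
      0<P-suc k = 0<-+ (<-respʳ (≈-sym (term-0 y)) 0<1) (0≤-sum {k} (λ i → 0≤-term 0≤y (suc (toℕ i))))
      lower : ∀ k → exp⁺ x * P y k ≤ exp⁺ (x + y)
      lower zero    = ≤-respˡ (≈-sym (zeroʳ _)) (0≤exp⁺ 0≤x+y)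
      lower (suc k) = /-≤⁻¹′ (0<P-suc k) (exp⁺≤ 0≤x λ n →
        ≤-/ (0<P-suc k) (≤-trans (≤-P-+ 0≤x 0≤y n (suc k)) (P≤exp⁺ 0≤x+y (n ℕ.+ suc k))))

    0≤neg : ¬ (0# ≤ x) → 0# ≤ - x
    0≤neg 0≰x = 0≤-neg (<⇒≤ (≰⇒> 0≰x))

    -- Writing x as a difference u - v of nonnegative numbers hides the case distinction in `exp`:
    -- identities for arbitrary arguments then follow from those of `exp⁺` by cancelling `exp⁺ v`.
    exp-quotient : ∀ {u v} → 0# ≤ u → 0# ≤ v → x + v ≈ u → exp x * exp⁺ v ≈ exp⁺ u
    exp-quotient {x} {u} {v} 0≤u 0≤v x+v≈u with 0# ≤? x
    ... | yes 0≤x = ≈-trans (≈-sym (exp⁺-+ 0≤x 0≤v)) (exp⁺-cong (0≤-+ 0≤x 0≤v) x+v≈u)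
    ... | no  0≰x = begin
      exp⁺ (- x) ⁻¹ * exp⁺ v                     ≈⟨ *-congˡ (exp⁺-cong 0≤v v≈) ⟩
      exp⁺ (- x) ⁻¹ * exp⁺ (- x + u)             ≈⟨ *-congˡ (exp⁺-+ (0≤neg 0≰x) 0≤u) ⟩
      exp⁺ (- x) ⁻¹ * (exp⁺ (- x) * exp⁺ u)      ≈⟨ *-assoc _ _ _ ⟨
      exp⁺ (- x) ⁻¹ * exp⁺ (- x) * exp⁺ u        ≈⟨ *-congʳ (inverseˡ (0<exp⁺ (0≤neg 0≰x))) ⟩
      1# * exp⁺ u                                ≈⟨ *-identityˡ _ ⟩
      exp⁺ u                                     ∎
      where
      open ≈-Reasoning
      v≈ : v ≈ - x + u
      v≈ = ≈-trans (solve 2 (λ x v → v := :- x :+ (x :+ v)) ≈-refl x v) (+-congˡ x+v≈u)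

    difference : ∀ x → ∃ λ u → ∃ λ v → 0# ≤ u × 0# ≤ v × x + v ≈ u
    difference x with 0# ≤? x
    ... | yes 0≤x = x , 0# , 0≤x , ≤-refl , +-identityʳ x
    ... | no  0≰x = 0# , - x , ≤-refl , 0≤neg 0≰x , -‿inverseʳ x

  0<exp : ∀ x → 0# < exp x
  0<exp x with 0# ≤? x
  ... | yes 0≤x = 0<exp⁺ 0≤x
  ... | no  0≰x = 0<⁻¹ (0<exp⁺ (0≤neg 0≰x))

  0≤exp : ∀ x → 0# ≤ exp x
  0≤exp x = <⇒≤ (0<exp x)

  exp-cong : x ≈ y → exp x ≈ exp y
  exp-cong {x} {y} x≈y with difference x
  ... | u , v , 0≤u , 0≤v , eq = *-cancelˡ-≈ (0<exp⁺ 0≤v) (begin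
      exp⁺ v * exp x   ≈⟨ *-comm _ _ ⟩
      exp x * exp⁺ v   ≈⟨ exp-quotient 0≤u 0≤v eq ⟩
      exp⁺ u           ≈⟨ exp-quotient 0≤u 0≤v (≈-trans (+-congʳ (≈-sym x≈y)) eq) ⟨
      exp y * exp⁺ v   ≈⟨ *-comm _ _ ⟩
      exp⁺ v * exp y   ∎)
    where open ≈-Reasoning

  exp-+ : ∀ x y → exp (x + y) ≈ exp x * exp y
  exp-+ x y with difference x | difference y
  ... | u , v , 0≤u , 0≤v , eq | u′ , v′ , 0≤u′ , 0≤v′ , eq′ =
    *-cancelˡ-≈ (0<exp⁺ (0≤-+ 0≤v 0≤v′)) (begin
      exp⁺ (v + v′) * exp (x + y)             ≈⟨ *-comm _ _ ⟩
      exp (x + y) * exp⁺ (v + v′)             ≈⟨ exp-quotient (0≤-+ 0≤u 0≤u′) (0≤-+ 0≤v 0≤v′) sum-eq ⟩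
      exp⁺ (u + u′)                           ≈⟨ exp⁺-+ 0≤u 0≤u′ ⟩
      exp⁺ u * exp⁺ u′                        ≈⟨ *-cong (exp-quotient 0≤u 0≤v eq) (exp-quotient 0≤u′ 0≤v′ eq′) ⟨
      exp x * exp⁺ v * (exp y * exp⁺ v′)      ≈⟨ solve 4 (λ a b c d → a :* b :* (c :* d) := b :* d :* (a :* c))
          ≈-refl _ _ _ _ ⟩
      exp⁺ v * exp⁺ v′ * (exp x * exp y)      ≈⟨ *-congʳ (exp⁺-+ 0≤v 0≤v′) ⟨
      exp⁺ (v + v′) * (exp x * exp y)         ∎)
    where
    open ≈-Reasoning
    sum-eq : x + y + (v + v′) ≈ u + u′
    sum-eq = ≈-trans (solve 4 (λ x y v w → x :+ y :+ (v :+ w) := (x :+ v) :+ (y :+ w)) ≈-refl x y v v′)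
        (+-cong eq eq′)

  exp-0 : exp 0# ≈ 1#
  exp-0 = *-cancelˡ-≈ (0<exp 0#) (begin
    exp 0# * exp 0#   ≈⟨ exp-+ 0# 0# ⟨
    exp (0# + 0#)     ≈⟨ exp-cong (+-identityˡ 0#) ⟩
    exp 0#            ≈⟨ *-identityʳ _ ⟨
    exp 0# * 1#       ∎)
    where open ≈-Reasoning

  exp-neg : ∀ x → exp x * exp (- x) ≈ 1#
  exp-neg x = ≈-trans (≈-sym (exp-+ x (- x))) (≈-trans (exp-cong (-‿inverseʳ x)) exp-0)

  -- For x ≥ 0 this is the second partial sum. For -1 ≤ x < 0 it is the geometric bound exp⁺ (- x)
  -- (1 + x) ≤ 1, where x = -1 is separate because the factor vanishes there. For x ≤ -1 the left
  -- side is not positive.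
  1+x≤exp : ∀ x → 1# + x ≤ exp x
  1+x≤exp x with 0# ≤? x
  ... | yes 0≤x = 1+x≤exp⁺ 0≤x
  ... | no  0≰x with ≤-total (- x) 1#
  ...   | inj₁ -x≤1 = ≤-respʳ (*-identityˡ _) (≤-/ (0<exp⁺ 0≤-x)
            (≤-respˡ (*-comm _ _) (≤-respˡ (*-congˡ (+-congˡ (solve 1 (λ x → :- (:- x) := x) ≈-refl x)))
              (/-bound (exp⁺≤ 0≤-x)))))
    where
    0≤-x = 0≤neg 0≰x
    /-bound : (∀ {y} → (∀ n → P (- x) n ≤ y) → exp⁺ (- x) ≤ y) → exp⁺ (- x) * (1# - - x) ≤ 1#
    /-bound least with (1# - - x) ≟ 0#
    ... | yes ≈0 = ≤-respˡ (≈-sym (≈-trans (*-congˡ ≈0) (zeroʳ _))) 0≤1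
    ... | no  ≉0 = ≤-respʳ (/-*-cancel 0<) (*-monoʳ-≤ (<⇒≤ 0<) (least λ n → ≤-/ 0< (P-geometric 0≤-x -x≤1 n)))
      where
      0< : 0# < 1# - - x
      0< = 0≤-diff -x≤1 , λ eq → ≉0 (≈-sym eq)
  ...   | inj₂ 1≤-x = ≤-trans (≤-respʳ (-‿inverseˡ x) (+-monoˡ-≤ x 1≤-x)) (0≤⁻¹ (0<exp⁺ (0≤neg 0≰x)))

  exp-mono-≤ : x ≤ y → exp x ≤ exp y
  exp-mono-≤ {x} {y} x≤y = begin
    exp x                   ≈⟨ *-identityʳ _ ⟨
    exp x * 1#              ≤⟨ *-monoˡ-≤ (0≤exp x) (≤-trans (x≤x+y (0≤-diff x≤y)) (1+x≤exp (y - x))) ⟩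
    exp x * exp (y - x)     ≈⟨ exp-+ x (y - x) ⟨
    exp (x + (y - x))       ≈⟨ exp-cong (solve 2 (λ x y → x :+ (y :- x) := y) ≈-refl x y) ⟩
    exp y                   ∎
    where open ≤-Reasoning

  1≤exp : 0# ≤ x → 1# ≤ exp x
  1≤exp 0≤x = ≤-respˡ exp-0 (exp-mono-≤ 0≤x)

  quadratic≤exp : 0# ≤ x → fromℕ 2 + fromℕ 2 * x + x * x ≤ fromℕ 2 * exp x
  quadratic≤exp {x} 0≤x with 0# ≤? x
  ... | yes _   = quadratic≤exp⁺ 0≤x
  ... | no  0≰x = contradiction 0≤x 0≰x

  exp-· : ∀ n x → exp (fromℕ n * x) ≈ exp x ^ n
  exp-· zero    x = ≈-trans (exp-cong (zeroˡ x)) exp-0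
  exp-· (suc n) x = begin
    exp ((1# + fromℕ n) * x)       ≈⟨ exp-cong (≈-trans (distribʳ _ _ _) (+-congʳ (*-identityˡ x))) ⟩
    exp (x + fromℕ n * x)          ≈⟨ exp-+ _ _ ⟩
    exp x * exp (fromℕ n * x)      ≈⟨ *-congˡ (exp-· n x) ⟩
    exp x * exp x ^ n              ∎
    where open ≈-Reasoning

-- Logarithms and ceilings

module Logarithm (ℜ : RealField) where

  open OrderLemmas ℜ
  open Exponential ℜ

  private variable
    x y z : Carrier

  private
    inhabited : 1# ≤ y → ∃ λ x → exp x ≤ y
    inhabited 1≤y = 0# , ≤-respˡ (≈-sym exp-0) 1≤y

    bounded : ∃ (UpperBound (λ x → exp x ≤ y))
    bounded {y} = y , λ x ex≤y → ≤-trans (≤-by-diff 0≤1 (+-comm x 1#)) (≤-trans (1+x≤exp x) ex≤y)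

  ≤-ln : 1# ≤ y → exp x ≤ y → x ≤ ln y
  ≤-ln 1≤y = sup-upper _ (inhabited 1≤y) bounded _

  ln-≤ : 1# ≤ y → (∀ x → exp x ≤ y → x ≤ z) → ln y ≤ z
  ln-≤ 1≤y = sup-least _ (inhabited 1≤y) bounded _

  -- An explicit step replaces continuity: if exp l < y for l = ln y, then l + ε with ε = 1 - exp l
  -- / y still has exponential at most y, which contradicts l being an upper bound.
  ≤-exp-ln : 1# ≤ y → y ≤ exp (ln y)
  ≤-exp-ln {y} 1≤y with y ≤? exp (ln y)
  ... | yes h = h
  ... | no  ¬h = contradiction (≤-ln 1≤y exp-≤) (<⇒≱ l<l+ε)
    where
    l ε : Carrier
    l = ln y
    ε = 1# - exp l * y ⁻¹
    0<y : 0# < y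
    0<y = <-≤-trans 0<1 1≤y
    el<y : exp l < y
    el<y = ≰⇒> ¬h
    ε*y : ε * y ≈ y - exp l
    ε*y = begin
      (1# - exp l * y ⁻¹) * y       ≈⟨ solve 4 (λ o e i y → (o :- e :* i) :* y := o :* y :- e :* (i :* y))
          ≈-refl 1# (exp l) (y ⁻¹) y ⟩
      1# * y - exp l * (y ⁻¹ * y)   ≈⟨ +-cong (*-identityˡ y)
          (-‿cong (≈-trans (*-congˡ (inverseˡ 0<y)) (*-identityʳ _))) ⟩
      y - exp l                     ∎
      where open ≈-Reasoning
    0<ε : 0# < ε
    0<ε = *-cancelʳ-≤ 0<y (≤-respˡ (≈-sym (zeroˡ y)) (≤-respʳ (≈-sym ε*y) (0≤-diff (<⇒≤ el<y))))
        , λ 0≈ε → proj₂ el<y (begin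
            exp l               ≈⟨ solve 2 (λ y e → e := y :- (y :- e)) ≈-refl y (exp l) ⟩
            y - (y - exp l)     ≈⟨ +-congˡ
                (-‿cong (≈-trans (≈-sym ε*y) (≈-trans (*-congʳ (≈-sym 0≈ε)) (zeroˡ y)))) ⟩
            y - 0#              ≈⟨ solve 1 (λ y → y :- # 0 := y) ≈-refl y ⟩
            y                   ∎)
      where open ≈-Reasoning
    l<l+ε : l < l + ε
    l<l+ε = x≤x+y (<⇒≤ 0<ε) , λ eq → proj₂ 0<ε (begin
      0#           ≈⟨ -‿inverseʳ l ⟨
      l - l        ≈⟨ +-congʳ eq ⟩
      l + ε - l    ≈⟨ solve 2 (λ l e → (l :+ e) :- l := e) ≈-refl l ε ⟩
      ε            ∎)
      where open ≈-Reasoning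
    -- exp ε = 1 / exp (- ε) ≤ 1 / (1 - ε) = y / exp l
    exp-≤ : exp (l + ε) ≤ y
    exp-≤ = begin
      exp (l + ε)                        ≈⟨ exp-+ l ε ⟩
      exp l * exp ε                      ≈⟨ *-identityˡ _ ⟨
      1# * (exp l * exp ε)               ≈⟨ *-congʳ (inverseʳ 0<y) ⟨
      y * y ⁻¹ * (exp l * exp ε)         ≈⟨ solve 4 (λ y i e f → y :* i :* (e :* f) := y :* (f :* (e :* i)))
          ≈-refl y (y ⁻¹) (exp l) (exp ε) ⟩
      y * (exp ε * (exp l * y ⁻¹))       ≤⟨ *-monoˡ-≤ (<⇒≤ 0<y) (*-monoˡ-≤ (0≤exp ε)
                                              (≤-respˡ (solve 2 (λ o e → o :+ :- (o :- e) := e) ≈-refl 1#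
                                                  (exp l * y ⁻¹)) (1+x≤exp (- ε)))) ⟩
      y * (exp ε * exp (- ε))            ≈⟨ *-congˡ (exp-neg ε) ⟩
      y * 1#                             ≈⟨ *-identityʳ y ⟩
      y                                  ∎
      where open ≤-Reasoning

  ^-cancel-≤ : ∀ n → 0# ≤ y → x ^ suc n ≤ y ^ suc n → x ≤ y
  ^-cancel-≤ {y} {x} n 0≤y h with x ≤? y
  ... | yes x≤y = x≤y
  ... | no  x≰y = contradiction h (<⇒≱ y^<x^)
    where
    y<x : y < x
    y<x = ≰⇒> x≰y
    0<x : 0# < x
    0<x = ≤-<-trans 0≤y y<x
    y^<x^ : y ^ suc n < x ^ suc n
    y^<x^ = ≤-<-trans (*-monoˡ-≤ 0≤y (^-mono-≤ 0≤y (<⇒≤ y<x) n))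
      ( *-monoʳ-≤ (0≤-^ (<⇒≤ 0<x) n) (<⇒≤ y<x)
      , λ eq → proj₂ y<x (*-cancelˡ-≈ (0<-^ 0<x n) (≈-trans (*-comm _ _) (≈-trans eq (*-comm _ _)))))

  -- Since exp (- ½) ≥ ½, exp ½ ≤ 2 < 3. This is what turns additive constants, such as the loss in
  -- rounding up, into multiples of a logarithm.
  half≤ln : fromℕ 3 ≤ y → 1# ≤ fromℕ 2 * ln y
  half≤ln {y} 3≤y = ≤-respˡ (inverseʳ 0<2) (*-monoˡ-≤ (0≤fromℕ 2) (≤-ln 1≤y exp½≤y))
    where
    0<2 : 0# < fromℕ 2
    0<2 = 0<fromℕ-suc 1
    ½ : Carrier
    ½ = fromℕ 2 ⁻¹
    1≤y : 1# ≤ y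
    1≤y = ≤-trans (x≤x+y (0≤fromℕ 2)) 3≤y
    exp½≤2 : exp ½ ≤ fromℕ 2
    exp½≤2 = begin
      exp ½                   ≈⟨ *-identityʳ _ ⟨
      exp ½ * 1#              ≈⟨ *-congˡ (inverseʳ 0<2) ⟨
      exp ½ * (fromℕ 2 * ½)   ≈⟨ solve 3 (λ e t h → e :* (t :* h) := t :* (e :* h)) ≈-refl _ _ _ ⟩
      fromℕ 2 * (exp ½ * ½)
        ≤⟨ *-monoˡ-≤ (0≤fromℕ 2) (*-monoˡ-≤ (0≤exp ½) (≤-respˡ 1-½ (1+x≤exp (- ½)))) ⟩
      fromℕ 2 * (exp ½ * exp (- ½))   ≈⟨ *-congˡ (exp-neg ½) ⟩
      fromℕ 2 * 1#                    ≈⟨ *-identityʳ _ ⟩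
      fromℕ 2                         ∎
      where
      open ≤-Reasoning
      1-½ : 1# - ½ ≈ ½
      1-½ = ≈-trans (+-congʳ (≈-sym (inverseʳ 0<2))) (solve 1 (λ h → # 2 :* h :- h := h) ≈-refl ½)
    exp½≤y : exp ½ ≤ y
    exp½≤y = ≤-trans exp½≤2 (≤-trans (fromℕ-mono (ℕ.n≤1+n 2)) 3≤y)

  -- 12 ≤ y³, so exp x ≤ 12 y forces exp (x / 4) ≤ y.
  ln-12* : fromℕ 3 ≤ y → ln (fromℕ 12 * y) ≤ fromℕ 4 * ln y
  ln-12* {y} 3≤y = ln-≤ 1≤12y λ x ex≤ → begin
    x                        ≈⟨ /-*-cancel 0<4 ⟨
    x / fromℕ 4 * fromℕ 4    ≈⟨ *-comm _ _ ⟩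
    fromℕ 4 * (x / fromℕ 4)  ≤⟨ *-monoˡ-≤ (0≤fromℕ 4) (≤-ln 1≤y (^-cancel-≤ 3 0≤y (pow x ex≤))) ⟩
    fromℕ 4 * ln y           ∎
    where
    open ≤-Reasoning
    0<4 : 0# < fromℕ 4
    0<4 = 0<fromℕ-suc 3
    1≤y : 1# ≤ y
    1≤y = ≤-trans (x≤x+y (0≤fromℕ 2)) 3≤y
    0≤y : 0# ≤ y
    0≤y = ≤-trans 0≤1 1≤y
    1≤12y : 1# ≤ fromℕ 12 * y
    1≤12y = ≤-trans 1≤y (≤-by-diff (0≤-* (0≤fromℕ 11) 0≤y)
      (solve 1 (λ y → y :+ # 11 :* y := # 12 :* y) ≈-refl y))
    3≤yyy : fromℕ 12 ≤ y ^ 3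
    3≤yyy = ≤-trans (fromℕ-mono {12} {27} (ℕ.m≤m+n 12 15))
      (≤-respˡ (solve 0 (# 3 :^ 3 := # 27) ≈-refl) (^-mono-≤ (0≤fromℕ 3) 3≤y 3))
    pow : ∀ x → exp x ≤ fromℕ 12 * y → exp (x / fromℕ 4) ^ 4 ≤ y ^ 4
    pow x ex≤ = begin
      exp (x / fromℕ 4) ^ 4          ≈⟨ exp-· 4 (x / fromℕ 4) ⟨
      exp (fromℕ 4 * (x / fromℕ 4))  ≈⟨ exp-cong (≈-trans (*-comm _ _) (/-*-cancel 0<4)) ⟩
      exp x                          ≤⟨ ex≤ ⟩
      fromℕ 12 * y                   ≤⟨ *-monoʳ-≤ 0≤y 3≤yyy ⟩
      y ^ 3 * y                      ≈⟨ *-comm _ _ ⟩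
      y ^ 4                          ∎

  ≤-⌈⌉ : ∀ x → x ≤ fromℕ ⌈ x ⌉
  ≤-⌈⌉ x = go (proj₁ (archimedean x)) (proj₂ (archimedean x))
    where
    go : ∀ n → x ≤ fromℕ n → x ≤ fromℕ (ceilFrom x n)
    go zero    x≤n = x≤n
    go (suc n) x≤n with x ≤? fromℕ n
    ... | yes x≤n′ = go n x≤n′
    ... | no  _    = x≤n

  ⌈⌉-≤ : 0# ≤ x → fromℕ ⌈ x ⌉ ≤ x + 1#
  ⌈⌉-≤ {x} 0≤x = go (proj₁ (archimedean x))
    where
    go : ∀ n → fromℕ (ceilFrom x n) ≤ x + 1#
    go zero    = 0≤-+ 0≤x 0≤1
    go (suc n) with x ≤? fromℕ n
    ... | yes _   = go n
    ... | no  x≰n = ≤-respʳ (+-comm _ _) (+-monoʳ-≤ 1# _ _ (<⇒≤ (≰⇒> x≰n)))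

-- Exponential estimates and tilting of Bernoulli moment generating functions

module Hoeffding (ℜ : RealField) where

  open OrderLemmas ℜ
  open Exponential ℜ

  private variable
    t p h x y : Carrier

  -- Since 1 - x ≤ exp (- x), exp x ≤ 1 / (1 - x); any y above this quotient will do, in particular
  -- a polynomial.
  exp-≤ : 0# < 1# - x → 1# ≤ y * (1# - x) → exp x ≤ y
  exp-≤ {x} {y} 0<1-x h = *-cancelʳ-≤ 0<1-x (begin
    exp x * (1# - x)      ≤⟨ *-monoˡ-≤ (0≤exp x) (1+x≤exp (- x)) ⟩
    exp x * exp (- x)     ≈⟨ exp-neg x ⟩
    1#                    ≤⟨ h ⟩
    y * (1# - x)          ∎)
    where open ≤-Reasoning

  private
    0<1-x : ∀ k → 0# ≤ x → fromℕ (2 ℕ.+ k) * x ≤ 1# → 0# < 1# - x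
    0<1-x {x} k 0≤x nx≤1 = *-cancelˡ-≤ 0<n (≤-respˡ (≈-sym (zeroʳ _)) (proj₁ 0<n[1-x]))
      , λ 0≈1-x → proj₂ 0<n[1-x] (≈-trans (≈-sym (zeroʳ _)) (*-congˡ 0≈1-x))
      where
      n : Carrier
      n = fromℕ (2 ℕ.+ k)
      0<n : 0# < n
      0<n = 0<fromℕ-suc (suc k)
      0<n[1-x] : 0# < n * (1# - x)
      0<n[1-x] = <-≤-trans 0<1 (≤-by-diff (0≤-+ (0≤-diff nx≤1) (0≤fromℕ k))
        (solve 2 (λ k x → # 1 :+ ((# 1 :- (# 1 :+ (# 1 :+ k)) :* x) :+ k)
          := (# 1 :+ (# 1 :+ k)) :* (# 1 :- x)) ≈-refl (fromℕ k) x))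

  exp-≤-1+x+2x² : 0# ≤ x → fromℕ 2 * x ≤ 1# → exp x ≤ 1# + x + fromℕ 2 * (x * x)
  exp-≤-1+x+2x² {x} 0≤x 2x≤1 = exp-≤ (0<1-x 0 0≤x 2x≤1)
    (≤-by-diff (0≤-* (0≤-sq x) (0≤-diff 2x≤1))
      (solve 1 (λ x → # 1 :+ x :* x :* (# 1 :- # 2 :* x)
        := (# 1 :+ x :+ # 2 :* (x :* x)) :* (# 1 :- x)) ≈-refl x))

  -- Again exp x ≤ 1 / (1 - x), multiplied by 3 to clear the coefficient 4 / 3 of x². With 2 in
  -- place of 4 / 3 the estimate in `upper-rate` would fall short when T is small against κ.
  3exp-≤ : 0# ≤ x → fromℕ 4 * x ≤ 1# → fromℕ 3 * exp x ≤ fromℕ 3 + fromℕ 3 * x + fromℕ 4 * (x * x)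
  3exp-≤ {x} 0≤x 4x≤1 = *-cancelʳ-≤ 0<1-x′ (begin
    fromℕ 3 * exp x * (1# - x)     ≈⟨ *-assoc _ _ _ ⟩
    fromℕ 3 * (exp x * (1# - x))   ≤⟨ *-monoˡ-≤ (0≤fromℕ 3) (*-monoˡ-≤ (0≤exp x) (1+x≤exp (- x))) ⟩
    fromℕ 3 * (exp x * exp (- x))  ≈⟨ *-congˡ (exp-neg x) ⟩
    fromℕ 3 * 1#                   ≤⟨ ≤-by-diff (0≤-* (0≤-sq x) (0≤-diff 4x≤1)) (solve 1 (λ x →
      # 3 :* # 1 :+ x :* x :* (# 1 :- # 4 :* x)
        := (# 3 :+ # 3 :* x :+ # 4 :* (x :* x)) :* (# 1 :- x)) ≈-refl x) ⟩
    (fromℕ 3 + fromℕ 3 * x + fromℕ 4 * (x * x)) * (1# - x) ∎)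
    where
    open ≤-Reasoning
    0<1-x′ : 0# < 1# - x
    0<1-x′ = 0<1-x 2 0≤x 4x≤1

  -- (2 + 2x + x²)(2 - 2x + x²) = 4 + x⁴
  2exp-neg-≤ : 0# ≤ x → fromℕ 2 * exp (- x) ≤ fromℕ 2 - fromℕ 2 * x + x * x
  2exp-neg-≤ {x} 0≤x = *-cancelʳ-≤ 0<q (begin
    fromℕ 2 * exp (- x) * q                 ≤⟨ *-monoˡ-≤ (0≤-* (0≤fromℕ 2) (0≤exp (- x))) (quadratic≤exp 0≤x) ⟩
    fromℕ 2 * exp (- x) * (fromℕ 2 * exp x) ≈⟨ solve 2 (λ a b → # 2 :* a :* (# 2 :* b) := # 4 :* (b :* a))
        ≈-refl _ _ ⟩
    fromℕ 4 * (exp x * exp (- x))           ≈⟨ *-congˡ (exp-neg x) ⟩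
    fromℕ 4 * 1#                            ≈⟨ *-identityʳ _ ⟩
    fromℕ 4                                 ≤⟨ ≤-by-diff (0≤-sq (x * x)) (solve 1 (λ x →
      # 4 :+ x :* x :* (x :* x) := (# 2 :- # 2 :* x :+ x :* x) :* (# 2 :+ # 2 :* x :+ x :* x)) ≈-refl x) ⟩
    (fromℕ 2 - fromℕ 2 * x + x * x) * q ∎)
    where
    open ≤-Reasoning
    q : Carrier
    q = fromℕ 2 + fromℕ 2 * x + x * x
    0<q : 0# < q
    0<q = 0<-+ (0<-+ (0<fromℕ-suc 1) (0≤-* (0≤fromℕ 2) 0≤x)) (0≤-sq x)

  -- The moment generating function at t of a Bernoulli variable of bias p.
  mgf : Carrier → Carrier → Carrier
  mgf t p = 1# - p + p * exp t

  -- The tangent of exp at t h lies below exp at 0 and at t; these two inequalities are averaged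
  -- with weights 1 - h and h.
  exp-convex : ∀ t → 0# ≤ h → h ≤ 1# → exp (t * h) ≤ mgf t h
  exp-convex {h} t 0≤h h≤1 = ≤-by-diff
    (0≤-+ (0≤-* (0≤-diff h≤1) (tangent 0#)) (0≤-* 0≤h (tangent t))) (begin
      e + ((1# - h) * (exp 0# - e * (1# + (0# - t * h))) + h * (exp t - e * (1# + (t - t * h))))
        ≈⟨ +-congˡ (+-congʳ (*-congˡ (+-congʳ exp-0))) ⟩
      e + ((1# - h) * (1# - e * (1# + (0# - t * h))) + h * (exp t - e * (1# + (t - t * h))))
        ≈⟨ solve 4 (λ e h f t → e :+ ((# 1 :- h) :* (# 1 :- e :* (# 1 :+ (# 0 :- t :* h)))
               :+ h :* (f :- e :* (# 1 :+ (t :- t :* h)))) := # 1 :- h :+ h :* f) ≈-refl e h (exp t) t ⟩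
      mgf t h ∎)
    where
    open ≈-Reasoning
    e : Carrier
    e = exp (t * h)
    tangent : ∀ y → 0# ≤ exp y - e * (1# + (y - t * h))
    tangent y = 0≤-diff (≤-respʳ
      (≈-trans (≈-sym (exp-+ _ _)) (exp-cong (solve 2 (λ x y → x :+ (y :- x) := y) ≈-refl (t * h) y)))
      (*-monoˡ-≤ (0≤exp _) (1+x≤exp (y - t * h))))

  module _ (s : Carrier) (0≤s : 0# ≤ s) where

    private
      r : Carrier
      r = exp s

      1≤r : 1# ≤ r
      1≤r = 1≤exp 0≤s

      rr : exp (s + s) ≈ r * r
      rr = exp-+ s s

    -- Going from parameter t to t + 2 s tilts the bias from p to p e²ˢ / M,
    -- which moves it by at most (r - 1) / (r + 1), where r = eˢ: this amounts to
    -- ((1 - p) - p r)² ≥ 0.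
    tilt : Carrier → Carrier
    tilt p = p * exp (s + s) / mgf (s + s) p

    0<mgf : 0# ≤ p → p ≤ 1# → 0# < mgf (s + s) p
    0<mgf {p} 0≤p p≤1 = <-≤-trans 0<1 (≤-by-diff (0≤-* 0≤p (0≤-diff (1≤exp (0≤-+ 0≤s 0≤s)))) (begin
      1# + p * (exp (s + s) - 1#)
        ≈⟨ solve 2 (λ p e → # 1 :+ p :* (e :- # 1) := # 1 :- p :+ p :* e) ≈-refl p (exp (s + s)) ⟩
      1# - p + p * exp (s + s)           ∎))
      where open ≈-Reasoning

    0≤tilt : 0# ≤ p → p ≤ 1# → 0# ≤ tilt p
    0≤tilt 0≤p p≤1 = 0≤-/ (0≤-* 0≤p (0≤exp _)) (0<mgf 0≤p p≤1)

    tilt≤1 : 0# ≤ p → p ≤ 1# → tilt p ≤ 1#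
    tilt≤1 {p} 0≤p p≤1 = /-≤ (0<mgf 0≤p p≤1) (≤-respʳ (≈-sym (*-identityˡ _))
      (x≤y+x (0≤-diff p≤1)))

    -- The shift (r - 1) / (r + 1) is relaxed to (r - 1) / 2. Both agree to first order as r tends
    -- to 1, which is all that matters in the limit of small steps, and clearing denominators leaves
    -- a polynomial identity in p and r.
    tilt-≤ : 0# ≤ p → p ≤ 1# → fromℕ 2 * tilt p ≤ fromℕ 2 * p + (r - 1#)
    tilt-≤ {p} 0≤p p≤1 = *-cancelʳ-≤ 0<M (begin
      fromℕ 2 * tilt p * M            ≈⟨ *-assoc _ _ _ ⟩
      fromℕ 2 * (tilt p * M)          ≈⟨ *-congˡ (/-*-cancel 0<M) ⟩
      fromℕ 2 * (p * exp (s + s))     ≈⟨ *-congˡ (*-congˡ rr) ⟩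
      fromℕ 2 * (p * (r * r))
        ≤⟨ ≤-by-diff (0≤-* (0≤-diff 1≤r) (0≤-+ (0≤-sq (1# - p - p * r))
             (0≤-* (0≤-* (0≤-* 0≤p (0≤-diff p≤1)) (0≤-+ (≤-trans 0≤1 1≤r) 0≤1)) (0≤-diff 1≤r)))) certificate ⟩
      (fromℕ 2 * p + (r - 1#)) * (1# - p + p * (r * r))
        ≈⟨ *-congˡ (+-congˡ (*-congˡ rr)) ⟨
      (fromℕ 2 * p + (r - 1#)) * M ∎)
      where
      open ≤-Reasoning
      M : Carrier
      M = mgf (s + s) p
      0<M : 0# < M
      0<M = 0<mgf 0≤p p≤1
      certificate : fromℕ 2 * (p * (r * r))
        + (r - 1#) * ((1# - p - p * r) * (1# - p - p * r) + p * (1# - p) * (r + 1#) * (r - 1#))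
        ≈ (fromℕ 2 * p + (r - 1#)) * (1# - p + p * (r * r))
      certificate = solve 2 (λ p r → # 2 :* (p :* (r :* r)) :+ (r :- # 1) :*
               ((# 1 :- p :- p :* r) :* (# 1 :- p :- p :* r)
                 :+ p :* (# 1 :- p) :* (r :+ # 1) :* (r :- # 1))
               := (# 2 :* p :+ (r :- # 1)) :* (# 1 :- p :+ p :* (r :* r))) ≈-refl p r

    mgf-tilt : ∀ u → 0# ≤ p → p ≤ 1# → mgf (s + s + u) p ≈ mgf (s + s) p * mgf u (tilt p)
    mgf-tilt {p} u 0≤p p≤1 = begin
      1# - p + p * exp (s + s + u)        ≈⟨ +-congˡ (*-congˡ (exp-+ (s + s) u)) ⟩
      1# - p + p * (E * U)                ≈⟨ solve 4 (λ o p e u → o :- p :+ p :* (e :* u)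
                                               := (o :- p :+ p :* e) :- p :* e :+ p :* e :* u) ≈-refl 1# p E U ⟩
      M - p * E + p * E * U               ≈⟨ +-cong (+-cong (*-identityʳ M) (-‿cong p′M)) (*-congʳ p′M) ⟨
      M * 1# - tilt p * M + tilt p * M * U ≈⟨ solve 4
          (λ o m t u → m :* o :- t :* m :+ t :* m :* u := m :* (o :- t :+ t :* u)) ≈-refl 1# M (tilt p) U ⟩
      M * mgf u (tilt p)                  ∎
      where
      open ≈-Reasoning
      E U M : Carrier
      E = exp (s + s)
      U = exp u
      M = mgf (s + s) p
      p′M : tilt p * M ≈ p * E
      p′M = /-*-cancel (0<mgf 0≤p p≤1)

    private
      W : Carrier
      W = exp (s + s) - 1#

      0≤W : 0# ≤ W
      0≤W = 0≤-diff (1≤exp (0≤-+ 0≤s 0≤s))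

    -- In step i the bias is at most p + 2 i v, as one tilt adds at most (r - 1) / 2 ≤ 2 v, and the
    -- step contributes at most W times the bias to the exponent. Summing over i < n gives W (n p +
    -- n (n - 1) v), rounded up to n² v.
    mgf-multiple : ∀ v → r - 1# ≤ fromℕ 4 * v → ∀ n → 0# ≤ p → p ≤ 1# →
                   mgf (fromℕ n * (s + s)) p ≤ exp (W * (fromℕ n * p + fromℕ n * fromℕ n * v))
    mgf-multiple {p} v r-1≤4v zero 0≤p p≤1 = begin
      1# - p + p * exp (0# * (s + s))   ≈⟨ +-congˡ (*-congˡ (≈-trans (exp-cong (zeroˡ _)) exp-0)) ⟩
      1# - p + p * 1#                   ≈⟨ +-congˡ (*-identityʳ p) ⟩
      1# - p + p                        ≈⟨ solve 2 (λ o p → o :- p :+ p := o) ≈-refl 1# p ⟩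
      1#                                ≈⟨ exp-0 ⟨
      exp 0#                            ≈⟨ exp-cong
          (solve 3 (λ w p v → w :* (# 0 :* p :+ # 0 :* # 0 :* v) := # 0) ≈-refl W p v) ⟨
      exp (W * (0# * p + 0# * 0# * v))  ∎
      where open ≤-Reasoning
    mgf-multiple {p} v r-1≤4v (suc n) 0≤p p≤1 = begin
      mgf (fromℕ (suc n) * (s + s)) p
        ≈⟨ +-congˡ (*-congˡ (exp-cong (≈-trans (distribʳ _ _ _) (+-congʳ (*-identityˡ _))))) ⟩
      mgf (s + s + fromℕ n * (s + s)) p                     ≈⟨ mgf-tilt (fromℕ n * (s + s)) 0≤p p≤1 ⟩
      mgf (s + s) p * mgf (fromℕ n * (s + s)) p′
        ≤⟨ *-mono-≤ (<⇒≤ (0<mgf 0≤p p≤1)) first 0≤mgf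
            (mgf-multiple v r-1≤4v n (0≤tilt 0≤p p≤1) (tilt≤1 0≤p p≤1)) ⟩
      exp (W * p) * exp (W * (N * p′ + N * N * v))          ≈⟨ exp-+ _ _ ⟨
      exp (W * p + W * (N * p′ + N * N * v))                ≤⟨ exp-mono-≤ exponent ⟩
      exp (W * (fromℕ (suc n) * p + fromℕ (suc n) * fromℕ (suc n) * v)) ∎
      where
      open ≤-Reasoning
      N p′ : Carrier
      N = fromℕ n
      p′ = tilt p
      0≤mgf : 0# ≤ mgf (fromℕ n * (s + s)) p′
      0≤mgf = 0≤-+ (0≤-diff (tilt≤1 0≤p p≤1)) (0≤-* (0≤tilt 0≤p p≤1) (0≤exp _))
      first : mgf (s + s) p ≤ exp (W * p)
      first = ≤-respˡ (begin-equality
        1# + (exp (s + s) - 1#) * p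
          ≈⟨ solve 2 (λ p e → # 1 :+ (e :- # 1) :* p := # 1 :- p :+ p :* e) ≈-refl p (exp (s + s)) ⟩
        mgf (s + s) p                     ∎) (1+x≤exp (W * p))
      0≤v : 0# ≤ v
      0≤v = *-cancelˡ-≤ (0<fromℕ-suc 3) (≤-respˡ (≈-sym (zeroʳ _)) (≤-trans (0≤-diff 1≤r) r-1≤4v))
      p′≤ : p′ ≤ p + fromℕ 2 * v
      p′≤ = *-cancelˡ-≤ (0<fromℕ-suc 1) (≤-trans (tilt-≤ 0≤p p≤1) (≤-respʳ
        (solve 2 (λ p v → # 2 :* p :+ # 4 :* v := # 2 :* (p :+ # 2 :* v)) ≈-refl p v)
        (+-monoʳ-≤ _ _ _ r-1≤4v)))
      exponent : W * p + W * (N * p′ + N * N * v) ≤ W * (fromℕ (suc n) * p + fromℕ (suc n) * fromℕ (suc n) * v)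
      exponent = begin
        W * p + W * (N * p′ + N * N * v)
          ≤⟨ +-monoʳ-≤ _ _ _ (*-monoˡ-≤ 0≤W (+-monoˡ-≤ _ (*-monoˡ-≤ (0≤fromℕ n) p′≤))) ⟩
        W * p + W * (N * (p + fromℕ 2 * v) + N * N * v)
          ≤⟨ ≤-by-diff (0≤-* 0≤W 0≤v) (solve 4 (λ w p n v →
               w :* p :+ w :* (n :* (p :+ # 2 :* v) :+ n :* n :* v) :+ w :* v
               := w :* ((# 1 :+ n) :* p :+ (# 1 :+ n) :* (# 1 :+ n) :* v)) ≈-refl W p N v) ⟩
        W * (fromℕ (suc n) * p + fromℕ (suc n) * fromℕ (suc n) * v) ∎

-- Hoeffding's lemma in the limit of small tilting steps

module HoeffdingLemma (ℜ : RealField) where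

  open OrderLemmas ℜ
  open Exponential ℜ
  open Hoeffding ℜ

  private variable
    x x′ p : Carrier

  ≤-+c/n⇒≤ : ∀ b c → 0# ≤ b → 0# ≤ c →
             (∀ n → b ≤ fromℕ (suc n) → x ≤ x′ + c / fromℕ (suc n)) → x ≤ x′
  ≤-+c/n⇒≤ {x} {x′} b c 0≤b 0≤c h = ≤-+ε⇒≤ λ ε 0<ε →
    let n , b+c/ε≤n = archimedean (b + c / ε)
        n≤1+n : fromℕ n ≤ fromℕ (suc n)
        n≤1+n = fromℕ-mono (ℕ.n≤1+n n)
        b≤n : b ≤ fromℕ (suc n)
        b≤n = ≤-trans (x≤x+y (0≤-/ 0≤c 0<ε)) (≤-trans b+c/ε≤n n≤1+n)
        c/ε≤n : c / ε ≤ fromℕ (suc n)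
        c/ε≤n = ≤-trans (x≤y+x 0≤b) (≤-trans b+c/ε≤n n≤1+n)
    in ≤-trans (h n b≤n) (+-monoʳ-≤ x′ _ _ (/-≤ (0<fromℕ-suc n)
         (≤-respʳ (*-comm _ _) (/-≤⁻¹ 0<ε c/ε≤n))))

  -- Parameter t = 8 T makes t² / 8 equal to 8 T². With N steps, y = T / N and 2 s = 8 y, to first
  -- order W is 8 y and v is y, so the exponent in `mgf-multiple` tends to 8 (T p + T²); `D` bounds
  -- the excess, which is of order 1 / N.
  mgf-≤-exp : ∀ T → 0# ≤ T → 0# ≤ p → p ≤ 1# → mgf (fromℕ 8 * T) p ≤ exp (fromℕ 8 * (T * p + T * T))
  mgf-≤-exp {p} T 0≤T 0≤p p≤1 = ≤-+c/n⇒≤ (fromℕ 16 * T) c (0≤-* (0≤fromℕ 16) 0≤T) 0≤c λ n 16T≤n →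
    ≤-by-diff (0≤-diff (refined n 16T≤n)) (begin
      M + (exp B - M * (1# - D n))   ≈⟨ solve 3 (λ m e d → m :+ (e :- m :* (# 1 :- d)) := e :+ m :* d) ≈-refl M
          (exp B) (D n) ⟩
      exp B + M * D n                ≈⟨ +-congˡ (solve 4 (λ m t i b → m :* (# 3 :* (# 16 :* (t :* i)) :* b)
                                          := m :* (# 48 :* t :* b) :* i) ≈-refl M T (fromℕ (suc n) ⁻¹) B) ⟩
      exp B + c / fromℕ (suc n)      ∎)
    where
    open ≈-Reasoning
    M B c : Carrier
    M = mgf (fromℕ 8 * T) p
    B = fromℕ 8 * (T * p + T * T)
    c = M * (fromℕ 48 * T * B)
    0≤M : 0# ≤ M
    0≤M = 0≤-+ (0≤-diff p≤1) (0≤-* 0≤p (0≤exp _))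
    0≤B : 0# ≤ B
    0≤B = 0≤-* (0≤fromℕ 8) (0≤-+ (0≤-* 0≤T 0≤p) (0≤-sq T))
    0≤c : 0# ≤ c
    0≤c = 0≤-* 0≤M (0≤-* (0≤-* (0≤fromℕ 48) 0≤T) 0≤B)
    D : ℕ → Carrier
    D n = fromℕ 3 * (fromℕ 16 * (T / fromℕ (suc n))) * B
    module _ (n : ℕ) (16T≤n : fromℕ 16 * T ≤ fromℕ (suc n)) where
      N y s v W : Carrier
      N = fromℕ (suc n)
      y = T / N
      s = fromℕ 4 * y
      v = y + fromℕ 8 * (y * y)
      W = exp (s + s) - 1#
      0<N : 0# < N
      0<N = 0<fromℕ-suc n
      0≤y : 0# ≤ y
      0≤y = 0≤-/ 0≤T 0<N
      Ny : N * y ≈ T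
      Ny = ≈-trans (*-comm _ _) (/-*-cancel 0<N)
      16y≤1 : fromℕ 16 * y ≤ 1#
      16y≤1 = *-cancelˡ-≤ 0<N (≤-respˡ (begin
        fromℕ 16 * T        ≈⟨ *-congˡ Ny ⟨
        fromℕ 16 * (N * y)  ≈⟨ solve 3 (λ a n y → a :* (n :* y) := n :* (a :* y)) ≈-refl _ _ _ ⟩
        N * (fromℕ 16 * y)  ∎) (≤-respʳ (≈-sym (*-identityʳ N)) 16T≤n))
      0≤s : 0# ≤ s
      0≤s = 0≤-* (0≤fromℕ 4) 0≤y
      2s≤1 : fromℕ 2 * s ≤ 1#
      2s≤1 = ≤-trans (≤-by-diff (0≤-* (0≤fromℕ 8) 0≤y)
          (solve 1 (λ y → # 2 :* (# 4 :* y) :+ # 8 :* y := # 16 :* y) ≈-refl y)) 16y≤1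
      r-1≤4v : exp s - 1# ≤ fromℕ 4 * v
      r-1≤4v = ≤-respʳ (solve 1 (λ y → # 1 :+ # 4 :* y :+ # 2 :* (# 4 :* y :* (# 4 :* y)) :- # 1
                 := # 4 :* (y :+ # 8 :* (y :* y))) ≈-refl y)
               (+-monoˡ-≤ (- 1#) (exp-≤-1+x+2x² 0≤s 2s≤1))
      W≤ : W ≤ fromℕ 8 * y * (1# + fromℕ 16 * y)
      W≤ = ≤-respʳ (solve 1 (λ y → # 1 :+ (# 4 :* y :+ # 4 :* y)
                      :+ # 2 :* ((# 4 :* y :+ # 4 :* y) :* (# 4 :* y :+ # 4 :* y)) :- # 1
                 := # 8 :* y :* (# 1 :+ # 16 :* y)) ≈-refl y)
               (+-monoˡ-≤ (- 1#) (exp-≤-1+x+2x² (0≤-+ 0≤s 0≤s)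
                 (≤-respˡ (solve 1 (λ y → # 16 :* y := # 2 :* (# 4 :* y :+ # 4 :* y)) ≈-refl y) 16y≤1)))
      exponent : W * (N * p + N * N * v) ≤ B + D n
      exponent = ≤-trans (*-monoʳ-≤ 0≤rest W≤) (≤-respˡ (≈-sym rewritten)
        (≤-by-diff (0≤-* (0≤-* (0≤fromℕ 16) 0≤y) (0≤-+
            (0≤-+ (0≤-* (0≤fromℕ 16) (0≤-* 0≤T 0≤p)) (0≤-* (0≤fromℕ 8) (0≤-sq T)))
            (0≤-* (0≤-* (0≤fromℕ 4) (0≤-sq T)) (0≤-diff 16y≤1))))
          (solve 3 (λ t p y → let z = # 16 :* y
                                  b = # 8 :* (t :* p :+ t :* t)
                              in # 8 :* t :* (# 1 :+ z) :* (p :+ t :* (# 1 :+ # 8 :* y))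
                   :+ z :* (# 16 :* (t :* p) :+ # 8 :* (t :* t) :+ # 4 :* (t :* t) :* (# 1 :- z))
                   := b :+ # 3 :* z :* b) ≈-refl T p y)))
        where
        0≤rest : 0# ≤ N * p + N * N * v
        0≤rest = 0≤-+ (0≤-* (<⇒≤ 0<N) 0≤p)
            (0≤-* (0≤-* (<⇒≤ 0<N) (<⇒≤ 0<N)) (0≤-+ 0≤y (0≤-* (0≤fromℕ 8) (0≤-sq y))))
        rewritten : fromℕ 8 * y * (1# + fromℕ 16 * y) * (N * p + N * N * v)
          ≈ fromℕ 8 * T * (1# + fromℕ 16 * y) * (p + T * (1# + fromℕ 8 * y))
        rewritten = begin
          fromℕ 8 * y * (1# + fromℕ 16 * y) * (N * p + N * N * v)
            ≈⟨ solve 3 (λ n p y → # 8 :* y :* (# 1 :+ # 16 :* y) :* (n :* p :+ n :* n :* (y :+ # 8 :* (y :* y)))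
                 := # 8 :* (n :* y) :* (# 1 :+ # 16 :* y) :* (p :+ (n :* y) :* (# 1 :+ # 8 :* y))) ≈-refl N p y
                     ⟩
          fromℕ 8 * (N * y) * (1# + fromℕ 16 * y) * (p + N * y * (1# + fromℕ 8 * y))
            ≈⟨ *-cong (*-congʳ (*-congˡ Ny)) (+-congˡ (*-congʳ Ny)) ⟩
          fromℕ 8 * T * (1# + fromℕ 16 * y) * (p + T * (1# + fromℕ 8 * y)) ∎
      -- Multiplying by exp (- D) ≥ 1 - D makes the error linear in D, hence exactly c / N, instead
      -- of leaving it inside an exponential.
      refined : M * (1# - D n) ≤ exp B
      refined = ≤R.begin
        M * (1# - D n)                 ≤R.≤⟨ *-monoˡ-≤ 0≤M (1+x≤exp (- D n)) ⟩
        M * exp (- D n)                ≤R.≤⟨ *-monoʳ-≤ (0≤exp _) M≤ ⟩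
        exp (B + D n) * exp (- D n)    ≤R.≈⟨ exp-+ _ _ ⟨
        exp (B + D n + - D n)          ≤R.≈⟨ exp-cong (solve 2 (λ b d → b :+ d :+ :- d := b) ≈-refl B (D n)) ⟩
        exp B                          ≤R.∎
        where
        module ≤R = ≤-Reasoning
        N*2s : fromℕ 8 * T ≈ N * (s + s)
        N*2s = ≈-trans (*-congˡ (≈-sym Ny)) (solve 2 (λ n y → # 8 :* (n :* y) := n :* (# 4 :* y :+ # 4 :* y))
            ≈-refl N y)
        M≤ : M ≤ exp (B + D n)
        M≤ = ≤-respˡ (+-congˡ (*-congˡ (exp-cong (≈-sym N*2s))))
          (≤-trans (mgf-multiple s 0≤s v r-1≤4v (suc n) 0≤p p≤1) (exp-mono-≤ exponent))

  expectation : ∀ {n} → Distribution n → (Fin n → Carrier) → Carrier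
  expectation d f = sum λ i → weight d i * f i

  module _ {n} (d : Distribution n) where

    private
      w : Fin n → Carrier
      w = weight d

      0≤w : ∀ i → 0# ≤ w i
      0≤w = Distribution.nonNeg d

    expectation-cong : ∀ {f g} → (∀ i → f i ≈ g i) → expectation d f ≈ expectation d g
    expectation-cong f≈g = sum-cong-≋ {n} λ i → *-congˡ (f≈g i)

    expectation-mono : ∀ {f g} → (∀ i → f i ≤ g i) → expectation d f ≤ expectation d g
    expectation-mono f≤g = sum-mono-≤ λ i → *-monoˡ-≤ (0≤w i) (f≤g i)

    expectation-const : ∀ c → expectation d (λ _ → c) ≈ c
    expectation-const c = ≈-trans (≈-sym (*-distribʳ-sum {n} c w))
        (≈-trans (*-congʳ (Distribution.total d)) (*-identityˡ c))

    expectation-+ : ∀ f g → expectation d (λ i → f i + g i) ≈ expectation d f + expectation d g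
    expectation-+ f g = ≈-trans (sum-cong-≋ {n} (λ i → distribˡ (w i) (f i) (g i))) (∑-distrib-+ {n} _ _)

    expectation-*ˡ : ∀ c f → expectation d (λ i → c * f i) ≈ c * expectation d f
    expectation-*ˡ c f = ≈-trans
        (sum-cong-≋ {n} (λ i → solve 3 (λ w c f → w :* (c :* f) := c :* (w :* f)) ≈-refl (w i) c (f i)))
      (≈-sym (*-distribˡ-sum {n} c _))

    expectation-affine : ∀ a b f → expectation d (λ i → a + b * f i) ≈ a + b * expectation d f
    expectation-affine a b f = ≈-trans (expectation-+ (λ _ → a) (λ i → b * f i))
      (+-cong (expectation-const a) (expectation-*ˡ b f))

    expectation-∈[0,1] : ∀ {f} → (∀ i → 0# ≤ f i) → (∀ i → f i ≤ 1#) → 0# ≤ expectation d f × expectation d f ≤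
        1#
    expectation-∈[0,1] 0≤f f≤1 = 0≤-sum (λ i → 0≤-* (0≤w i) (0≤f i))
      , ≤-respʳ (expectation-const 1#) (expectation-mono f≤1)

    -- After the convexity bound the integrand is affine in f, so its expectation depends on f
    -- through the mean only: a Bernoulli variable of the same mean is the worst case.
    hoeffding : ∀ {f} T → 0# ≤ T → (∀ i → 0# ≤ f i) → (∀ i → f i ≤ 1#) →
      expectation d (λ i → exp (fromℕ 8 * T * f i)) ≤ exp (fromℕ 8 * (T * expectation d f + T * T))
    hoeffding {f} T 0≤T 0≤f f≤1 = begin
      expectation d (λ i → exp (t * f i))
        ≤⟨ expectation-mono (λ i → exp-convex t (0≤f i) (f≤1 i)) ⟩
      expectation d (λ i → mgf t (f i))
        ≈⟨ expectation-cong (λ i → mgf-affine (f i)) ⟩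
      expectation d (λ i → 1# + (exp t - 1#) * f i)
        ≈⟨ expectation-affine 1# (exp t - 1#) f ⟩
      1# + (exp t - 1#) * expectation d f
        ≈⟨ mgf-affine _ ⟨
      mgf t (expectation d f)
        ≤⟨ mgf-≤-exp T 0≤T (proj₁ μ∈) (proj₂ μ∈) ⟩
      exp (fromℕ 8 * (T * expectation d f + T * T)) ∎
      where
      open ≤-Reasoning
      t : Carrier
      t = fromℕ 8 * T
      μ∈ = expectation-∈[0,1] 0≤f f≤1
      mgf-affine : ∀ p → mgf t p ≈ 1# + (exp t - 1#) * p
      mgf-affine p = solve 2 (λ p e → # 1 :- p :+ p :* e := # 1 :+ (e :- # 1) :* p) ≈-refl p (exp t)

-- Expectations over finitely supported experiments and independent samples

module RandomExperiments (ℜ : RealField) where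

  open OrderLemmas ℜ
  open HoeffdingLemma ℜ

  private variable
    A B : Set

  average : ∀ n → .{{NonZero n}} → (Fin n → Carrier) → Carrier
  average n f = sum f / fromℕ n

  average-cong : ∀ n → .{{_ : NonZero n}} → ∀ {f g} → (∀ i → f i ≈ g i) → average n f ≈ average n g
  average-cong n f≈g = *-congʳ (sum-cong-≋ {n} f≈g)

  average-mono : ∀ n → .{{_ : NonZero n}} → ∀ {f g} → (∀ i → f i ≤ g i) → average n f ≤ average n g
  average-mono n f≤g = *-monoʳ-≤ (0≤⁻¹ (0<fromℕ n)) (sum-mono-≤ f≤g)

  average-const : ∀ n → .{{_ : NonZero n}} → ∀ c → average n (λ _ → c) ≈ c
  average-const n c = ≈-sym (/-unique (0<fromℕ n) (≈-sym (≈-trans (sum-replicate n) (n·c n))))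
    where
    n·c : ∀ n → n · c ≈ c * fromℕ n
    n·c zero    = ≈-sym (zeroʳ c)
    n·c (suc n) = ≈-trans (+-cong (≈-sym (*-identityʳ c)) (n·c n)) (≈-sym (distribˡ _ _ _))

  average-+ : ∀ n → .{{_ : NonZero n}} → ∀ f g → average n (λ i → f i + g i) ≈ average n f + average n g
  average-+ n f g = ≈-trans (*-congʳ (∑-distrib-+ {n} f g)) (distribʳ _ _ _)

  average-*ˡ : ∀ n → .{{_ : NonZero n}} → ∀ c f → average n (λ i → c * f i) ≈ c * average n f
  average-*ˡ n c f = ≈-trans (*-congʳ (≈-sym (*-distribˡ-sum {n} c f))) (*-assoc _ _ _)

  Ex : (A → Carrier) → Rand A → Carrier
  Ex f (pure a)      = f a
  Ex f (choose d k)  = expectation d λ i → Ex f (k i)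
  Ex f (uniform n k) = average n λ i → Ex f (k i)

  indicator : Bool → Carrier
  indicator b = if b then 1# else 0#

  Pr≈Ex : ∀ (E : A → Bool) r → Pr E r ≈ Ex (indicator ∘ E) r
  Pr≈Ex E (pure a)      = ≈-refl
  Pr≈Ex E (choose d k)  = expectation-cong d λ i → Pr≈Ex E (k i)
  Pr≈Ex E (uniform n k) = average-cong n λ i → Pr≈Ex E (k i)

  Ex-cong : ∀ {f g : A → Carrier} → (∀ a → f a ≈ g a) → ∀ r → Ex f r ≈ Ex g r
  Ex-cong f≈g (pure a)      = f≈g a
  Ex-cong f≈g (choose d k)  = expectation-cong d λ i → Ex-cong f≈g (k i)
  Ex-cong f≈g (uniform n k) = average-cong n λ i → Ex-cong f≈g (k i)

  Ex-mono : ∀ {f g : A → Carrier} → (∀ a → f a ≤ g a) → ∀ r → Ex f r ≤ Ex g r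
  Ex-mono f≤g (pure a)      = f≤g a
  Ex-mono f≤g (choose d k)  = expectation-mono d λ i → Ex-mono f≤g (k i)
  Ex-mono f≤g (uniform n k) = average-mono n λ i → Ex-mono f≤g (k i)

  Ex-const : ∀ c (r : Rand A) → Ex (λ _ → c) r ≈ c
  Ex-const c (pure a)      = ≈-refl
  Ex-const c (choose d k)  = ≈-trans (expectation-cong d λ i → Ex-const c (k i)) (expectation-const d c)
  Ex-const c (uniform n k) = ≈-trans (average-cong n λ i → Ex-const c (k i)) (average-const n c)

  Ex-+ : ∀ (f g : A → Carrier) r → Ex (λ a → f a + g a) r ≈ Ex f r + Ex g r
  Ex-+ f g (pure a)      = ≈-refl
  Ex-+ f g (choose d k)  = ≈-trans (expectation-cong d λ i → Ex-+ f g (k i)) (expectation-+ d _ _)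
  Ex-+ f g (uniform n k) = ≈-trans (average-cong n λ i → Ex-+ f g (k i)) (average-+ n _ _)

  Ex-sum : ∀ {n} (f : Fin n → A → Carrier) r → (∑[ i < n ] Ex (f i) r) ≈ Ex (λ a → ∑[ i < n ] f i a) r
  Ex-sum {n = zero}  f r = ≈-sym (Ex-const 0# r)
  Ex-sum {n = suc n} f r = ≈-trans (+-congˡ (Ex-sum (f ∘ fsuc) r)) (≈-sym (Ex-+ (f fzero) _ r))

  Ex-≤ : ∀ {f : A → Carrier} {c} → (∀ a → f a ≤ c) → ∀ r → Ex f r ≤ c
  Ex-≤ f≤c r = ≤-respʳ (Ex-const _ r) (Ex-mono f≤c r)

  Ex-bind : ∀ (f : B → Carrier) (g : A → Rand B) r → Ex f (r >>= g) ≈ Ex (λ a → Ex f (g a)) r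
  Ex-bind f g (pure a)      = ≈-refl
  Ex-bind f g (choose d k)  = expectation-cong d λ i → Ex-bind f g (k i)
  Ex-bind f g (uniform n k) = average-cong n λ i → Ex-bind f g (k i)

  0≤Pr : ∀ (E : A → Bool) r → 0# ≤ Pr E r
  0≤Pr E r = ≤-respʳ (≈-sym (Pr≈Ex E r)) (≤-respˡ (Ex-const 0# r) (Ex-mono (λ a → 0≤ind (E a)) r))
    where
    0≤ind : ∀ b → 0# ≤ indicator b
    0≤ind true  = 0≤1
    0≤ind false = ≤-refl

  Pr≤1 : ∀ (E : A → Bool) r → Pr E r ≤ 1#
  Pr≤1 E r = ≤-respˡ (≈-sym (Pr≈Ex E r)) (Ex-≤ (λ a → ind≤1 (E a)) r)
    where
    ind≤1 : ∀ b → indicator b ≤ 1#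
    ind≤1 true  = ≤-refl
    ind≤1 false = 0≤1

  sum-++ : ∀ a {b} (f : Fin (a ℕ.+ b) → Carrier) → sum f ≈ (∑[ i < a ] f (i ↑ˡ b)) + (∑[ i < b ] f (a ↑ʳ i))
  sum-++ zero    f = ≈-sym (+-identityˡ _)
  sum-++ (suc a) f = ≈-trans (+-congˡ (sum-++ a (f ∘ fsuc))) (≈-sym (+-assoc _ _ _))

  ExVec : ∀ {N} → Distribution N → ∀ n → (Vec (Fin N) n → Carrier) → Carrier
  ExVec d zero    F = F []
  ExVec d (suc n) F = expectation d λ x → ExVec d n λ xs → F (x ∷ xs)

  module _ {N} (d : Distribution N) where

    ExVec-mono : ∀ n {F G} → (∀ xs → F xs ≤ G xs) → ExVec d n F ≤ ExVec d n G
    ExVec-mono zero    F≤G = F≤G []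
    ExVec-mono (suc n) F≤G = expectation-mono d λ x → ExVec-mono n λ xs → F≤G (x ∷ xs)

    ExVec-cong : ∀ n {F G} → (∀ xs → F xs ≈ G xs) → ExVec d n F ≈ ExVec d n G
    ExVec-cong zero    F≈G = F≈G []
    ExVec-cong (suc n) F≈G = expectation-cong d λ x → ExVec-cong n λ xs → F≈G (x ∷ xs)

    ExVec-const : ∀ n c → ExVec d n (λ _ → c) ≈ c
    ExVec-const zero    c = ≈-refl
    ExVec-const (suc n) c = ≈-trans (expectation-cong d λ x → ExVec-const n c) (expectation-const d c)

    ExVec-+ : ∀ n F G → ExVec d n (λ xs → F xs + G xs) ≈ ExVec d n F + ExVec d n G
    ExVec-+ zero    F G = ≈-refl
    ExVec-+ (suc n) F G = ≈-trans (expectation-cong d λ x → ExVec-+ n (λ xs → F (x ∷ xs)) (λ xs → G (x ∷ xs)))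
        (expectation-+ d _ _)

    ExVec-*ˡ : ∀ n c F → ExVec d n (λ xs → c * F xs) ≈ c * ExVec d n F
    ExVec-*ˡ zero    c F = ≈-refl
    ExVec-*ˡ (suc n) c F = ≈-trans (expectation-cong d λ x → ExVec-*ˡ n c (λ xs → F (x ∷ xs)))
        (expectation-*ˡ d c _)

  sumVec : ∀ {N n} → (Fin N → Carrier) → Vec (Fin N) n → Carrier
  sumVec f xs = sum λ j → f (Vec.lookup xs j)

-- Upper tail of a sample mean

module SamplingTail (ℜ : RealField) where

  open OrderLemmas ℜ
  open Exponential ℜ
  open HoeffdingLemma ℜ
  open RandomExperiments ℜ

  module _ {N} (d : Distribution N) {f : Fin N → Carrier}
           (0≤f : ∀ i → 0# ≤ f i) (f≤1 : ∀ i → f i ≤ 1#) (T : Carrier) (0≤T : 0# ≤ T) where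

    private
      μ t : Carrier
      μ = expectation d f
      t = fromℕ 8 * T

    -- The Chernoff weight of the event that the sample mean exceeds μ + 2 T.
    excess : ∀ {n} → Vec (Fin N) n → Carrier
    excess {n} xs = exp (t * (sumVec f xs - fromℕ n * (μ + fromℕ 2 * T)))

    0≤excess : ∀ {n} (xs : Vec (Fin N) n) → 0# ≤ excess xs
    0≤excess xs = 0≤exp _

    1≤excess : ∀ {n} (xs : Vec (Fin N) n) → fromℕ n * (μ + fromℕ 2 * T) ≤ sumVec f xs → 1# ≤ excess xs
    1≤excess xs h = 1≤exp (0≤-* (0≤-* (0≤fromℕ 8) 0≤T) (0≤-diff h))

    -- Each draw contributes exp (8 T μ + 8 T²) by Hoeffding's lemma against the normalisation exp
    -- (- 8 T μ - 16 T²), a net factor exp (- 8 T²). For the deviation 2 T this is the sharp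
    -- exponent 2 (2 T)².
    excess-tail : ∀ n → ExVec d n excess ≤ exp (- (fromℕ n * (fromℕ 8 * (T * T))))
    excess-tail zero = ≤-reflexive (exp-cong (solve 3 (λ t m u → t :* (# 0 :- # 0 :* m)
      := :- (# 0 :* (# 8 :* u))) ≈-refl t (μ + fromℕ 2 * T) (T * T)))
    excess-tail (suc n) = begin
      expectation d (λ x → ExVec d n λ xs → excess (x ∷ xs))
        ≈⟨ expectation-cong d (λ x → ≈-trans (ExVec-cong d n (split x)) (ExVec-*ˡ d n _ _)) ⟩
      expectation d (λ x → c * exp (t * f x) * ExVec d n excess)
        ≈⟨ expectation-cong d (λ x → solve 3 (λ c e r → c :* e :* r := c :* r :* e) ≈-refl c _ _) ⟩
      expectation d (λ x → c * ExVec d n excess * exp (t * f x))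
        ≈⟨ expectation-*ˡ d _ _ ⟩
      c * ExVec d n excess * expectation d (λ x → exp (t * f x))
        ≤⟨ *-mono-≤ (0≤-* (0≤exp _) 0≤rest) (*-monoˡ-≤ (0≤exp _) (excess-tail n))
             (≤-respˡ (expectation-const d _) (expectation-mono d (λ x → 0≤exp _)))
             (hoeffding d T 0≤T 0≤f f≤1) ⟩
      c * exp (- (fromℕ n * (fromℕ 8 * (T * T)))) * exp (fromℕ 8 * (T * μ + T * T))
        ≈⟨ ≈-trans (*-congʳ (≈-sym (exp-+ _ _))) (≈-sym (exp-+ _ _)) ⟩
      exp (- (t * (μ + fromℕ 2 * T)) + - (fromℕ n * (fromℕ 8 * (T * T))) + fromℕ 8 * (T * μ + T * T))
        ≈⟨ exp-cong (solve 3 (λ t m n → :- (# 8 :* t :* (m :+ # 2 :* t)) :+ :- (n :* (# 8 :* (t :* t)))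
              :+ # 8 :* (t :* m :+ t :* t) := :- ((# 1 :+ n) :* (# 8 :* (t :* t)))) ≈-refl T μ (fromℕ n)) ⟩
      exp (- (fromℕ (suc n) * (fromℕ 8 * (T * T)))) ∎
      where
      open ≤-Reasoning
      c : Carrier
      c = exp (- (t * (μ + fromℕ 2 * T)))
      0≤rest : 0# ≤ ExVec d n excess
      0≤rest = ≤-respˡ (ExVec-const d n 0#) (ExVec-mono d n λ xs → 0≤excess xs)
      split : ∀ x xs → excess (x ∷ xs) ≈ c * exp (t * f x) * excess xs
      split x xs = ≈-trans (exp-cong (solve 5 (λ t f s n m → t :* ((f :+ s) :- (# 1 :+ n) :* m)
          := :- (t :* m) :+ t :* f :+ t :* (s :- n :* m)) ≈-refl t (f x) (sumVec f xs) (fromℕ n)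
              (μ + fromℕ 2 * T)))
        (≈-trans (exp-+ _ _) (*-congʳ (exp-+ _ _)))

-- Acceptance probability as an expectation over a run

module Acceptance {{ℜ : RealField}} (N K : ℕ) .{{_ : NonZero K}}
                  (I : Model.Instance N K) (P : Model.Prover N K) where

  open OrderLemmas ℜ
  open HoeffdingLemma ℜ using (expectation; expectation-cong)
  open RandomExperiments ℜ
  open Model {{ℜ}} N K
  open Instance I
  open Prover P
  open Execution I P

  -- The prover's state is kept as an argument so that bounds can be quantified over whatever state
  -- an adaptive prover has reached.
  acc : Verifier → State → Carrier
  acc v st = Pr proj₁ (run v st)

  private
    Pr-log : ∀ es (r : Rand (Bool × List Event)) → Pr proj₁ (log es r) ≈ Pr proj₁ r
    Pr-log es r = ≈-trans (Pr≈Ex proj₁ (log es r)) (≈-trans (Ex-bind _ _ r) (≈-sym (Pr≈Ex proj₁ r)))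

    Pr-bind-log : ∀ {A : Set} (es : A → List Event) (g : A → Rand (Bool × List Event)) r →
                  Pr proj₁ (r >>= λ a → log (es a) (g a)) ≈ Ex (λ a → Pr proj₁ (g a)) r
    Pr-bind-log es g r = ≈-trans (Pr≈Ex proj₁ (r >>= λ a → log (es a) (g a)))
      (≈-trans (Ex-bind _ _ r)
          (Ex-cong (λ a → ≈-trans (≈-sym (Pr≈Ex proj₁ (log (es a) (g a)))) (Pr-log (es a) (g a))) r))

  acc-draw : ∀ k st → acc (draw k) st ≈ expectation D (λ x → acc (k x) st)
  acc-draw k st = expectation-cong D λ x → Pr-log _ (run (k x) st)

  acc-query : ∀ x k st → acc (query x k) st ≈ acc (k (f-V x)) st
  acc-query x k st = Pr-log _ (run (k (f-V x)) st)

  acc-send : ∀ msg v st → acc (send msg v) st ≈ Ex (λ (st′ , _) → acc v st′) (runComp (observe msg st))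
  acc-send msg v st = Pr-bind-log (λ (_ , es) → V-sends msg ∷ es) (λ (st′ , _) → run v st′)
      (runComp (observe msg st))

  acc-recv : ∀ p k st → acc (recv p k) st ≈ Ex (λ ((st′ , r) , _) → acc (k r) st′) (runComp (answer p st))
  acc-recv p k st = Pr-bind-log
    (λ ((_ , r) , es) → es ++ P-sends p r ∷ []) (λ ((st′ , r) , _) → run (k r) st′) (runComp (answer p st))

  0≤acc : ∀ v st → 0# ≤ acc v st
  0≤acc v st = 0≤Pr proj₁ (run v st)

  acc≤1 : ∀ v st → acc v st ≤ 1#
  acc≤1 v st = Pr≤1 proj₁ (run v st)

  acc-drawMany : ∀ n k st → acc (drawMany n k) st ≈ ExVec D n (λ xs → acc (k xs) st)
  acc-drawMany zero    k st = ≈-refl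
  acc-drawMany (suc n) k st = ≈-trans (acc-draw (λ x → drawMany n λ xs → k (x ∷ xs)) st)
    (expectation-cong D λ x → acc-drawMany n (λ xs → k (x ∷ xs)) st)

-- Grid values and the detection probability of randomized comparison

module Grid {{ℜ : RealField}} (N K : ℕ) .{{_ : NonZero K}} where

  open OrderLemmas ℜ
  open RandomExperiments ℜ
  open Model {{ℜ}} N K

  0<K : 0# < fromℕ K
  0<K = 0<fromℕ K

  grid-0≤ : ∀ {s w} → InGrid s w → 0# ≤ w
  grid-0≤ (z , w≈) = ≤-respʳ (≈-sym w≈) (0≤-/ (0≤fromℕ (toℕ z)) 0<K)

  grid-≤ : ∀ {s w} → InGrid s w → w ≤ fromℕ s
  grid-≤ {s} (z , w≈) = ≤-respˡ (≈-sym w≈) (/-≤ 0<K (≤-respʳ (≈-trans (fromℕ-* K s) (*-comm _ _))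
    (fromℕ-mono (ℕ.s≤s⁻¹ (Fin.toℕ<n z)))))

  val-0≤ : ∀ v → 0# ≤ val v
  val-0≤ v = 0≤-/ (0≤fromℕ (toℕ v)) 0<K

  val-≤1 : ∀ v → val v ≤ 1#
  val-≤1 v = /-≤ 0<K (≤-respʳ (≈-sym (*-identityˡ _)) (fromℕ-mono (ℕ.s≤s⁻¹ (Fin.toℕ<n v))))

  -- A difference with a fixed orientation is additive in both arguments and never exceeds the
  -- absolute difference, which is itself not additive.
  signed : Bool → Carrier → Carrier → Carrier
  signed true  x y = x - y
  signed false x y = y - x

  signed-+ : ∀ b x y x′ y′ → signed b (x + x′) (y + y′) ≈ signed b x y + signed b x′ y′
  signed-+ true  x y x′ y′ = solve 4 (λ x y u v → (x :+ u) :- (y :+ v) := x :- y :+ (u :- v)) ≈-refl x y x′ y′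
  signed-+ false x y x′ y′ = solve 4 (λ x y u v → (y :+ v) :- (x :+ u) := y :- x :+ (v :- u)) ≈-refl x y x′ y′

  signed-cong : ∀ b {x x′ y y′} → x ≈ x′ → y ≈ y′ → signed b x y ≈ signed b x′ y′
  signed-cong true  x≈ y≈ = +-cong x≈ (-‿cong y≈)
  signed-cong false x≈ y≈ = +-cong y≈ (-‿cong x≈)

  signed-≤ : ∀ b {x y s} → 0# ≤ x → x ≤ s → 0# ≤ y → y ≤ s → signed b x y ≤ s
  signed-≤ true  {x} {y} 0≤x x≤s 0≤y y≤s = ≤-trans
      (≤-by-diff 0≤y (solve 2 (λ x y → x :- y :+ y := x) ≈-refl x y)) x≤s
  signed-≤ false {x} {y} 0≤x x≤s 0≤y y≤s = ≤-trans
      (≤-by-diff 0≤x (solve 2 (λ x y → y :- x :+ x := y) ≈-refl x y)) y≤s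

  does-≡ : ∀ {P : Set} (d : Dec P) b → (P → b ≡ true) → (b ≡ true → P) → does d ≡ b
  does-≡ (yes p) b     to from = ≡.sym (to p)
  does-≡ (no ¬p) false to from = ≡.refl
  does-≡ (no ¬p) true  to from = contradiction (from ≡.refl) ¬p

  private
    T⇒≡ : ∀ {b} → So b → b ≡ true
    T⇒≡ {true} _ = ≡.refl

  -- With an integer z on the right, the undetermined test on reals becomes a Boolean test that
  -- computes; the shift U = u + 1 turns ≤ into <.
  threshold : ∀ {x} z → x ≈ fromℕ z → ∀ u → does (fromℕ (suc u) ≤? x) ≡ (u ℕ.<ᵇ z)
  threshold {x} z x≈z u = does-≡ (fromℕ (suc u) ≤? x) (u ℕ.<ᵇ z)
    (λ h → T⇒≡ (ℕ.<⇒<ᵇ (fromℕ-cancel {suc u} {z} (≤-respʳ x≈z h))))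
    (λ eq → ≤-respʳ (≈-sym x≈z) (fromℕ-mono (ℕ.<ᵇ⇒< u z (≡.subst So (≡.sym eq) _))))

  sum-threshold : ∀ n z → z ℕ.≤ n → (∑[ u < n ] indicator (toℕ u ℕ.<ᵇ z)) ≈ fromℕ z
  sum-threshold zero    zero    _   = ≈-refl
  sum-threshold (suc n) zero    _   = ≈-trans (+-identityˡ _) (sum-threshold n zero ℕ.z≤n)
  sum-threshold (suc n) (suc z) h   = +-congˡ (sum-threshold n z (ℕ.s≤s⁻¹ h))

  module _ {A B} (y z : Fin (suc K)) (A≈ : A ≈ val y) (B≈ : B ≈ val z) where

    private
      K* : ∀ {A} y → A ≈ val y → fromℕ K * A ≈ fromℕ (toℕ y)
      K* y A≈ = ≈-trans (*-comm _ _) (≈-trans (*-congʳ A≈) (/-*-cancel 0<K))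

      bit : Fin (suc K) → ℕ → Carrier
      bit y u = indicator (u ℕ.<ᵇ toℕ y)

    compare-≡ : ∀ u → compare A B u ≡ (toℕ u ℕ.<ᵇ toℕ y) xor (toℕ u ℕ.<ᵇ toℕ z)
    compare-≡ u = ≡.cong₂ _xor_ (threshold (toℕ y) (K* y A≈) (toℕ u)) (threshold (toℕ z) (K* z B≈) (toℕ u))

    average-bits : average K (λ u → bit y (toℕ u) - bit z (toℕ u)) ≈ val y - val z
    average-bits = begin
      average K (λ u → bit y (toℕ u) - bit z (toℕ u))
        ≈⟨ average-cong K (λ u → +-congˡ (solve 1 (λ x → :- x := :- # 1 :* x) ≈-refl (bit z (toℕ u)))) ⟩
      average K (λ u → bit y (toℕ u) + - 1# * bit z (toℕ u))
        ≈⟨ ≈-trans (average-+ K (λ u → bit y (toℕ u)) (λ u → - 1# * bit z (toℕ u)))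
            (+-congˡ (average-*ˡ K (- 1#) (λ u → bit z (toℕ u)))) ⟩
      average K (λ u → bit y (toℕ u)) + - 1# * average K (λ u → bit z (toℕ u))
        ≈⟨ +-cong (*-congʳ (sum-threshold K (toℕ y) (≤K y)))
            (*-congˡ (*-congʳ (sum-threshold K (toℕ z) (≤K z)))) ⟩
      val y + - 1# * val z
        ≈⟨ solve 2 (λ x y → x :+ :- # 1 :* y := x :- y) ≈-refl (val y) (val z) ⟩
      val y - val z ∎
      where
      open ≈-Reasoning
      ≤K : ∀ y → toℕ y ℕ.≤ K
      ≤K y = ℕ.s≤s⁻¹ (Fin.toℕ<n y)

    diff-≤-average-compare : val y - val z ≤ average K (indicator ∘ compare A B)
    diff-≤-average-compare = ≤-respˡ average-bits (average-mono K λ u →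
      ≡.subst (λ b → bit y (toℕ u) - bit z (toℕ u) ≤ indicator b) (≡.sym (compare-≡ u))
        (bits (toℕ u ℕ.<ᵇ toℕ y) (toℕ u ℕ.<ᵇ toℕ z)))
      where
      bits : ∀ b c → indicator b - indicator c ≤ indicator (b xor c)
      bits true  true  = ≤-reflexive (-‿inverseʳ 1#)
      bits true  false = ≤-reflexive (solve 0 (# 1 :- # 0 := # 1) ≈-refl)
      bits false true  = ≤-by-diff (0≤fromℕ 2) (solve 0 (# 0 :- # 1 :+ # 2 := # 1) ≈-refl)
      bits false false = ≤-reflexive (-‿inverseʳ 0#)

    -- For z ≤ y the events u < z and u < y are nested, so the two bits disagree exactly where their
    -- difference is 1.
    average-compare-≤ : toℕ z ℕ.≤ toℕ y → average K (indicator ∘ compare A B) ≤ val y - val z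
    average-compare-≤ z≤y = ≤-respʳ average-bits (average-mono K λ u →
      ≡.subst (λ b → indicator b ≤ bit y (toℕ u) - bit z (toℕ u)) (≡.sym (compare-≡ u)) (bits (toℕ u)))
      where
      bits : ∀ u → indicator ((u ℕ.<ᵇ toℕ y) xor (u ℕ.<ᵇ toℕ z)) ≤ bit y u - bit z u
      bits u with u ℕ.<ᵇ toℕ y in eq | u ℕ.<ᵇ toℕ z in eq′
      ... | true  | true  = ≤-reflexive (≈-sym (-‿inverseʳ 1#))
      ... | true  | false = ≤-reflexive (solve 0 (# 1 := # 1 :- # 0) ≈-refl)
      ... | false | false = ≤-reflexive (≈-sym (-‿inverseʳ 0#))
      ... | false | true  = contradiction
              (≡.trans (≡.sym eq) (T⇒≡
                  (ℕ.<⇒<ᵇ (ℕ.<-≤-trans (ℕ.<ᵇ⇒< u (toℕ z) (≡.subst So (≡.sym eq′) _)) z≤y)))) λ ()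

  compare-comm : ∀ x y u → compare x y u ≡ compare y x u
  compare-comm x y u = xor-comm (does (fromℕ (suc (toℕ u)) ≤? fromℕ K * x))
      (does (fromℕ (suc (toℕ u)) ≤? fromℕ K * y))

  average-compare-comm : ∀ A B → average K (indicator ∘ compare A B) ≈ average K (indicator ∘ compare B A)
  average-compare-comm A B = average-cong K λ u → ≈-reflexive (≡.cong indicator (compare-comm A B u))

  signed-≤-average-compare : ∀ b {A B} y z → A ≈ val y → B ≈ val z →
                             signed b A B ≤ average K (indicator ∘ compare A B)
  signed-≤-average-compare true {A} {B} y z A≈ B≈ = ≤-respˡ (+-cong (≈-sym A≈) (-‿cong (≈-sym B≈)))
    (diff-≤-average-compare y z A≈ B≈)
  signed-≤-average-compare false {A} {B} y z A≈ B≈ = ≤-respˡ (+-cong (≈-sym B≈) (-‿cong (≈-sym A≈)))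
    (≤-respʳ (average-compare-comm B A) (diff-≤-average-compare z y B≈ A≈))

  average-compare-≤-abs : ∀ {A B} y z → A ≈ val y → B ≈ val z →
                          average K (indicator ∘ compare A B) ≤ abs (val y - val z)
  average-compare-≤-abs {A} {B} y z A≈ B≈ with ℕ.≤-total (toℕ z) (toℕ y)
  ... | inj₁ z≤y = ≤-trans (average-compare-≤ y z A≈ B≈ z≤y) (≤-abs _)
  ... | inj₂ y≤z = ≤-respˡ (average-compare-comm B A) (≤-trans (average-compare-≤ z y B≈ A≈ y≤z)
        (≤-respˡ (solve 2 (λ y z → :- (y :- z) := z :- y) ≈-refl (val y) (val z)) (neg-≤-abs _)))

  grid-val : ∀ {w} → InGrid 1 w → ∃ λ y → w ≈ val y
  grid-val {w} (z , w≈) = Fin.cast K1≡K z , ≈-trans w≈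
      (*-congʳ (≈-reflexive (≡.cong fromℕ (≡.sym (Fin.toℕ-cast K1≡K z)))))
    where
    K1≡K : suc (K ℕ.* 1) ≡ suc K
    K1≡K = ≡.cong suc (ℕ.*-identityʳ K)

-- Unfolding one level of a descent

module DescentShape {{ℜ : RealField}} (N K : ℕ) .{{_ : NonZero K}} where

  open RealField ℜ
  open Model {{ℜ}} N K

  -- Gives a name to the continuation that `descend` hides under `recv`; on verifiers of any other
  -- shape the value is a dummy.
  childrenReply : Verifier → Carrier × Carrier → Verifier
  childrenReply (recv (children _ _ _) k) = k
  childrenReply v                         = λ _ → v

  does-true : ∀ {A : Set} (a? : Dec A) → does a? ≡ true → A
  does-true (yes a) _ = a

  ∧-true : ∀ {x y} → x ∧ y ≡ true → x ≡ true × y ≡ true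
  ∧-true {true} y≡true = ≡.refl , y≡true

  checks : (a b : ℕ) (w₀ w₁ w : Carrier) → Bool
  checks a b w₀ w₁ w = does (inGrid? a w₀) ∧ does (inGrid? b w₁) ∧ does (w₀ + w₁ ≟ w)

  checks-sound : ∀ a b w₀ w₁ w → checks a b w₀ w₁ w ≡ true → InGrid a w₀ × InGrid b w₁ × w₀ + w₁ ≈ w
  checks-sound a b w₀ w₁ w eq =
    let eq₀ , eq′ = ∧-true {does (inGrid? a w₀)} eq
        eq₁ , eq₂ = ∧-true {does (inGrid? b w₁)} eq′
    in does-true (inGrid? a w₀) eq₀ , does-true (inGrid? b w₁) eq₁ , does-true (w₀ + w₁ ≟ w) eq₂

  checks-complete : ∀ a b w₀ w₁ w → InGrid a w₀ → InGrid b w₁ → w₀ + w₁ ≈ w → checks a b w₀ w₁ w ≡ true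
  checks-complete a b w₀ w₁ w g₀ g₁ s =
    ≡.cong₂ _∧_ (dec-true (inGrid? a w₀) g₀)
        (≡.cong₂ _∧_ (dec-true (inGrid? b w₁) g₁) (dec-true (w₀ + w₁ ≟ w) s))

  module _ {a b} (l : BalancedTree a) (r : BalancedTree b) (lo : ℕ) (w₀ w₁ : Carrier) (k : Carrier → Verifier) where

    descendChild : Fin a ⊎ Fin b → Verifier
    descendChild (inj₁ i) = send (reveal true) (descend l lo i w₀ k)
    descendChild (inj₂ i) = send (reveal false) (descend r (lo ℕ.+ a) i w₁ k)

    -- `descend` splits on the position inside an anonymous function; here the
    -- same split is made by `descendChild`.
    descend-node : ∀ p w j → childrenReply (descend (node p l r) lo j w k) (w₀ , w₁)
                   ≡ (if checks a b w₀ w₁ w then descendChild (splitAt a j) else halt false)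
    descend-node p w j with splitAt a j
    ... | inj₁ _ = ≡.refl
    ... | inj₂ _ = ≡.refl

-- Additive potential for a single descent against an arbitrary prover

module SingleDescent {{ℜ : RealField}} (N K : ℕ) .{{_ : NonZero K}}
                        (I : Model.Instance N K) (P : Model.Prover N K) where

  open OrderLemmas ℜ
  open Exponential ℜ
  open RandomExperiments ℜ
  open Model {{ℜ}} N K
  open Instance I
  open Prover P
  open Execution I P using (runComp)
  open Acceptance N K I P
  open Grid N K
  open DescentShape N K

  module _ (b : Bool) (c R : Carrier) where

    -- A bound on the acceptance probabilities summed over s leaves: each leaf contributes R, and
    -- each unit of oriented difference between claims and values saves c R. Being jointly linear in
    -- s, w and v, it adds up over the two children.
    potential : ℕ → Carrier → Carrier → Carrier
    potential s w v = R * (fromℕ s - c * signed b w v)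

    potential-+ : ∀ s₀ s₁ {w₀ w₁ w v₀ v₁ v} → w₀ + w₁ ≈ w → v ≈ v₀ + v₁ →
                  potential s₀ w₀ v₀ + potential s₁ w₁ v₁ ≈ potential (s₀ ℕ.+ s₁) w v
    potential-+ s₀ s₁ {w₀} {w₁} {w} {v₀} {v₁} {v} w≈ v≈ = begin
      potential s₀ w₀ v₀ + potential s₁ w₁ v₁
        ≈⟨ solve 6 (λ r c x y s t → r :* (s :- c :* x) :+ r :* (t :- c :* y) := r :*
            ((s :+ t) :- c :* (x :+ y)))
             ≈-refl R c (signed b w₀ v₀) (signed b w₁ v₁) (fromℕ s₀) (fromℕ s₁) ⟩
      R * (fromℕ s₀ + fromℕ s₁ - c * (signed b w₀ v₀ + signed b w₁ v₁))
        ≈⟨ *-congˡ (+-cong (fromℕ-+ s₀ s₁) (-‿cong (*-congˡ (signed-+ b w₀ v₀ w₁ v₁)))) ⟨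
      R * (fromℕ (s₀ ℕ.+ s₁) - c * signed b (w₀ + w₁) (v₀ + v₁))
        ≈⟨ *-congˡ (+-congˡ (-‿cong (*-congˡ (signed-cong b w≈ (≈-sym v≈))))) ⟩
      potential (s₀ ℕ.+ s₁) w v ∎
      where open ≈-Reasoning

  -- Whatever the prover answers, the leaf claims that it commits to before the
  -- path is revealed add up to the root claim w; hence a bound on the acceptance
  -- probability that is affine in the leaf claim is inherited by the root.
  module _ (b : Bool) (c R : Carrier) (0≤c : 0# ≤ c) (c≤1 : c ≤ 1#) (0≤R : 0# ≤ R) where

    0≤potential : ∀ s {w v} → 0# ≤ w → w ≤ fromℕ s → 0# ≤ v → v ≤ fromℕ s → 0# ≤ potential b c R s w v
    0≤potential s 0≤w w≤s 0≤v v≤s = 0≤-* 0≤R (0≤-diff (≤-trans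
      (*-monoˡ-≤ 0≤c (signed-≤ b 0≤w w≤s 0≤v v≤s))
      (≤-respʳ (*-identityˡ _) (*-monoʳ-≤ (0≤fromℕ s) c≤1))))

    descend-bound : ∀ {s} (T : BalancedTree s) lo w (F : Fin s → Carrier) (k : Fin s → Carrier → Verifier) →
      (∀ j → 0# ≤ F j) → (∀ j → F j ≤ 1#) →
      (∀ j A st → InGrid 1 A → acc (k j A) st ≤ potential b c R 1 A (F j)) →
      InGrid s w → ∀ st → (∑[ j < s ] acc (descend T lo j w (k j)) st) ≤ potential b c R s w (sum F)
    descend-bound leaf lo w F k 0≤F F≤1 leaf-bound grid st = ≤-respˡ (≈-sym (+-identityʳ _))
      (≤-respʳ (*-congˡ (+-congˡ (-‿cong (*-congˡ (signed-cong b ≈-refl (≈-sym (+-identityʳ (F fzero))))))))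
        (leaf-bound fzero w st grid))
    descend-bound {s} (node {s₀} {s₁} p l r) lo w F k 0≤F F≤1 leaf-bound grid st = begin
      (∑[ j < s ] acc (descend (node p l r) lo j w (k j)) st)
        ≈⟨ sum-cong-≋ {s} (λ j → acc-recv (children lo s₀ s₁) (reply j) st) ⟩
      (∑[ j < s ] Ex (λ ((st′ , claims) , _) → acc (reply j claims) st′)
          (runComp (answer (children lo s₀ s₁) st)))
        -- This is where the privacy of J enters: the prompt and the state are the same for all j,
        -- so a single experiment serves every j and the sum moves inside it.
        ≈⟨ Ex-sum {n = s} (λ j ((st′ , claims) , _) → acc (reply j claims) st′)
            (runComp (answer (children lo s₀ s₁) st)) ⟩
      Ex (λ ((st′ , claims) , _) → ∑[ j < s ] acc (reply j claims) st′)
          (runComp (answer (children lo s₀ s₁) st))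
        ≤⟨ Ex-≤ (λ ((st′ , (w₀ , w₁)) , _) → replied st′ w₀ w₁) (runComp (answer (children lo s₀ s₁) st)) ⟩
      potential b c R s w (sum F) ∎
      where
      open ≤-Reasoning
      reply : Fin s → Carrier × Carrier → Verifier
      reply j = childrenReply (descend (node p l r) lo j w (k j))
      F₀ : Fin s₀ → Carrier
      F₀ i = F (i ↑ˡ s₁)
      F₁ : Fin s₁ → Carrier
      F₁ i = F (s₀ ↑ʳ i)

      revealed : ∀ {t} (msg : VerifierMsg) (v : Fin t → Verifier) bound →
        (∀ st → (∑[ i < t ] acc (v i) st) ≤ bound) → ∀ st → (∑[ i < t ] acc (send msg (v i)) st) ≤ bound
      revealed {t} msg v bound h st = begin
        (∑[ i < t ] acc (send msg (v i)) st)
          ≈⟨ sum-cong-≋ {t} (λ i → acc-send msg (v i) st) ⟩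
        (∑[ i < t ] Ex (λ (st′ , _) → acc (v i) st′) (runComp (observe msg st)))
          ≈⟨ Ex-sum {n = t} (λ i (st′ , _) → acc (v i) st′) (runComp (observe msg st)) ⟩
        Ex (λ (st′ , _) → ∑[ i < t ] acc (v i) st′) (runComp (observe msg st))
          ≤⟨ Ex-≤ (λ (st′ , _) → h st′) (runComp (observe msg st)) ⟩
        bound ∎

      replied : ∀ st′ w₀ w₁ → (∑[ j < s ] acc (reply j (w₀ , w₁)) st′) ≤ potential b c R s w (sum F)
      replied st′ w₀ w₁ = begin
        (∑[ j < s ] acc (reply j (w₀ , w₁)) st′)
          ≈⟨ sum-cong-≋ {s} (λ j → ≈-reflexive
              (≡.cong (λ v → acc v st′) (descend-node l r lo w₀ w₁ (k j) p w j))) ⟩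
        (∑[ j < s ] acc (if ok then descendChild l r lo w₀ w₁ (k j) (splitAt s₀ j) else halt false) st′)
          ≤⟨ checked ok ≡.refl ⟩
        potential b c R s w (sum F) ∎
        where
        ok : Bool
        ok = checks s₀ s₁ w₀ w₁ w
        checked : ∀ o → ok ≡ o →
          (∑[ j < s ] acc (if o then descendChild l r lo w₀ w₁ (k j) (splitAt s₀ j) else halt false) st′) ≤
              potential b c R s w (sum F)
        -- A failed check leaves acceptance probability 0, so the potential only has to be
        -- nonnegative: the oriented difference is at most s and c ≤ 1.
        checked false _  = ≤-respˡ (≈-sym (≈-trans (sum-replicate s) (n·0 s)))
          (0≤potential s (grid-0≤ grid) (grid-≤ grid) (0≤-sum 0≤F) (sum-≤-size F≤1))
          where
          n·0 : ∀ n → n · 0# ≈ 0#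
          n·0 zero    = ≈-refl
          n·0 (suc n) = ≈-trans (+-identityˡ _) (n·0 n)
        checked true  ok≡true = let g₀ , g₁ , w₀+w₁≈w = checks-sound s₀ s₁ w₀ w₁ w ok≡true in begin
          (∑[ j < s ] acc (descendChild l r lo w₀ w₁ (k j) (splitAt s₀ j)) st′)
            ≈⟨ sum-++ s₀ (λ j → acc (descendChild l r lo w₀ w₁ (k j) (splitAt s₀ j)) st′) ⟩
          (∑[ i < s₀ ] acc (descendChild l r lo w₀ w₁ (k (i ↑ˡ s₁)) (splitAt s₀ (i ↑ˡ s₁))) st′)
            + (∑[ i < s₁ ] acc (descendChild l r lo w₀ w₁ (k (s₀ ↑ʳ i)) (splitAt s₀ (s₀ ↑ʳ i))) st′)
            ≈⟨ +-cong
                 (sum-cong-≋ {s₀} (λ i → ≈-reflexive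
                     (≡.cong (λ z → acc (descendChild l r lo w₀ w₁ (k (i ↑ˡ s₁)) z) st′)
                     (Fin.splitAt-↑ˡ s₀ i s₁))))
                 (sum-cong-≋ {s₁} (λ i → ≈-reflexive
                     (≡.cong (λ z → acc (descendChild l r lo w₀ w₁ (k (s₀ ↑ʳ i)) z) st′)
                     (Fin.splitAt-↑ʳ s₀ s₁ i)))) ⟩
          (∑[ i < s₀ ] acc (send (reveal true) (descend l lo i w₀ (k (i ↑ˡ s₁)))) st′)
            + (∑[ i < s₁ ] acc (send (reveal false) (descend r (lo ℕ.+ s₀) i w₁ (k (s₀ ↑ʳ i)))) st′)
            ≤⟨ +-mono-≤
                 (revealed {s₀} (reveal true) (λ i → descend l lo i w₀ (k (i ↑ˡ s₁)))
                     (potential b c R s₀ w₀ (sum F₀)) (descend-bound l lo w₀ F₀ (λ i → k (i ↑ˡ s₁))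
                   (λ i → 0≤F _) (λ i → F≤1 _) (λ i → leaf-bound _) g₀) st′)
                 (revealed {s₁} (reveal false) (λ i → descend r (lo ℕ.+ s₀) i w₁ (k (s₀ ↑ʳ i)))
                     (potential b c R s₁ w₁ (sum F₁)) (descend-bound r (lo ℕ.+ s₀) w₁ F₁ (λ i → k (s₀ ↑ʳ i))
                   (λ i → 0≤F _) (λ i → F≤1 _) (λ i → leaf-bound _) g₁) st′) ⟩
          potential b c R s₀ w₀ (sum F₀) + potential b c R s₁ w₁ (sum F₁)
            ≈⟨ potential-+ b c R s₀ s₁ w₀+w₁≈w (sum-++ s₀ F) ⟩
          potential b c R s w (sum F) ∎

-- Chernoff rates at the chosen exponents

module ChernoffRates (ℜ : RealField) where

  open OrderLemmas ℜ
  open Exponential ℜ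
  open Hoeffding ℜ

  module Rates (κ T g L Q : Carrier) (0≤κ : 0# ≤ κ) (0<T : 0# < T) (g≈ : g ≈ fromℕ 2 * κ + fromℕ 16 * T)
           (rate : fromℕ 6 * g * L ≤ fromℕ 64 * (Q * (T * T))) (0≤Q : 0# ≤ Q) where

    private
      0≤T : 0# ≤ T
      0≤T = <⇒≤ 0<T

    0<g : 0# < g
    0<g = <-respʳ (≈-trans (+-comm _ _) (≈-sym g≈)) (0<-+ (0<-* (0<fromℕ-suc 15) 0<T) (0≤-* (0≤fromℕ 2) 0≤κ))

    -- The lower-tail exponent λ = η / (3 g), where η = 16 T.
    λ↓ : Carrier
    λ↓ = fromℕ 16 * T / (fromℕ 3 * g)

    0≤λ↓ : 0# ≤ λ↓
    0≤λ↓ = 0≤-/ (0≤-* (0≤fromℕ 16) 0≤T) (0<-* (0<fromℕ-suc 2) 0<g)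

    -- Here κ + 12 T is the guaranteed detection rate and κ + 8 T = g / 2 the threshold. By exp (-
    -- λ) ≤ 1 - λ + λ² / 2 one descent gains at least 4 T λ - λ² (κ + 12 T) / 2. The choice of λ
    -- makes λ (κ + 12 T) ≤ 4 T, so the gain is at least 2 T λ = 32 T² / (3 g), which `rate` matches
    -- with L.
    lower-rate : L ≤ Q * ((1# - exp (- λ↓)) * (κ + fromℕ 12 * T) - λ↓ * (κ + fromℕ 8 * T))
    lower-rate = *-cancelˡ-≤ (0<fromℕ-suc 1) (≤-trans 2L≤ (≤-respʳ
        (solve 3 (λ q a b → q :* (# 2 :* a :- # 2 :* b) := # 2 :* (q :* (a :- b)))
          ≈-refl Q (c * (κ + fromℕ 12 * T)) (λ↓ * (κ + fromℕ 8 * T)))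
        (*-monoˡ-≤ 0≤Q per-step)))
      where
      open ≤-Reasoning
      c 3g : Carrier
      c = 1# - exp (- λ↓)
      3g = fromℕ 3 * g
      0<3g : 0# < 3g
      0<3g = 0<-* (0<fromℕ-suc 2) 0<g
      λ3g : λ↓ * 3g ≈ fromℕ 16 * T
      λ3g = /-*-cancel 0<3g
      2L≤ : fromℕ 2 * L ≤ Q * (fromℕ 4 * T * λ↓)
      2L≤ = *-cancelʳ-≤ 0<3g (begin
        fromℕ 2 * L * 3g                   ≈⟨ solve 2 (λ l g → # 2 :* l :* (# 3 :* g) := # 6 :* g :* l) ≈-refl L
            g ⟩
        fromℕ 6 * g * L                    ≤⟨ rate ⟩
        fromℕ 64 * (Q * (T * T))           ≈⟨ solve 2
            (λ q t → # 64 :* (q :* (t :* t)) := q :* (# 4 :* t :* (# 16 :* t))) ≈-refl Q T ⟩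
        Q * (fromℕ 4 * T * (fromℕ 16 * T)) ≈⟨ *-congˡ (*-congˡ λ3g) ⟨
        Q * (fromℕ 4 * T * (λ↓ * 3g))      ≈⟨ solve 4
            (λ q t l h → q :* (# 4 :* t :* (l :* h)) := q :* (# 4 :* t :* l) :* h) ≈-refl Q T λ↓ 3g ⟩
        Q * (fromℕ 4 * T * λ↓) * 3g        ∎)
      λp≤ : λ↓ * (κ + fromℕ 12 * T) ≤ fromℕ 4 * T
      λp≤ = *-cancelˡ-≤ (0<fromℕ-suc 3) (begin
        fromℕ 4 * (λ↓ * (κ + fromℕ 12 * T))
          ≤⟨ ≤-by-diff (0≤-* (0≤fromℕ 2) (0≤-* 0≤λ↓ 0≤κ))
              (solve 3 (λ l k t → # 4 :* (l :* (k :+ # 12 :* t)) :+ # 2 :* (l :* k)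
               := l :* (# 3 :* (# 2 :* k :+ # 16 :* t))) ≈-refl λ↓ κ T) ⟩
        λ↓ * (fromℕ 3 * (fromℕ 2 * κ + fromℕ 16 * T))  ≈⟨ *-congˡ (*-congˡ g≈) ⟨
        λ↓ * 3g                                        ≈⟨ λ3g ⟩
        fromℕ 16 * T                                   ≈⟨ solve 1 (λ t → # 16 :* t := # 4 :* (# 4 :* t)) ≈-refl
            T ⟩
        fromℕ 4 * (fromℕ 4 * T)                        ∎)
      per-step : fromℕ 4 * T * λ↓ ≤ fromℕ 2 * (c * (κ + fromℕ 12 * T)) - fromℕ 2 * (λ↓ * (κ + fromℕ 8 * T))
      per-step = ≤-by-diff
        (0≤-+ (0≤-* (0≤-+ 0≤κ (0≤-* (0≤fromℕ 12) 0≤T)) (0≤-diff (2exp-neg-≤ 0≤λ↓))) (0≤-* 0≤λ↓ (0≤-diff λp≤)))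
        (solve 4 (λ l k t e → # 4 :* t :* l :+ ((k :+ # 12 :* t) :* ((# 2 :- # 2 :* l :+ l :* l) :- # 2 :* e)
             :+ l :* (# 4 :* t :- l :* (k :+ # 12 :* t)))
          := # 2 :* ((# 1 :- e) :* (k :+ # 12 :* t)) :- # 2 :* (l :* (k :+ # 8 :* t))) ≈-refl λ↓ κ T
              (exp (- λ↓)))

    -- The upper-tail exponent λ = η / (4 g).
    λ↑ : Carrier
    λ↑ = fromℕ 4 * T / g

    0≤λ↑ : 0# ≤ λ↑
    0≤λ↑ = 0≤-/ (0≤-* (0≤fromℕ 4) 0≤T) 0<g

    -- Here κ + 2 T bounds the honest detection rate, 6 T below the threshold. By exp λ - 1 ≤ λ + 4
    -- λ² / 3 and λ (κ + 2 T) ≤ 2 T, one descent gains at least 10 T λ / 3; already 8 T λ / 3 = 32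
    -- T² / (3 g) is enough for `rate`.
    upper-rate : L ≤ Q * (λ↑ * (κ + fromℕ 8 * T) - (exp λ↑ - 1#) * (κ + fromℕ 2 * T))
    upper-rate = *-cancelˡ-≤ (0<fromℕ-suc 5) (≤-trans 6L≤ (≤-respʳ
        (solve 3 (λ q a b → q :* (# 6 :* a :- # 6 :* b) := # 6 :* (q :* (a :- b)))
          ≈-refl Q (λ↑ * (κ + fromℕ 8 * T)) ((exp λ↑ - 1#) * (κ + fromℕ 2 * T)))
        (*-monoˡ-≤ 0≤Q per-step)))
      where
      open ≤-Reasoning
      λg : λ↑ * g ≈ fromℕ 4 * T
      λg = /-*-cancel 0<g
      6L≤ : fromℕ 6 * L ≤ Q * (fromℕ 16 * T * λ↑)
      6L≤ = *-cancelʳ-≤ 0<g (begin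
        fromℕ 6 * L * g                    ≈⟨ solve 2 (λ l g → # 6 :* l :* g := # 6 :* g :* l) ≈-refl L g ⟩
        fromℕ 6 * g * L                    ≤⟨ rate ⟩
        fromℕ 64 * (Q * (T * T))           ≈⟨ solve 2
            (λ q t → # 64 :* (q :* (t :* t)) := q :* (# 16 :* t :* (# 4 :* t))) ≈-refl Q T ⟩
        Q * (fromℕ 16 * T * (fromℕ 4 * T)) ≈⟨ *-congˡ (*-congˡ λg) ⟨
        Q * (fromℕ 16 * T * (λ↑ * g))      ≈⟨ solve 4
            (λ q t l h → q :* (# 16 :* t :* (l :* h)) := q :* (# 16 :* t :* l) :* h) ≈-refl Q T λ↑ g ⟩
        Q * (fromℕ 16 * T * λ↑) * g        ∎)
      8λP≤ : fromℕ 8 * (λ↑ * (κ + fromℕ 2 * T)) ≤ fromℕ 16 * T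
      8λP≤ = begin
        fromℕ 8 * (λ↑ * (κ + fromℕ 2 * T))
          ≤⟨ ≤-by-diff (0≤-* (0≤fromℕ 48) (0≤-* 0≤λ↑ 0≤T))
              (solve 3 (λ l k t → # 8 :* (l :* (k :+ # 2 :* t)) :+ # 48 :* (l :* t)
               := # 4 :* (l :* (# 2 :* k :+ # 16 :* t))) ≈-refl λ↑ κ T) ⟩
        fromℕ 4 * (λ↑ * (fromℕ 2 * κ + fromℕ 16 * T))  ≈⟨ *-congˡ (*-congˡ g≈) ⟨
        fromℕ 4 * (λ↑ * g)                             ≈⟨ *-congˡ λg ⟩
        fromℕ 4 * (fromℕ 4 * T)                        ≈⟨ solve 1 (λ t → # 4 :* (# 4 :* t) := # 16 :* t) ≈-refl
            T ⟩
        fromℕ 16 * T                                   ∎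
      4λ≤1 : fromℕ 4 * λ↑ ≤ 1#
      4λ≤1 = *-cancelʳ-≤ 0<g (begin
        fromℕ 4 * λ↑ * g                  ≈⟨ *-assoc _ _ _ ⟩
        fromℕ 4 * (λ↑ * g)                ≈⟨ *-congˡ λg ⟩
        fromℕ 4 * (fromℕ 4 * T)           ≤⟨ ≤-by-diff (0≤-* (0≤fromℕ 2) 0≤κ)
            (solve 2 (λ k t → # 4 :* (# 4 :* t) :+ # 2 :* k := # 2 :* k :+ # 16 :* t) ≈-refl κ T) ⟩
        fromℕ 2 * κ + fromℕ 16 * T        ≈⟨ ≈-trans (≈-sym g≈) (≈-sym (*-identityˡ g)) ⟩
        1# * g                            ∎)
      per-step : fromℕ 16 * T * λ↑ ≤ fromℕ 6 * (λ↑ * (κ + fromℕ 8 * T)) - fromℕ 6 *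
          ((exp λ↑ - 1#) * (κ + fromℕ 2 * T))
      per-step = ≤-by-diff
        (0≤-+ (0≤-+ (0≤-* (0≤fromℕ 2) (0≤-* (0≤-+ 0≤κ (0≤-* (0≤fromℕ 2) 0≤T)) (0≤-diff (3exp-≤ 0≤λ↑ 4λ≤1))))
            (0≤-* 0≤λ↑ (0≤-diff 8λP≤)))
              (0≤-* (0≤fromℕ 4) (0≤-* 0≤T 0≤λ↑)))
        (solve 4 (λ l k t e → let P = k :+ # 2 :* t in
             # 16 :* t :* l :+ (# 2 :* (P :* ((# 3 :+ # 3 :* l :+ # 4 :* (l :* l)) :- # 3 :* e))
             :+ l :* (# 16 :* t :- # 8 :* (l :* P)) :+ # 4 :* (t :* l))
          := # 6 :* (l :* (k :+ # 8 :* t)) :- # 6 :* ((e :- # 1) :* P)) ≈-refl λ↑ κ T (exp λ↑))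

-- Consequences of the parameter choices

record Admissible {{ℜ : RealField}} {{p : Parameters}} : Set where
  open RealField ℜ
  open Parameters p
  field
    0≤ε-c : 0# ≤ ε-c
    ε-f≤1 : ε-f ≤ 1#
    0<δ   : 0# < δ
    δ<⅓   : δ < 1# / fromℕ 3
    0≤ρ   : 0# ≤ ρ
    ρ≤1   : ρ ≤ 1#
    0≤γ   : 0# ≤ γ
    γ≤1   : γ ≤ 1#
    0<η   : 0# < η

module ParameterBounds {{ℜ : RealField}} {{p : Parameters}} where

  open OrderLemmas ℜ
  open Exponential ℜ
  open Logarithm ℜ
  open Parameters p

  -- One sixteenth of η turns all slacks into integer multiples: `a` and every sampling deviation
  -- are 2 T, the Hoeffding parameter is 8 T, and g / 2 = κ + 8 T.
  T : Carrier
  T = η / fromℕ 16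

  η≈ : η ≈ fromℕ 16 * T
  η≈ = ≈-sym (≈-trans (*-comm _ _) (/-*-cancel (0<fromℕ-suc 15)))

  a≈ : a ≈ fromℕ 2 * T
  a≈ = ≈-sym (/-unique (0<fromℕ-suc 7) (≈-trans (solve 1 (λ t → # 2 :* t :* # 8 := # 16 :* t) ≈-refl T)
      (≈-sym η≈)))

  g≈ : g ≈ fromℕ 2 * κ + fromℕ 16 * T
  g≈ = ≈-trans (solve 2 (λ g k → g := # 2 :* k :+ (g :- # 2 :* k)) ≈-refl g κ) (+-congˡ η≈)

  module _ (admissible : Admissible) where

    open Admissible admissible

    0≤κ : 0# ≤ κ
    0≤κ = 0≤-+ 0≤ρ (0≤-* (0≤-diff ρ≤1) 0≤γ)

    0<T : 0# < T
    0<T = 0<-/ 0<η (0<fromℕ-suc 15)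

    0≤η : 0# ≤ η
    0≤η = <⇒≤ 0<η

    η≤g : η ≤ g
    η≤g = ≤-by-diff (0≤-* (0≤fromℕ 2) 0≤κ) (solve 2 (λ g k → (g :- # 2 :* k) :+ # 2 :* k := g) ≈-refl g κ)

    0≤g : 0# ≤ g
    0≤g = ≤-trans 0≤η η≤g

    η≤1 : η ≤ 1#
    η≤1 = ≤-trans η≤g (≤-trans (≤-by-diff 0≤ε-c (solve 2 (λ f c → f :- c :+ c := f) ≈-refl ε-f ε-c)) ε-f≤1)

    0<η² : 0# < η ^ 2
    0<η² = 0<-^ 0<η 2

    η²≤η : η ^ 2 ≤ η
    η²≤η = ≤-respʳ (*-identityʳ η) (*-monoˡ-≤ 0≤η (≤-respˡ (≈-sym (*-identityʳ η)) η≤1))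

    1/δ : Carrier
    1/δ = 1# / δ

    3≤1/δ : fromℕ 3 ≤ 1/δ
    3≤1/δ = ≤-/ 0<δ (≤-respʳ (≈-trans (*-comm _ _) (/-*-cancel (0<fromℕ-suc 2)))
        (*-monoˡ-≤ (0≤fromℕ 3) (<⇒≤ δ<⅓)))

    12/δ≈ : fromℕ 12 / δ ≈ fromℕ 12 * 1/δ
    12/δ≈ = *-congˡ (≈-sym (*-identityˡ _))

    1≤1/δ : 1# ≤ 1/δ
    1≤1/δ = ≤-trans (x≤x+y (0≤fromℕ 2)) 3≤1/δ

    3≤12/δ : fromℕ 3 ≤ fromℕ 12 / δ
    3≤12/δ = ≤-respʳ (≈-sym 12/δ≈) (≤-trans 3≤1/δ (≤-by-diff (0≤-* (0≤fromℕ 11) (≤-trans 0≤1 1≤1/δ))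
      (solve 1 (λ y → y :+ # 11 :* y := # 12 :* y) ≈-refl 1/δ)))

    1≤12/δ : 1# ≤ fromℕ 12 / δ
    1≤12/δ = ≤-trans (x≤x+y (0≤fromℕ 2)) 3≤12/δ

    ln1/δ : Carrier
    ln1/δ = ln 1/δ

    1≤2ln1/δ : 1# ≤ fromℕ 2 * ln1/δ
    1≤2ln1/δ = half≤ln 3≤1/δ

    0≤ln1/δ : 0# ≤ ln1/δ
    0≤ln1/δ = *-cancelˡ-≤ (0<fromℕ-suc 1) (≤-respˡ (≈-sym (zeroʳ _)) (≤-trans 0≤1 1≤2ln1/δ))

    1≤2L : 1# ≤ fromℕ 2 * L
    1≤2L = half≤ln 3≤12/δ

    0≤L : 0# ≤ L
    0≤L = *-cancelˡ-≤ (0<fromℕ-suc 1) (≤-respˡ (≈-sym (zeroʳ _)) (≤-trans 0≤1 1≤2L))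

    L≤4ln1/δ : L ≤ fromℕ 4 * ln1/δ
    L≤4ln1/δ = ≤-trans (ln-≤ 1≤12/δ λ x ex≤ → ≤-ln (≤-respʳ 12/δ≈ 1≤12/δ) (≤-respʳ 12/δ≈ ex≤)) (ln-12* 3≤1/δ)

    -- The total failure budget in units of exp (- L). Soundness spends two of the twelve units, one
    -- on sampling and one on the descents; completeness spends four, three of them on sampling.
    12exp[-L]≤δ : fromℕ 12 * exp (- L) ≤ δ
    12exp[-L]≤δ = begin
      fromℕ 12 * exp (- L)              ≈⟨ *-congʳ (/-*-cancel 0<δ) ⟨
      fromℕ 12 / δ * δ * exp (- L)      ≤⟨ *-monoʳ-≤ (0≤exp _) (*-monoʳ-≤ (<⇒≤ 0<δ) (≤-exp-ln 1≤12/δ)) ⟩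
      exp L * δ * exp (- L)             ≈⟨ solve 3 (λ e d f → e :* d :* f := d :* (e :* f)) ≈-refl (exp L) δ
          (exp (- L)) ⟩
      δ * (exp L * exp (- L))           ≈⟨ *-congˡ (exp-neg L) ⟩
      δ * 1#                            ≈⟨ *-identityʳ δ ⟩
      δ                                 ∎
      where open ≤-Reasoning

    m-lower : fromℕ 32 * L ≤ fromℕ m * η ^ 2
    m-lower = /-≤⁻¹ 0<η² (≤-⌈⌉ _)

    q-lower : fromℕ 24 * g * L ≤ fromℕ q * η ^ 2
    q-lower = /-≤⁻¹ 0<η² (≤-⌈⌉ _)

    sampling-rate : L ≤ fromℕ m * (fromℕ 8 * (T * T))
    sampling-rate = *-cancelˡ-≤ (0<fromℕ-suc 31) (≤-respʳ
      (≈-trans (*-congˡ (^-congˡ 2 η≈))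
          (solve 2 (λ m t → m :* (# 16 :* t) :^ 2 := # 32 :* (m :* (# 8 :* (t :* t)))) ≈-refl (fromℕ m) T))
          m-lower)

    testing-rate : fromℕ 6 * g * L ≤ fromℕ 64 * (fromℕ q * (T * T))
    testing-rate = *-cancelˡ-≤ (0<fromℕ-suc 3)
        (≤-respˡ (solve 2 (λ g l → # 24 :* g :* l := # 4 :* (# 6 :* g :* l)) ≈-refl g L)
      (≤-respʳ (≈-trans (*-congˡ (^-congˡ 2 η≈))
          (solve 2 (λ q t → q :* (# 16 :* t) :^ 2 := # 4 :* (# 64 :* (q :* (t :* t)))) ≈-refl (fromℕ q) T))
          q-lower))

    open ChernoffRates.Rates ℜ κ T g L (fromℕ q) 0≤κ 0<T g≈ testing-rate (0≤fromℕ q) public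
      using (λ↓; 0≤λ↓; lower-rate; λ↑; 0≤λ↑; upper-rate)

    -- From L ≥ ½ and η ≤ 1. The cost bounds use it to have ⌊log₂ m⌋ ≥ 1, so that additive constants
    -- can be absorbed.
    16≤m : 16 ℕ.≤ m
    16≤m = fromℕ-cancel {16} {m} (begin
      fromℕ 16                      ≈⟨ *-identityʳ _ ⟨
      fromℕ 16 * 1#                 ≤⟨ *-monoˡ-≤ (0≤fromℕ 16) 1≤2L ⟩
      fromℕ 16 * (fromℕ 2 * L)      ≈⟨ solve 1 (λ l → # 16 :* (# 2 :* l) := # 32 :* l) ≈-refl L ⟩
      fromℕ 32 * L                  ≤⟨ m-lower ⟩
      fromℕ m * η ^ 2               ≤⟨ *-monoˡ-≤ (0≤fromℕ m) (≤-trans η²≤η η≤1) ⟩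
      fromℕ m * 1#                  ≈⟨ *-identityʳ _ ⟩
      fromℕ m                       ∎)
      where open ≤-Reasoning

    1≤q : 1 ℕ.≤ q
    1≤q = pos q q-lower
      where
      0<24gL : 0# < fromℕ 24 * g * L
      0<24gL = 0<-* (0<-* (0<fromℕ-suc 23) (<-≤-trans 0<η η≤g))
        (0≤L , λ 0≈L → <⇒≱ 0<1 (≤-respʳ (≈-trans (*-congˡ (≈-sym 0≈L)) (zeroʳ _)) 1≤2L))
      pos : ∀ q → fromℕ 24 * g * L ≤ fromℕ q * η ^ 2 → 1 ℕ.≤ q
      pos zero    h = contradiction (≤-respʳ (zeroˡ _) h) (<⇒≱ 0<24gL)
      pos (suc q) _ = ℕ.s≤s ℕ.z≤n

    private
      -- `⌈_⌉` adds at most 1, which is at most 2 x ln (1 / δ) / η² as x ≥ η².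
      ceiling-bound : ∀ c x → η ^ 2 ≤ x → 0# ≤ x →
        fromℕ ⌈ fromℕ c * x * L / (η ^ 2) ⌉ ≤ fromℕ (c ℕ.* 4 ℕ.+ 2) * (x * ln1/δ / (η ^ 2))
      ceiling-bound c x η²≤x 0≤x = ≤-trans (⌈⌉-≤ (0≤-/ (0≤-* (0≤-* (0≤fromℕ c) 0≤x) 0≤L) 0<η²)) (begin
        fromℕ c * x * L * i + 1#
          ≤⟨ +-mono-≤ (*-monoʳ-≤ 0≤i (*-monoˡ-≤ (0≤-* (0≤fromℕ c) 0≤x) L≤4ln1/δ)) 1≤ ⟩
        fromℕ c * x * (fromℕ 4 * ln1/δ) * i + fromℕ 2 * ln1/δ * (x * i)
          ≈⟨ solve 4 (λ c x l i → c :* x :* (# 4 :* l) :* i :+ # 2 :* l :* (x :* i)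
               := (c :* # 4 :+ # 2) :* (x :* l :* i)) ≈-refl (fromℕ c) x ln1/δ i ⟩
        (fromℕ c * fromℕ 4 + fromℕ 2) * (x * ln1/δ * i)
          ≈⟨ *-congʳ (≈-trans (fromℕ-+ (c ℕ.* 4) 2) (+-congʳ (fromℕ-* c 4))) ⟨
        fromℕ (c ℕ.* 4 ℕ.+ 2) * (x * ln1/δ * i) ∎)
        where
        open ≤-Reasoning
        i : Carrier
        i = (η ^ 2) ⁻¹
        0≤i : 0# ≤ i
        0≤i = 0≤⁻¹ 0<η²
        1≤ : 1# ≤ fromℕ 2 * ln1/δ * (x * i)
        1≤ = ≤-respˡ (*-identityˡ 1#)
            (*-mono-≤ 0≤1 1≤2ln1/δ 0≤1 (≤-/ 0<η² (≤-respˡ (≈-sym (*-identityˡ _)) η²≤x)))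

    q-upper : fromℕ q ≤ fromℕ 130 * (g * ln1/δ / (η ^ 2))
    q-upper = ≤-trans (ceiling-bound 24 g (≤-trans η²≤η η≤g) 0≤g)
      (*-monoʳ-≤ (0≤-/ (0≤-* 0≤g 0≤ln1/δ) 0<η²) (fromℕ-mono {98} {130} (ℕ.m≤m+n 98 32)))

    m-upper : fromℕ m ≤ fromℕ 130 * (ln1/δ / (η ^ 2))
    m-upper = begin
      fromℕ m                                       ≤⟨ ⌈⌉-≤ (0≤-/ (0≤-* (0≤fromℕ 32) 0≤L) 0<η²) ⟩
      fromℕ 32 * L * i + 1#
        ≤⟨ +-mono-≤ (*-monoʳ-≤ 0≤i (*-monoˡ-≤ (0≤fromℕ 32) L≤4ln1/δ)) 1≤ ⟩
      fromℕ 32 * (fromℕ 4 * ln1/δ) * i + fromℕ 2 * ln1/δ * i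
        ≈⟨ solve 2 (λ l i → # 32 :* (# 4 :* l) :* i :+ # 2 :* l :* i := # 130 :* (l :* i)) ≈-refl ln1/δ i ⟩
      fromℕ 130 * (ln1/δ * i)                       ∎
      where
      open ≤-Reasoning
      i : Carrier
      i = (η ^ 2) ⁻¹
      0≤i : 0# ≤ i
      0≤i = 0≤⁻¹ 0<η²
      1≤ : 1# ≤ fromℕ 2 * ln1/δ * i
      1≤ = ≤-respˡ (*-identityˡ 1#) (*-mono-≤ 0≤1 1≤2ln1/δ 0≤1
        (≤-respʳ (*-identityˡ i) (≤-/ 0<η² (≤-respˡ (≈-sym (*-identityˡ _)) (≤-trans η²≤η η≤1)))))

-- Mean mismatch and its effect on expectations

module Mismatch {{ℜ : RealField}} (N K : ℕ) .{{_ : NonZero K}} (I : Model.Instance {{ℜ}} N K) where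

  open OrderLemmas ℜ
  open HoeffdingLemma ℜ
  open Model {{ℜ}} N K
  open Instance I
  open Grid N K

  F-P F-V gap : Fin N → Carrier
  F-P x = val (f-P x)
  F-V x = val (f-V x)
  gap x = abs (F-P x - F-V x)

  0≤F-P : ∀ x → 0# ≤ F-P x
  0≤F-P x = val-0≤ (f-P x)

  F-P≤1 : ∀ x → F-P x ≤ 1#
  F-P≤1 x = val-≤1 (f-P x)

  0≤F-V : ∀ x → 0# ≤ F-V x
  0≤F-V x = val-0≤ (f-V x)

  F-V≤1 : ∀ x → F-V x ≤ 1#
  F-V≤1 x = val-≤1 (f-V x)

  μ-V : Carrier
  μ-V = expectation D F-V

  0≤gap : ∀ x → 0# ≤ gap x
  0≤gap x with ≤-total 0# (F-P x - F-V x)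
  ... | inj₁ 0≤d = ≤-trans 0≤d (≤-abs _)
  ... | inj₂ d≤0 = ≤-trans (0≤-neg d≤0) (neg-≤-abs _)

  gap≤1 : ∀ x → gap x ≤ 1#
  gap≤1 x = abs-≤
    (signed-≤ true (0≤F-P x) (F-P≤1 x) (0≤F-V x) (F-V≤1 x))
    (≤-respˡ (solve 2 (λ p v → v :- p := :- (p :- v)) ≈-refl (F-P x) (F-V x))
        (signed-≤ false (0≤F-P x) (F-P≤1 x) (0≤F-V x) (F-V≤1 x)))

  -- Pointwise the gap is at most γ + (1 - γ) on B and γ elsewhere. The mean γ + (1 - γ) D(B)
  -- increases with D(B) because γ ≤ 1, so ρ may replace D(B), and the result is κ written the other
  -- way round.
  mean-gap-≤ : ∀ {ρ γ} → γ ≤ 1# → BoundedMismatch ρ γ I → expectation D gap ≤ ρ + (1# - ρ) * γ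
  mean-gap-≤ {ρ} {γ} γ≤1 (B , mass≤ρ , outside) = begin
    expectation D gap
      ≤⟨ expectation-mono D pointwise ⟩
    expectation D (λ x → γ + (1# - γ) * inB x)
      ≈⟨ expectation-affine D γ (1# - γ) inB ⟩
    γ + (1# - γ) * expectation D inB
      ≈⟨ +-congˡ (*-congˡ (sum-cong-≋ {N} mass≈)) ⟩
    γ + (1# - γ) * mass B
      ≤⟨ +-monoʳ-≤ _ _ _ (*-monoˡ-≤ (0≤-diff γ≤1) mass≤ρ) ⟩
    γ + (1# - γ) * ρ
      ≈⟨ solve 2 (λ r c → c :+ (# 1 :- c) :* r := r :+ (# 1 :- r) :* c) ≈-refl ρ γ ⟩
    ρ + (1# - ρ) * γ ∎
    where
    open ≤-Reasoning
    inB : Fin N → Carrier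
    inB x = if Vec.lookup B x then 1# else 0#
    mass≈ : ∀ x → weight D x * inB x ≈ (if Vec.lookup B x then weight D x else 0#)
    mass≈ x with Vec.lookup B x
    ... | true  = *-identityʳ _
    ... | false = zeroʳ _
    pointwise : ∀ x → gap x ≤ γ + (1# - γ) * inB x
    pointwise x with Vec.lookup B x in eq
    ... | true  = ≤-respʳ (solve 1 (λ c → # 1 := c :+ (# 1 :- c) :* # 1) ≈-refl γ) (gap≤1 x)
    ... | false = ≤-respʳ (solve 1 (λ c → c := c :+ (# 1 :- c) :* # 0) ≈-refl γ)
                    (outside x λ x∈B → contradiction (≡.trans (≡.sym (Vec.[]=⇒lookup x∈B)) eq) λ ())

  private
    mean-shift : ∀ {F G : Fin N → Carrier} → (∀ x → F x ≤ G x + gap x) → expectation D F ≤ expectation D G +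
        expectation D gap
    mean-shift F≤ = ≤-respʳ (expectation-+ D _ _) (expectation-mono D F≤)

  μ-P≤ : μ-P ≤ μ-V + expectation D gap
  μ-P≤ = mean-shift λ x → ≤-respˡ (solve 2 (λ p v → v :+ (p :- v) := p) ≈-refl (F-P x) (F-V x))
      (+-monoʳ-≤ _ _ _ (≤-abs _))

  μ-V≤ : μ-V ≤ μ-P + expectation D gap
  μ-V≤ = mean-shift λ x → ≤-respˡ (solve 2 (λ p v → p :+ :- (p :- v) := v) ≈-refl (F-P x) (F-V x))
      (+-monoʳ-≤ _ _ _ (neg-≤-abs _))

  -- A lower tail of F is an upper tail of 1 - F, so `excess-tail` serves both sides.
  complement : (Fin N → Carrier) → Fin N → Carrier
  complement F x = 1# - F x

  mean-complement : ∀ F → expectation D (complement F) ≈ 1# - expectation D F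
  mean-complement F = ≈-trans (expectation-cong D λ x → solve 1 (λ f → # 1 :- f := # 1 :+ :- # 1 :* f) ≈-refl
      (F x))
    (≈-trans (expectation-affine D 1# (- 1#) F)
        (solve 1 (λ f → # 1 :+ :- # 1 :* f := # 1 :- f) ≈-refl (expectation D F)))

-- Lower-tail bound for the count over adaptive descents

module RepeatedDescents {{ℜ : RealField}} (N K : ℕ) .{{_ : NonZero K}} {{p : Parameters}}
                         (I : Model.Instance N K) (P : Model.Prover N K)
                         (tree : BalancedTree (Parameters.m p)) where

  open OrderLemmas ℜ
  open Exponential ℜ
  open HoeffdingLemma ℜ
  open RandomExperiments ℜ
  open Model {{ℜ}} N K
  open Instance I
  open Parameters p
  open Protocol tree
  open Grid N K
  open Mismatch N K I
  open Acceptance N K I P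
  open SingleDescent N K I P

  private instance
    m-nonZero : NonZero m
    m-nonZero = size-nonZero tree

  0<m : 0# < fromℕ m
  0<m = 0<fromℕ m

  module _ (xs : Vec (Fin N) m) (W : Carrier) (W∈ : InGrid m W) (b : Bool)
           (λ₀ : Carrier) (0≤λ : 0# ≤ λ₀) (π : Carrier)
           (biased : fromℕ m * π ≤ signed b W (sumVec F-V xs)) where

    private
      c thr : Carrier
      c = 1# - exp (- λ₀)
      thr = g * fromℕ q / fromℕ 2

      0≤c : 0# ≤ c
      0≤c = 0≤-diff (≤-respʳ exp-0 (exp-mono-≤ (neg-≤0 0≤λ)))

      c≤1 : c ≤ 1#
      c≤1 = ≤-by-diff (0≤exp (- λ₀)) (solve 1 (λ e → # 1 :- e :+ e := # 1) ≈-refl _)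

      v : Fin m → Carrier
      v j = F-V (Vec.lookup xs j)

      0≤v : ∀ j → 0# ≤ v j
      0≤v j = 0≤F-V (Vec.lookup xs j)

      v≤1 : ∀ j → v j ≤ 1#
      v≤1 j = F-V≤1 (Vec.lookup xs j)

      -- Dominates the indicator of the final acceptance Z ≤ thr, and shrinks by exp (- λ₀) with
      -- every detection.
      weightZ : ℕ → Carrier
      weightZ Z = exp (λ₀ * (thr - fromℕ Z))

      weightZ-suc : ∀ Z → weightZ (suc Z) ≈ exp (- λ₀) * weightZ Z
      weightZ-suc Z = ≈-trans
          (exp-cong (solve 3 (λ l t z → l :* (t :- (# 1 :+ z)) := :- l :+ l :* (t :- z)) ≈-refl λ₀ thr
          (fromℕ Z))) (exp-+ _ _)

    -- A supermartingale argument as an induction on the remaining descents: each descent multiplies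
    -- the weight on average by at most 1 - c π. Quantifying over `st` absorbs the adaptivity of the
    -- prover.
    descents-bound : ∀ t Z st → acc (descents xs W t Z) st ≤ weightZ Z * (1# - c * π) ^ t

    private
      tested : ∀ t Z j A st → InGrid 1 A →
        acc (query (Vec.lookup xs j) λ v → coin K λ U → descents xs W t
            (if compare A (val v) U then suc Z else Z)) st
        ≤ potential b c (weightZ Z * (1# - c * π) ^ t) 1 A (v j)

      0≤R : ∀ t Z → 0# ≤ weightZ Z * (1# - c * π) ^ t

      -- `biased` itself limits π: an oriented difference of two sums in [0, m] is at most m, so π ≤
      -- 1, and c ≤ 1.
      0≤rate : 0# ≤ 1# - c * π
      0≤rate = 0≤-diff (*-cancelˡ-≤ 0<m (begin
        fromℕ m * (c * π)     ≈⟨ solve 3 (λ m c p → m :* (c :* p) := c :* (m :* p)) ≈-refl (fromℕ m) c π ⟩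
        c * (fromℕ m * π)     ≤⟨ *-monoˡ-≤ 0≤c (≤-trans biased (signed-≤ b (grid-0≤ W∈) (grid-≤ W∈)
                                    (0≤-sum 0≤v) (sum-≤-size v≤1)))  ⟩
        c * fromℕ m           ≤⟨ *-monoʳ-≤ (0≤fromℕ m) c≤1 ⟩
        1# * fromℕ m          ≈⟨ *-comm _ _ ⟩
        fromℕ m * 1#          ∎))
        where open ≤-Reasoning

      0≤R t Z = 0≤-* (0≤exp _) (0≤-^ 0≤rate t)

      tested t Z j A st A∈ = begin
        acc (query x λ v → coin K λ U → next U v) st
          ≈⟨ acc-query x (λ v → coin K λ U → next U v) st ⟩
        average K (λ U → acc (next U (f-V x)) st)
          ≤⟨ average-mono K (λ U → outcome (compare A (v j) U)) ⟩
        average K (λ U → R + - (c * R) * indicator (compare A (v j) U))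
          ≈⟨ ≈-trans (average-+ K (λ _ → R) _) (+-cong (average-const K R) (average-*ˡ K (- (c * R)) _)) ⟩
        R + - (c * R) * average K (indicator ∘ compare A (v j))
          ≈⟨ solve 3 (λ r c u → r :+ :- (c :* r) :* u := r :* (# 1 :- c :* u)) ≈-refl R c _ ⟩
        R * (1# - c * average K (indicator ∘ compare A (v j)))
          ≤⟨ *-monoˡ-≤ (0≤R t Z) (+-monoʳ-≤ _ _ _ (neg-anti-≤ (*-monoˡ-≤ 0≤c
               (signed-≤-average-compare b (proj₁ A-val) (f-V x) (proj₂ A-val) ≈-refl)))) ⟩
        R * (1# - c * signed b A (v j))
          ≈⟨ *-congˡ (+-congʳ fromℕ-1) ⟨
        R * (fromℕ 1 - c * signed b A (v j)) ∎
        where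
        open ≤-Reasoning
        x = Vec.lookup xs j
        R = weightZ Z * (1# - c * π) ^ t
        A-val = grid-val A∈
        next : Fin K → Fin (suc K) → Verifier
        next U v = descents xs W t (if compare A (val v) U then suc Z else Z)
        outcome : ∀ b → acc (descents xs W t (if b then suc Z else Z)) st ≤ R + - (c * R) * indicator b
        outcome true  = ≤-trans (descents-bound t (suc Z) st) (≤-reflexive (≈-trans (*-congʳ (weightZ-suc Z))
          (solve 3 (λ e w r → e :* w :* r := w :* r :+ :- ((# 1 :- e) :* (w :* r)) :* # 1) ≈-refl (exp (- λ₀))
              (weightZ Z) ((1# - c * π) ^ t))))
        outcome false = ≤-trans (descents-bound t Z st)
            (≤-reflexive (solve 2 (λ r c → r := r :+ :- (c :* r) :* # 0) ≈-refl R c))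

    descents-bound zero Z st with fromℕ Z ≤? thr
    ... | yes Z≤thr = ≤-respʳ (≈-sym (*-identityʳ _)) (1≤exp (0≤-* 0≤λ (0≤-diff Z≤thr)))
    ... | no  _     = ≤-respʳ (≈-sym (*-identityʳ _)) (0≤exp _)
    descents-bound (suc t) Z st = begin
      average m (λ J → acc (descend tree 0 J W (k J)) st)
        ≤⟨ *-monoʳ-≤ (0≤⁻¹ 0<m) (descend-bound b c R 0≤c c≤1 (0≤R t Z) tree 0 W v k
             0≤v v≤1 (tested t Z) W∈ st) ⟩
      R * (fromℕ m - c * signed b W (sum v)) / fromℕ m
        ≤⟨ /-≤ 0<m (begin
             R * (fromℕ m - c * signed b W (sum v))
               ≤⟨ *-monoˡ-≤ (0≤R t Z) (+-monoʳ-≤ _ _ _ (neg-anti-≤ (*-monoˡ-≤ 0≤c biased))) ⟩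
             R * (fromℕ m - c * (fromℕ m * π))
               ≈⟨ solve 5 (λ w r m c p → w :* r :* (m :- c :* (m :* p)) := w :* ((# 1 :- c :* p) :* r) :* m)
                    ≈-refl (weightZ Z) ((1# - c * π) ^ t) (fromℕ m) c π ⟩
             weightZ Z * (1# - c * π) ^ suc t * fromℕ m ∎) ⟩
      weightZ Z * (1# - c * π) ^ suc t ∎
      where
      open ≤-Reasoning
      R = weightZ Z * (1# - c * π) ^ t
      k : Fin m → Carrier → Verifier
      k J A = query (Vec.lookup xs J) λ v → coin K λ U → descents xs W t
          (if compare A (val v) U then suc Z else Z)

    descents-≤ : ∀ st → acc (descents xs W q 0) st ≤ exp (- (fromℕ q * (c * π - λ₀ * (g / fromℕ 2))))
    descents-≤ st = begin
      acc (descents xs W q 0) st                     ≤⟨ descents-bound q 0 st ⟩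
      weightZ 0 * (1# - c * π) ^ q                   ≤⟨ *-monoˡ-≤ (0≤exp _) (^-mono-≤ 0≤rate (1+x≤exp _) q) ⟩
      weightZ 0 * exp (- (c * π)) ^ q                ≈⟨ *-congˡ (exp-· q _) ⟨
      weightZ 0 * exp (fromℕ q * - (c * π))          ≈⟨ exp-+ _ _ ⟨
      exp (λ₀ * (thr - 0#) + fromℕ q * - (c * π))
        ≈⟨ exp-cong (solve 5 (λ l g q i u → l :* (g :* q :* i :- # 0) :+ q :* :- u := :-
            (q :* (u :- l :* (g :* i))))
             ≈-refl λ₀ g (fromℕ q) (fromℕ 2 ⁻¹) (c * π)) ⟩
      exp (- (fromℕ q * (c * π - λ₀ * (g / fromℕ 2)))) ∎
      where open ≤-Reasoning

-- Soundness against arbitrary provers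

module Soundness {{ℜ : RealField}} (N K : ℕ) .{{_ : NonZero K}} {{p : Parameters}}
                 (tree : BalancedTree (Parameters.m p)) where

  open OrderLemmas ℜ
  open Exponential ℜ
  open HoeffdingLemma ℜ
  open RandomExperiments ℜ
  open SamplingTail ℜ
  open Model {{ℜ}} N K
  open Parameters p
  open ParameterBounds
  open Protocol tree
  open Grid N K
  open DescentShape N K using (does-true; ∧-true)

  0<m : 0# < fromℕ m
  0<m = 0<fromℕ m {{size-nonZero tree}}

  rootCheck : Carrier → Carrier → Bool
  rootCheck σ W = does (inGrid? m W) ∧ does (abs (W / fromℕ m - σ) ≤? ε-c + a)

  afterRoot : Carrier → Vec (Fin N) m → Carrier → Verifier
  afterRoot σ xs W = if rootCheck σ W then descents xs W q 0 else halt false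

  afterSample : Carrier → Vec (Fin N) m → Verifier
  afterSample σ xs = send (sample (Vec.toList xs)) (recv (root m) (afterRoot σ xs))

  half-g : g / fromℕ 2 ≈ κ + fromℕ 8 * T
  half-g = ≈-sym (/-unique (0<fromℕ-suc 1) (≈-trans
    (solve 2 (λ k t → (k :+ # 8 :* t) :* # 2 := # 2 :* k :+ # 16 :* t) ≈-refl κ T) (≈-sym g≈)))

  sumVec-complement : ∀ {n} F (xs : Vec (Fin N) n) → sumVec (λ x → 1# - F x) xs ≈ fromℕ n - sumVec F xs
  sumVec-complement F []       = solve 0 (# 0 := # 0 :- # 0) ≈-refl
  sumVec-complement F (x ∷ xs) = ≈-trans (+-congˡ (sumVec-complement F xs))
    (solve 3 (λ f n s → # 1 :- f :+ (n :- s) := # 1 :+ n :- (f :+ s)) ≈-refl _ _ _)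

  module _ (I : Instance) (P : Prover) (bm : BoundedMismatch ρ γ I) (admissible : Admissible) where

    open Admissible admissible using (γ≤1)

    open Instance I
    open Prover P using (observe; answer) renaming (start to start₀)
    open Execution I P using (runComp)
    open Mismatch N K I
    open Acceptance N K I P
    open RepeatedDescents N K I P tree using (descents-≤)

    private
      π : Carrier
      π = κ + fromℕ 12 * T

      G : Carrier
      G = expectation D gap

      G≤κ : G ≤ κ
      G≤κ = mean-gap-≤ γ≤1 bm

      -- The bias budget: of the gap g, κ is lost between μ-P and μ-V, 2 T to the sampling error,
      -- and another 2 T = a to the tolerance of the root check.
      π≈ : π ≈ ε-f - ε-c - κ - fromℕ 4 * T
      π≈ = ≈-trans (solve 2 (λ k t → k :+ # 12 :* t := # 2 :* k :+ # 16 :* t :- k :- # 4 :* t) ≈-refl κ T)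
        (+-congʳ (+-congʳ (≈-sym g≈)))

    -- The orientation b precedes W: the prover picks W after seeing the sample, yet every W that
    -- passes the root check must err in the same direction.
    Biased : Carrier → Vec (Fin N) m → Bool → Set
    Biased σ xs b = ∀ W → InGrid m W → abs (W / fromℕ m - σ) ≤ ε-c + a → fromℕ m * π ≤ signed b W
        (sumVec F-V xs)

    biased-acc : ∀ σ xs b → Biased σ xs b → ∀ st → acc (afterSample σ xs) st ≤ exp (- L)
    biased-acc σ xs b biased st = begin
      acc (afterSample σ xs) st
        ≈⟨ acc-send (sample (Vec.toList xs)) (recv (root m) (afterRoot σ xs)) st ⟩
      Ex (λ (st′ , _) → acc (recv (root m) (afterRoot σ xs)) st′)
          (runComp (observe (sample (Vec.toList xs)) st))
        ≤⟨ Ex-≤ (λ (st′ , _) → ≤-respˡ (≈-sym (acc-recv (root m) (afterRoot σ xs) st′))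
             (Ex-≤ (λ ((st″ , W) , _) → root-acc W st″) (runComp (answer (root m) st′))))
             (runComp (observe (sample (Vec.toList xs)) st)) ⟩
      exp (- L) ∎
      where
      open ≤-Reasoning
      root-acc : ∀ W st → acc (afterRoot σ xs W) st ≤ exp (- L)
      root-acc W st = checked (rootCheck σ W) ≡.refl
        where
        checked : ∀ ok → rootCheck σ W ≡ ok → acc (if ok then descents xs W q 0 else halt false) st ≤ exp (- L)
        checked false _  = 0≤exp _
        checked true  eq =
          let eq₀ , eq₁ = ∧-true {does (inGrid? m W)} eq
              W∈ = does-true (inGrid? m W) eq₀
          in ≤-trans
            (descents-≤ xs W W∈ b (λ↓ admissible) (0≤λ↓ admissible) π
              (biased W W∈ (does-true (abs (W / fromℕ m - σ) ≤? ε-c + a) eq₁)) st)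
            (exp-mono-≤ (neg-anti-≤ (≤-respʳ (*-congˡ (+-congˡ (-‿cong (*-congˡ (≈-sym half-g)))))
              (lower-rate admissible))))

    -- A sample mean of f far above its expectation is paid for by `excess`;
    -- otherwise every admissible root claim is biased against f-V.
    acc-≤-tail : ∀ σ b {f} (0≤f : ∀ x → 0# ≤ f x) (f≤1 : ∀ x → f x ≤ 1#) →
      (∀ xs → sumVec f xs ≤ fromℕ m * (expectation D f + fromℕ 2 * T) → Biased σ xs b) →
      acceptPr I (verifier σ) P ≤ δ
    acc-≤-tail σ b {f} 0≤f f≤1 typical = begin
      acceptPr I (verifier σ) P
        ≈⟨ acc-drawMany m (afterSample σ) start₀ ⟩
      ExVec D m (λ xs → acc (afterSample σ xs) start₀)
        ≤⟨ ExVec-mono D m (λ xs → pointwise xs) ⟩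
      ExVec D m (λ xs → exc xs + exp (- L))
        ≈⟨ ≈-trans (ExVec-+ D m exc (λ _ → exp (- L))) (+-congˡ (ExVec-const D m _)) ⟩
      ExVec D m exc + exp (- L)
        ≤⟨ +-monoˡ-≤ _ (≤-trans (excess-tail D 0≤f f≤1 T 0≤T m)
            (exp-mono-≤ (neg-anti-≤ (sampling-rate admissible)))) ⟩
      exp (- L) + exp (- L)
        ≤⟨ ≤-by-diff (0≤-* (0≤fromℕ 10) (0≤exp _)) (solve 1 (λ e → e :+ e :+ # 10 :* e := # 12 :* e) ≈-refl _) ⟩
      fromℕ 12 * exp (- L)
        ≤⟨ 12exp[-L]≤δ admissible ⟩
      δ ∎
      where
      open ≤-Reasoning
      0≤T : 0# ≤ T
      0≤T = <⇒≤ (0<T admissible)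
      exc : Vec (Fin N) m → Carrier
      exc = excess D 0≤f f≤1 T 0≤T
      pointwise : ∀ xs → acc (afterSample σ xs) start₀ ≤ exc xs + exp (- L)
      pointwise xs with fromℕ m * (expectation D f + fromℕ 2 * T) ≤? sumVec f xs
      ... | yes h = ≤-trans (acc≤1 (afterSample σ xs) start₀)
          (≤-trans (1≤excess D 0≤f f≤1 T 0≤T xs h) (x≤x+y (0≤exp _)))
      ... | no ¬h = ≤-trans (biased-acc σ xs b (typical xs (<⇒≤ (≰⇒> ¬h))) start₀)
              (x≤y+x (0≤excess D 0≤f f≤1 T 0≤T xs))

    soundness : ∀ σ → ε-f < Δ-mis I σ → acceptPr I (verifier σ) P ≤ δ
    soundness σ ε-f<Δ with abs-cases (μ-P - σ)
    -- Here σ < μ-P, so every admissible W is too small against f-V. The danger is a sample on which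
    -- f-V is low, which is an upper tail of 1 - f-V.
    ... | inj₁ Δ≈ = acc-≤-tail σ false {complement F-V}
            (λ x → 0≤-diff (F-V≤1 x))
                (λ x → ≤-by-diff (0≤F-V x) (solve 1 (λ f → # 1 :- f :+ f := # 1) ≈-refl _))
            λ xs ΣF≤ W W∈ near → ≤-respˡ (*-congˡ (≈-sym π≈)) (≤-by-diff
              (0≤-+ (0≤-+
                (0≤-diff (≤-respˡ (sumVec-complement F-V xs)
                    (≤-respʳ (*-congˡ (+-congʳ (mean-complement F-V))) ΣF≤)))
                (0≤-diff (/-≤⁻¹ 0<m (W/m≤ near))))
                (0≤-* (0≤fromℕ m) (0≤-+ (0≤-+ (0≤-diff μ-P≤) (0≤-diff G≤κ))
                    (0≤-diff (≤-respʳ Δ≈ (<⇒≤ ε-f<Δ))))))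
              (certificate (fromℕ m) T (sumVec F-V xs) W))
      where
      W/m≤ : ∀ {w} → abs (w - σ) ≤ ε-c + a → w ≤ σ + (ε-c + fromℕ 2 * T)
      W/m≤ {w} near = ≤-by-diff (0≤-diff (≤-trans (≤-abs (w - σ)) (≤-respʳ (+-congˡ a≈) near)))
        (solve 3 (λ w s e → w :+ (e :- (w :- s)) := s :+ e) ≈-refl w σ (ε-c + fromℕ 2 * T))
      certificate : ∀ m t ΣF W →
        m * (ε-f - ε-c - κ - fromℕ 4 * t) + (m * (1# - μ-V + fromℕ 2 * t) - (m - ΣF)
          + ((σ + (ε-c + fromℕ 2 * t)) * m - W) + m * (μ-V + G - μ-P + (κ - G) + (μ-P - σ - ε-f))) ≈ ΣF - W
      certificate m t ΣF W = solve 11 (λ m t ΣF W v p k G s f c →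
        m :* (f :- c :- k :- # 4 :* t) :+ (m :* (# 1 :- v :+ # 2 :* t) :- (m :- ΣF)
          :+ ((s :+ (c :+ # 2 :* t)) :* m :- W) :+ m :* (v :+ G :- p :+ (k :- G) :+ (p :- s :- f))) := ΣF :- W)
        ≈-refl m t ΣF W μ-V μ-P κ G σ ε-f ε-c
    -- Here σ > μ-P, so W is too large, and the danger is a sample on which f-V is high.
    ... | inj₂ Δ≈ = acc-≤-tail σ true {F-V} 0≤F-V F-V≤1
            λ xs ΣF≤ W W∈ near → ≤-respˡ (*-congˡ (≈-sym π≈)) (≤-by-diff
              (0≤-+ (0≤-+ (0≤-diff ΣF≤) (0≤-diff (≤W near)))
                (0≤-* (0≤fromℕ m) (0≤-+ (0≤-+ (0≤-diff μ-V≤) (0≤-diff G≤κ))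
                    (0≤-diff (≤-respʳ Δ≈ (<⇒≤ ε-f<Δ))))))
              (certificate (fromℕ m) T (sumVec F-V xs) W))
      where
      ≤W : ∀ {W} → abs (W / fromℕ m - σ) ≤ ε-c + a → (σ - (ε-c + fromℕ 2 * T)) * fromℕ m ≤ W
      ≤W {W} near = ≤-respʳ (/-*-cancel 0<m) (*-monoʳ-≤ (0≤fromℕ m)
        (≤-by-diff (0≤-diff (≤-trans (neg-≤-abs (W / fromℕ m - σ)) (≤-respʳ (+-congˡ a≈) near)))
          (solve 3 (λ w s e → s :- e :+ (e :- :- (w :- s)) := w) ≈-refl (W / fromℕ m) σ (ε-c + fromℕ 2 * T))))
      certificate : ∀ m t ΣF W →
        m * (ε-f - ε-c - κ - fromℕ 4 * t) + (m * (μ-V + fromℕ 2 * t) - ΣF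
          + (W - (σ - (ε-c + fromℕ 2 * t)) * m) + m * (μ-P + G - μ-V + (κ - G) + (- (μ-P - σ) - ε-f))) ≈ W - ΣF
      certificate m t ΣF W = solve 11 (λ m t ΣF W v p k G s f c →
        m :* (f :- c :- k :- # 4 :* t) :+ (m :* (v :+ # 2 :* t) :- ΣF
          :+ (W :- (s :- (c :+ # 2 :* t)) :* m) :+ m :* (p :+ G :- v :+ (k :- G) :+ (:- (p :- s) :- f))) := W :-
              ΣF)
        ≈-refl m t ΣF W μ-V μ-P κ G σ ε-f ε-c

-- Deterministic behaviour of the honest prover

module HonestRun {{ℜ : RealField}} (N K : ℕ) .{{_ : NonZero K}} (I : Model.Instance {{ℜ}} N K) where

  open OrderLemmas ℜ
  open Model {{ℜ}} N K
  open Instance I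
  open Execution I honestProver
  open Grid N K
  open DescentShape N K
  open Acceptance N K I honestProver

  -- Traces the one path that a computation without coins and draws takes when f-P answers its
  -- queries, so that a branching tree can be handled as a value together with its list of queries.
  data Yields {A : Set} : ProverComp A → A → List (Fin N) → Set where
    return : ∀ a → Yields (return a) a []
    query  : ∀ {x k a qs} → Yields (k (f-P x)) a qs → Yields (query x k) a (x ∷ qs)

  runComp-yields : ∀ {A : Set} {c : ProverComp A} {a qs} → Yields c a qs →
                   runComp c ≡ pure (a , List.map P-queries qs)
  runComp-yields (return a) = ≡.refl
  runComp-yields (query {x} {k} y) = ≡.cong (log (P-queries x ∷ [])) (runComp-yields y)

  mapComp-yields : ∀ {A B : Set} (φ : A → B) {c a qs} → Yields c a qs → Yields (mapComp φ c) (φ a) qs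
  mapComp-yields φ (return a) = return (φ a)
  mapComp-yields φ (query y)  = query (mapComp-yields φ y)

  answers : List (Fin N) → Fin N → Fin (suc K)
  answers []       = λ _ → fzero
  answers (x ∷ xs) = λ y → if does (x Fin.≟ y) then f-P x else answers xs y

  queryAll-yields : ∀ xs → Yields (queryAll xs) (answers xs) xs
  queryAll-yields []       = return _
  queryAll-yields (x ∷ xs) = query (mapComp-yields _ (queryAll-yields xs))

  answers-∈ : ∀ {xs y} → y ∈ xs → answers xs y ≡ f-P y
  answers-∈ {x ∷ xs} {y} y∈ with x Fin.≟ y
  ... | yes ≡.refl = ≡.refl
  answers-∈ (here ≡.refl) | no x≢y = contradiction ≡.refl x≢y
  answers-∈ (there y∈)    | no _   = answers-∈ y∈

  honestState : List (Fin N) → List (Fin (suc K))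
  honestState = List.map f-P

  observe-sample : ∀ xs st → runComp (Prover.observe honestProver (sample xs) st)
                   ≡ pure (honestState xs , List.map P-queries (List.deduplicate Fin._≟_ xs))
  observe-sample xs st = ≡.trans
    (runComp-yields (mapComp-yields (λ f → List.map f xs) (queryAll-yields (List.deduplicate Fin._≟_ xs))))
    (≡.cong (λ ps → pure (ps , _))
        (List.map-cong-local (All.tabulate λ x∈xs → answers-∈ (∈-deduplicate⁺ Fin._≟_ x∈xs))))

  acc-sample : ∀ xs v st → acc (send (sample xs) v) st ≈ acc v (honestState xs)
  acc-sample xs v st = ≈-trans (acc-send (sample xs) v st)
    (≈-reflexive (≡.cong (Ex (λ (st′ , _) → acc v st′)) (observe-sample xs st)))
    where open RandomExperiments ℜ

  acc-reveal : ∀ b v st → acc (send (reveal b) v) st ≈ acc v st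
  acc-reveal b v st = acc-send (reveal b) v st

  acc-root : ∀ n k st → acc (recv (root n) k) st ≈ acc (k (total st)) st
  acc-root n k st = acc-recv (root n) k st

  acc-children : ∀ lo a b k st → acc (recv (children lo a b) k) st
    ≈ acc (k (total (List.take a (List.drop lo st)) , total (List.take b (List.drop (lo ℕ.+ a) st)))) st
  acc-children lo a b k st = acc-recv (children lo a b) k st

  total-++ : ∀ xs ys → total (xs ++ ys) ≈ total xs + total ys
  total-++ []       ys = ≈-sym (+-identityˡ _)
  total-++ (x ∷ xs) ys = ≈-trans (+-congˡ (total-++ xs ys)) (≈-sym (+-assoc _ _ _))

  total-grid : ∀ {s} (v : Vec (Fin (suc K)) s) → InGrid s (total (Vec.toList v))
  total-grid {s} v = fromℕ< (ℕ.s≤s (bound v)) , ≈-trans (total≈ v)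
      (*-congʳ (≈-reflexive (≡.cong fromℕ (≡.sym (Fin.toℕ-fromℕ< (ℕ.s≤s (bound v)))))))
    where
    size : ∀ {s} → Vec (Fin (suc K)) s → ℕ
    size []      = 0
    size (x ∷ v) = toℕ x ℕ.+ size v
    bound : ∀ {s} (v : Vec (Fin (suc K)) s) → size v ℕ.≤ K ℕ.* s
    bound []              = ℕ.z≤n
    bound {suc s} (x ∷ v) = ≡.subst (size (x ∷ v) ℕ.≤_) (≡.sym (ℕ.*-suc K s))
        (ℕ.+-mono-≤ (ℕ.s≤s⁻¹ (Fin.toℕ<n x)) (bound v))
    total≈ : ∀ {s} (v : Vec (Fin (suc K)) s) → total (Vec.toList v) ≈ fromℕ (size v) / fromℕ K
    total≈ []      = ≈-sym (zeroˡ _)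
    total≈ (x ∷ v) = ≈-trans (+-congˡ (total≈ v))
        (≈-trans (≈-sym (distribʳ _ _ _)) (*-congʳ (≈-sym (fromℕ-+ (toℕ x) (size v)))))

  segment : ∀ {A : Set} (pre : List A) {s} (v : Vec A s) post →
            List.take s (List.drop (length pre) (pre ++ Vec.toList v ++ post)) ≡ Vec.toList v
  segment []        []      post = ≡.refl
  segment []        (x ∷ v) post = ≡.cong (x ∷_) (segment [] v post)
  segment (_ ∷ pre) v       post = segment pre v post

  -- `pre` and `post` place the current interval inside the full list held as state, from which the
  -- prover cuts both partial sums. The leaf claim A is existential because it equals the value of
  -- f-P only up to `_≈_`, while the continuation `k` depends on its representation.
  honest-descend : ∀ {s} (tree : BalancedTree s) (pre : List _) (v : Vec (Fin (suc K)) s) (post : List _) →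
    ∀ {lo w ps} → lo ≡ length pre → ps ≡ pre ++ Vec.toList v ++ post → w ≈ total (Vec.toList v) →
    ∀ j k → ∃ λ A → A ≈ val (Vec.lookup v j) × acc (descend tree lo j w k) ps ≈ acc (k A) ps
  honest-descend leaf pre (x ∷ []) post {w = w} _ _ w≈ fzero k = w , ≈-trans w≈ (+-identityʳ _) , ≈-refl
  honest-descend (node {a} {b} p l r) pre v post {lo} {w} {ps} ≡.refl ≡.refl w≈ j k with Vec.splitAt a v
  ... | v₀ , v₁ , ≡.refl = proj₁ found , proj₁ (proj₂ found) , ≈-trans
        (≈-trans (acc-children lo a b (childrenReply (descend (node p l r) lo j w k)) ps)
          (≈-reflexive (≡.cong (λ v → acc v ps) (≡.trans
            (≡.cong₂ (λ w₀ w₁ → childrenReply (descend (node p l r) lo j w k) (w₀ , w₁)) claim₀ claim₁)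
            (≡.trans (descend-node l r lo w₀ w₁ k p w j)
                (≡.cong (λ o → if o then descendChild l r lo w₀ w₁ k (splitAt a j) else halt false) ok))))))
        (proj₂ (proj₂ found))
    where
    w₀ w₁ : Carrier
    w₀ = total (Vec.toList v₀)
    w₁ = total (Vec.toList v₁)
    ps≡₀ : pre ++ Vec.toList (v₀ Vec.++ v₁) ++ post ≡ pre ++ Vec.toList v₀ ++ (Vec.toList v₁ ++ post)
    ps≡₀ = ≡.cong (pre ++_)
        (≡.trans (≡.cong (_++ post) (Vec.toList-++ v₀ v₁)) (List.++-assoc (Vec.toList v₀) _ _))
    ps≡₁ : pre ++ Vec.toList (v₀ Vec.++ v₁) ++ post ≡ (pre ++ Vec.toList v₀) ++ Vec.toList v₁ ++ post
    ps≡₁ = ≡.trans ps≡₀ (≡.sym (List.++-assoc pre _ _))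
    lo≡₁ : lo ℕ.+ a ≡ length (pre ++ Vec.toList v₀)
    lo≡₁ = ≡.sym (≡.trans (List.length-++ pre) (≡.cong (lo ℕ.+_) (Vec.length-toList v₀)))
    claim₀ : total (List.take a (List.drop lo ps)) ≡ w₀
    claim₀ = ≡.cong total (≡.trans (≡.cong (λ ps → List.take a (List.drop lo ps)) ps≡₀) (segment pre v₀ _))
    claim₁ : total (List.take b (List.drop (lo ℕ.+ a) ps)) ≡ w₁
    claim₁ = ≡.cong total (≡.trans (≡.cong₂ (λ n ps → List.take b (List.drop n ps)) lo≡₁ ps≡₁)
        (segment (pre ++ Vec.toList v₀) v₁ post))
    ok : checks a b w₀ w₁ w ≡ true
    ok = checks-complete a b w₀ w₁ w (total-grid v₀) (total-grid v₁)
      (≈-trans (≈-sym (total-++ (Vec.toList v₀) _))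
          (≈-trans (≈-reflexive (≡.cong total (≡.sym (Vec.toList-++ v₀ v₁)))) (≈-sym w≈)))
    found : ∃ λ A → A ≈ val (Vec.lookup (v₀ Vec.++ v₁) j) × acc (descendChild l r lo w₀ w₁ k (splitAt a j)) ps ≈
        acc (k A) ps
    found with splitAt a j | Vec.lookup-splitAt a v₀ v₁ j
    ... | inj₁ i | eq =
      let A , A≈ , acc≈ = honest-descend l pre v₀ (Vec.toList v₁ ++ post) ≡.refl ps≡₀ ≈-refl i k
      in A , ≈-trans A≈ (≈-reflexive (≡.cong val (≡.sym eq))) , ≈-trans (acc-reveal true (descend l lo i w₀ k) ps) acc≈
    ... | inj₂ i | eq =
      let A , A≈ , acc≈ = honest-descend r (pre ++ Vec.toList v₀) v₁ post lo≡₁ ps≡₁ ≈-refl i k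
      in A , ≈-trans A≈ (≈-reflexive (≡.cong val (≡.sym eq))) , ≈-trans (acc-reveal false (descend r (lo ℕ.+ a) i w₁ k) ps) acc≈

-- Upper-tail bound for the honest count, and completeness

module Completeness {{ℜ : RealField}} (N K : ℕ) .{{_ : NonZero K}} {{p : Parameters}}
                    (tree : BalancedTree (Parameters.m p)) (I : Model.Instance {{ℜ}} N K) where

  open OrderLemmas ℜ
  open Exponential ℜ
  open HoeffdingLemma ℜ
  open RandomExperiments ℜ
  open SamplingTail ℜ
  open Model {{ℜ}} N K
  open Parameters p
  open ParameterBounds
  open Protocol tree
  open Instance I
  open Grid N K
  open Mismatch N K I
  open HonestRun N K I
  open Acceptance N K I honestProver
  open Soundness N K tree using (0<m; rootCheck; afterRoot; afterSample; half-g; sumVec-complement)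

  private instance
    m-nonZero : NonZero m
    m-nonZero = size-nonZero tree

  total-honestState : ∀ {n} (xs : Vec (Fin N) n) → total (honestState (Vec.toList xs)) ≈ sumVec F-P xs
  total-honestState []       = ≈-refl
  total-honestState (x ∷ xs) = +-congˡ (total-honestState xs)

  module _ (xs : Vec (Fin N) m) (λ₀ : Carrier) (0≤λ : 0# ≤ λ₀) (π : Carrier) (0≤π : 0# ≤ π)
           (close : sumVec gap xs ≤ fromℕ m * π) where

    private
      c thr W : Carrier
      c = exp λ₀ - 1#
      thr = g * fromℕ q / fromℕ 2
      W = total (honestState (Vec.toList xs))

      ps : List (Fin (suc K))
      ps = honestState (Vec.toList xs)

      answered : Vec (Fin (suc K)) m
      answered = Vec.map f-P xs

      ps≡ : ps ≡ Vec.toList answered ++ []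
      ps≡ = ≡.trans (≡.sym (Vec.toList-map f-P xs)) (≡.sym (List.++-identityʳ _))

      W≈ : W ≈ total (Vec.toList answered)
      W≈ = ≈-reflexive (≡.cong total (≡.sym (Vec.toList-map f-P xs)))

      0≤c : 0# ≤ c
      0≤c = 0≤-diff (1≤exp 0≤λ)

      weightZ : ℕ → Carrier
      weightZ Z = exp (λ₀ * (fromℕ Z - thr))

      weightZ-suc : ∀ Z → weightZ (suc Z) ≈ exp λ₀ * weightZ Z
      weightZ-suc Z = ≈-trans
          (exp-cong (solve 3 (λ l t z → l :* ((# 1 :+ z) :- t) := l :+ l :* (z :- t)) ≈-refl λ₀ thr (fromℕ Z)))
          (exp-+ _ _)

      0≤rate : 0# ≤ 1# + c * π
      0≤rate = 0≤-+ 0≤1 (0≤-* 0≤c 0≤π)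

    -- The additive form bounds the rejection probability without subtraction and is preserved by
    -- averaging over J and U. The weight is at least 1 on rejected counts, and a descent multiplies
    -- it on average by at most 1 + c π. The state can stay fixed at `ps`, since the honest prover
    -- leaves it unchanged after the sample.
    descents-complete : ∀ t Z → 1# ≤ acc (descents xs W t Z) ps + weightZ Z * (1# + c * π) ^ t

    private
      next : ℕ → ℕ → Fin m → Carrier → Verifier
      next t Z J A = query (Vec.lookup xs J) λ v → coin K λ U → descents xs W t
          (if compare A (val v) U then suc Z else Z)

      tested : ∀ t Z J A → A ≈ val (Vec.lookup answered J) →
        let R = weightZ Z * (1# + c * π) ^ t in
        1# ≤ acc (next t Z J A) ps + (R + c * R * gap (Vec.lookup xs J))
      tested t Z J A A≈ = begin
        1#
          ≈⟨ average-const K 1# ⟨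
        average K (λ _ → 1#)
          ≤⟨ average-mono K (λ U → outcome (cmp U)) ⟩
        average K (λ U → acc (branch (cmp U)) ps + (R + c * R * indicator (cmp U)))
          ≈⟨ ≈-trans (average-+ K _ _)
              (+-congˡ (≈-trans (average-+ K (λ _ → R) _)
              (+-cong (average-const K R) (average-*ˡ K (c * R) _)))) ⟩
        average K (λ U → acc (branch (cmp U)) ps) + (R + c * R * average K (indicator ∘ cmp))
          ≤⟨ +-mono-≤ (≤-reflexive (≈-sym (acc-query x (λ v → coin K λ U → branch (compare A (val v) U)) ps)))
               (+-monoʳ-≤ _ _ _ (*-monoˡ-≤ (0≤-* 0≤c 0≤R) (average-compare-≤-abs (f-P x) (f-V x) A≈′ ≈-refl))) ⟩
        acc (next t Z J A) ps + (R + c * R * gap x) ∎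
        where
        open ≤-Reasoning
        x = Vec.lookup xs J
        R = weightZ Z * (1# + c * π) ^ t
        0≤R : 0# ≤ R
        0≤R = 0≤-* (0≤exp _) (0≤-^ 0≤rate t)
        A≈′ : A ≈ val (f-P x)
        A≈′ = ≈-trans A≈ (≈-reflexive (≡.cong val (Vec.lookup-map J f-P xs)))
        cmp : Fin K → Bool
        cmp = compare A (F-V x)
        branch : Bool → Verifier
        branch b = descents xs W t (if b then suc Z else Z)
        outcome : ∀ b → 1# ≤ acc (branch b) ps + (R + c * R * indicator b)
        outcome true  = ≤-respʳ (+-congˡ (≈-trans (*-congʳ (weightZ-suc Z))
          (solve 3 (λ e w r → e :* w :* r := w :* r :+ (e :- # 1) :* (w :* r) :* # 1) ≈-refl (exp λ₀)
              (weightZ Z) ((1# + c * π) ^ t))))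
          (descents-complete t (suc Z))
        outcome false = ≤-respʳ (+-congˡ (solve 2 (λ r c → r := r :+ c :* r :* # 0) ≈-refl R c))
            (descents-complete t Z)

    descents-complete zero Z with fromℕ Z ≤? thr
    ... | yes _     = x≤x+y (0≤-* (0≤exp _) 0≤1)
    ... | no  Z≰thr = ≤-respʳ (≈-trans (≈-sym (*-identityʳ _)) (≈-sym (+-identityˡ _)))
        (1≤exp (0≤-* 0≤λ (0≤-diff (<⇒≤ (≰⇒> Z≰thr)))))
    descents-complete (suc t) Z = begin
      1#
        ≈⟨ average-const m 1# ⟨
      average m (λ _ → 1#)
        ≤⟨ average-mono m pointwise ⟩
      average m (λ J → acc (run J) ps + (R + c * R * gap (Vec.lookup xs J)))
        ≈⟨ ≈-trans (average-+ m _ _)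
            (+-congˡ (≈-trans (average-+ m (λ _ → R) _) (+-cong (average-const m R) (average-*ˡ m (c * R) _))))
            ⟩
      average m (λ J → acc (run J) ps) + (R + c * R * (sumVec gap xs / fromℕ m))
        ≤⟨ +-monoʳ-≤ _ _ _ (+-monoʳ-≤ _ _ _ (*-monoˡ-≤ (0≤-* 0≤c 0≤R) (/-≤ 0<m (≤-respʳ (*-comm _ _) close)))) ⟩
      average m (λ J → acc (run J) ps) + (R + c * R * π)
        ≈⟨ +-congˡ (solve 4 (λ w r c p → w :* r :+ c :* (w :* r) :* p := w :* ((# 1 :+ c :* p) :* r))
             ≈-refl (weightZ Z) ((1# + c * π) ^ t) c π) ⟩
      average m (λ J → acc (run J) ps) + weightZ Z * (1# + c * π) ^ suc t ∎
      where
      open ≤-Reasoning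
      R = weightZ Z * (1# + c * π) ^ t
      0≤R : 0# ≤ R
      0≤R = 0≤-* (0≤exp _) (0≤-^ 0≤rate t)
      run : Fin m → Verifier
      run J = descend tree 0 J W (next t Z J)
      pointwise : ∀ J → 1# ≤ acc (run J) ps + (R + c * R * gap (Vec.lookup xs J))
      pointwise J =
        let A , A≈ , acc≈ = honest-descend tree [] answered [] {0} {W} {ps} ≡.refl ps≡ W≈ J (next t Z J)
        in ≤-respʳ (+-congʳ (≈-sym acc≈)) (tested t Z J A A≈)

    descents-complete-q : 1# ≤ acc (descents xs W q 0) ps + exp (- (fromℕ q * (λ₀ * (g / fromℕ 2) - c * π)))
    descents-complete-q = ≤-trans (descents-complete q 0) (+-monoʳ-≤ _ _ _ (begin
      weightZ 0 * (1# + c * π) ^ q                   ≤⟨ *-monoˡ-≤ (0≤exp _) (^-mono-≤ 0≤rate (1+x≤exp _) q) ⟩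
      weightZ 0 * exp (c * π) ^ q                    ≈⟨ *-congˡ (exp-· q _) ⟨
      weightZ 0 * exp (fromℕ q * (c * π))            ≈⟨ exp-+ _ _ ⟨
      exp (λ₀ * (0# - thr) + fromℕ q * (c * π))
        ≈⟨ exp-cong (solve 5 (λ l g q i u → l :* (# 0 :- g :* q :* i) :+ q :* u := :-
            (q :* (l :* (g :* i) :- u)))
             ≈-refl λ₀ g (fromℕ q) (fromℕ 2 ⁻¹) (c * π)) ⟩
      exp (- (fromℕ q * (λ₀ * (g / fromℕ 2) - c * π))) ∎))
      where open ≤-Reasoning

  module _ (bm : BoundedMismatch ρ γ I) (admissible : Admissible) (σ : Carrier) (Δ≤ : Δ-mis I σ ≤ ε-c) where

    open Admissible admissible using (γ≤1)

    private
      0≤T : 0# ≤ T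
      0≤T = <⇒≤ (0<T admissible)

      G : Carrier
      G = expectation D gap

      0≤-complement : ∀ x → 0# ≤ complement F-P x
      0≤-complement x = 0≤-diff (F-P≤1 x)

      complement-≤1 : ∀ x → complement F-P x ≤ 1#
      complement-≤1 x = ≤-by-diff (0≤F-P x) (solve 1 (λ f → # 1 :- f :+ f := # 1) ≈-refl _)

      -- Three ways for a sample to be atypical: a high or a low mean of f-P would endanger the root
      -- check, a high mean mismatch the final count.
      exc₁ exc₂ exc₃ : Vec (Fin N) m → Carrier
      exc₁ = excess D {F-P} 0≤F-P F-P≤1 T 0≤T
      exc₂ = excess D {complement F-P} 0≤-complement complement-≤1 T 0≤T
      exc₃ = excess D {gap} 0≤gap gap≤1 T 0≤T

      tail-≤ : ∀ f (0≤f : ∀ x → 0# ≤ f x) (f≤1 : ∀ x → f x ≤ 1#) → ExVec D m (excess D {f} 0≤f f≤1 T 0≤T) ≤ exp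
          (- L)
      tail-≤ f 0≤f f≤1 = ≤-trans (excess-tail D {f} 0≤f f≤1 T 0≤T m)
        (exp-mono-≤ (neg-anti-≤ (sampling-rate admissible)))

    typical-acc : ∀ xs → sumVec F-P xs ≤ fromℕ m * (μ-P + fromℕ 2 * T) →
      sumVec (complement F-P) xs ≤ fromℕ m * (expectation D (complement F-P) + fromℕ 2 * T) →
      sumVec gap xs ≤ fromℕ m * (G + fromℕ 2 * T) →
      1# ≤ acc (afterSample σ xs) [] + exp (- L)
    typical-acc xs upper lower mismatch = begin
      1#
        ≤⟨ descents-complete-q xs l (0≤λ↑ admissible) (κ + fromℕ 2 * T)
             (0≤-+ (0≤κ admissible) (0≤-* (0≤fromℕ 2) 0≤T))
                 (≤-trans mismatch (*-monoˡ-≤ (0≤fromℕ m) (+-monoˡ-≤ _ (mean-gap-≤ γ≤1 bm)))) ⟩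
      acc (descents xs W q 0) ps + exp (- (fromℕ q * (l * (g / fromℕ 2) - (exp l - 1#) * (κ + fromℕ 2 * T))))
        ≤⟨ +-monoʳ-≤ _ _ _ (exp-mono-≤ (neg-anti-≤ (≤-respʳ (*-congˡ (+-congʳ (*-congˡ (≈-sym half-g))))
             (upper-rate admissible)))) ⟩
      acc (descents xs W q 0) ps + exp (- L)
        ≈⟨ +-congʳ (≈-reflexive (≡.cong (λ o → acc (if o then descents xs W q 0 else halt false) ps) accepted))
            ⟨
      acc (afterRoot σ xs W) ps + exp (- L)
        ≈⟨ +-congʳ (≈-trans (acc-sample (Vec.toList xs) (recv (root m) (afterRoot σ xs)) [])
            (acc-root m (afterRoot σ xs) ps)) ⟨
      acc (afterSample σ xs) [] + exp (- L) ∎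
      where
      open ≤-Reasoning
      l W : Carrier
      l = λ↑ admissible
      ps : List (Fin (suc K))
      ps = honestState (Vec.toList xs)
      W = total ps
      W∈ : InGrid m W
      W∈ = ≡.subst (λ ps → InGrid m (total ps)) (Vec.toList-map f-P xs) (total-grid (Vec.map f-P xs))
      W≈ : W ≈ sumVec F-P xs
      W≈ = total-honestState xs
      W/m≤ : W / fromℕ m ≤ μ-P + fromℕ 2 * T
      W/m≤ = /-≤ 0<m (≤-respˡ (≈-sym W≈) (≤-respʳ (*-comm _ _) upper))
      ≤W/m : μ-P - fromℕ 2 * T ≤ W / fromℕ m
      ≤W/m = ≤-/ 0<m (≤-respʳ (≈-sym W≈) (≤-by-diff
        (0≤-diff (≤-respˡ (sumVec-complement F-P xs) (≤-respʳ (*-congˡ (+-congʳ (mean-complement F-P))) lower)))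
        (solve 4 (λ p t m s → (p :- # 2 :* t) :* m :+ (m :* (# 1 :- p :+ # 2 :* t) :- (m :- s)) := s)
          ≈-refl μ-P T (fromℕ m) (sumVec F-P xs))))
      near : abs (W / fromℕ m - σ) ≤ ε-c + a
      near = ≤-respʳ (+-congˡ (≈-sym a≈)) (abs-≤
        (≤-by-diff (0≤-+ (0≤-diff W/m≤) (0≤-diff (≤-trans (≤-abs (μ-P - σ)) Δ≤)))
          (solve 5 (λ w s p t c → w :- s :+ (p :+ # 2 :* t :- w :+ (c :- (p :- s))) := c :+ # 2 :* t)
            ≈-refl (W / fromℕ m) σ μ-P T ε-c))
        (≤-by-diff (0≤-+ (0≤-diff ≤W/m) (0≤-diff (≤-trans (neg-≤-abs (μ-P - σ)) Δ≤)))
          (solve 5 (λ w s p t c → :- (w :- s) :+ (w :- (p :- # 2 :* t) :+ (c :- :- (p :- s))) := c :+ # 2 :* t)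
            ≈-refl (W / fromℕ m) σ μ-P T ε-c)))
      accepted : rootCheck σ W ≡ true
      accepted = ≡.cong₂ _∧_ (dec-true (inGrid? m W) W∈) (dec-true (abs (W / fromℕ m - σ) ≤? ε-c + a) near)

    completeness : 1# - δ ≤ acceptPr I (verifier σ) honestProver
    completeness = ≤-by-diff
      (0≤-+ (0≤-diff total-bound) (0≤-diff (12exp[-L]≤δ admissible)))
      (solve 3 (λ A e d → # 1 :- d :+ (A :+ # 12 :* e :- # 1 :+ (d :- # 12 :* e)) := A) ≈-refl Acc (exp (- L))
          δ)
      where
      open ≤-Reasoning
      Acc : Carrier
      Acc = acceptPr I (verifier σ) honestProver
      pointwise : ∀ xs → 1# ≤ acc (afterSample σ xs) [] + (exc₁ xs + (exc₂ xs + (exc₃ xs + exp (- L))))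
      pointwise xs = decide (fromℕ m * (μ-P + fromℕ 2 * T) ≤? sumVec F-P xs)
          (fromℕ m * (expectation D (complement F-P) + fromℕ 2 * T) ≤? sumVec (complement F-P) xs)
          (fromℕ m * (G + fromℕ 2 * T) ≤? sumVec gap xs)
        where
        A e₁ e₂ e₃ e : Carrier
        A = acc (afterSample σ xs) []
        e₁ = exc₁ xs
        e₂ = exc₂ xs
        e₃ = exc₃ xs
        e = exp (- L)
        0≤A : 0# ≤ A
        0≤A = 0≤acc (afterSample σ xs) []
        0≤e₁ : 0# ≤ e₁
        0≤e₁ = 0≤exp _
        0≤e₂ : 0# ≤ e₂
        0≤e₂ = 0≤exp _
        0≤e₃ : 0# ≤ e₃
        0≤e₃ = 0≤exp _
        0≤e : 0# ≤ e
        0≤e = 0≤exp _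
        decide : Dec (fromℕ m * (μ-P + fromℕ 2 * T) ≤ sumVec F-P xs) →
          Dec (fromℕ m * (expectation D (complement F-P) + fromℕ 2 * T) ≤ sumVec (complement F-P) xs) →
          Dec (fromℕ m * (G + fromℕ 2 * T) ≤ sumVec gap xs) → 1# ≤ A + (e₁ + (e₂ + (e₃ + e)))
        decide (yes h) _ _ = ≤-trans (1≤excess D 0≤F-P F-P≤1 T 0≤T xs h)
          (≤-trans (x≤x+y (0≤-+ 0≤e₂ (0≤-+ 0≤e₃ 0≤e))) (x≤y+x 0≤A))
        decide _ (yes h) _ = ≤-trans (1≤excess D 0≤-complement complement-≤1 T 0≤T xs h)
          (≤-trans (x≤x+y (0≤-+ 0≤e₃ 0≤e)) (≤-trans (x≤y+x 0≤e₁) (x≤y+x 0≤A)))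
        decide _ _ (yes h) = ≤-trans (1≤excess D 0≤gap gap≤1 T 0≤T xs h)
          (≤-trans (x≤x+y 0≤e) (≤-trans (x≤y+x 0≤e₂) (≤-trans (x≤y+x 0≤e₁) (x≤y+x 0≤A))))
        decide (no h₁) (no h₂) (no h₃) = ≤-trans (typical-acc xs (<⇒≤ (≰⇒> h₁)) (<⇒≤ (≰⇒> h₂)) (<⇒≤ (≰⇒> h₃)))
          (+-monoʳ-≤ A _ _ (≤-trans (x≤y+x 0≤e₃) (≤-trans (x≤y+x 0≤e₂) (x≤y+x 0≤e₁))))
      total-bound : 1# ≤ Acc + fromℕ 12 * exp (- L)
      total-bound = begin
        1#
          ≈⟨ ExVec-const D m 1# ⟨
        ExVec D m (λ _ → 1#)
          ≤⟨ ExVec-mono D m pointwise ⟩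
        ExVec D m (λ xs → acc (afterSample σ xs) [] + (exc₁ xs + (exc₂ xs + (exc₃ xs + exp (- L)))))
          ≈⟨ ≈-trans (ExVec-+ D m _ _)
              (+-congˡ (≈-trans (ExVec-+ D m exc₁ _) (+-congˡ (≈-trans (ExVec-+ D m exc₂ _)
               (+-congˡ (≈-trans (ExVec-+ D m exc₃ _) (+-congˡ (ExVec-const D m (exp (- L)))))))))) ⟩
        ExVec D m (λ xs → acc (afterSample σ xs) []) +
            (ExVec D m exc₁ + (ExVec D m exc₂ + (ExVec D m exc₃ + exp (- L))))
          ≤⟨ +-mono-≤ (≤-reflexive (≈-sym (acc-drawMany m (afterSample σ) [])))
               (+-mono-≤ (tail-≤ F-P 0≤F-P F-P≤1)
                   (+-mono-≤ (tail-≤ (complement F-P) 0≤-complement complement-≤1)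
                   (+-monoˡ-≤ _ (tail-≤ gap 0≤gap gap≤1)))) ⟩
        Acc + (exp (- L) + (exp (- L) + (exp (- L) + exp (- L))))
          ≤⟨ ≤-by-diff (0≤-* (0≤fromℕ 8) (0≤exp _))
              (solve 2 (λ A e → A :+ (e :+ (e :+ (e :+ e))) :+ # 8 :* e := A :+ # 12 :* e) ≈-refl Acc
              (exp (- L))) ⟩
        Acc + fromℕ 12 * exp (- L) ∎

-- Depth of balanced trees and binary logarithms

module TreeDepth where

  open import Data.Nat.Base
    using (>-nonZero⁻¹; _*_; _+_; _<_; _∸_; _≤_; _⊔_; s≤s; z≤n; ∣_-_∣; ⌈_/2⌉; ⌊_/2⌋)
  open import Data.Nat.Properties
    using (+-assoc; +-comm; +-identityʳ; +-mono-≤; +-monoʳ-≤; m+[n∸m]≡n; module ≤-Reasoning; m≤n+m∸n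
          ; m≤n+∣m-n∣; n≡⌊n+n/2⌋; n≤1+n; ∣-∣-comm; ≤-refl; ≤-reflexive; ≤-trans; ⊔-lub; ⌊n/2⌋-mono
          ; ⌊n/2⌋<n)

  depth : ∀ {s} → BalancedTree s → ℕ
  depth leaf         = 0
  depth (node _ l r) = suc (depth l ⊔ depth r)

  private
    -- Balance gives 2 a ≤ a + b + 1, which is then halved.
    half-bound : ∀ a b → ∣ a - b ∣ ≤ 1 → a ≤ ⌈ a + b /2⌉
    half-bound a b h = begin
      a                          ≡⟨ n≡⌊n+n/2⌋ a ⟩
      ⌊ a + a /2⌋            ≤⟨ ⌊n/2⌋-mono (+-monoʳ-≤ a (≤-trans (m≤n+∣m-n∣ a b) (+-monoʳ-≤ b h))) ⟩
      ⌊ a + (b + 1) /2⌋    ≡⟨ ≡.cong ⌊_/2⌋ (≡.trans (≡.sym (+-assoc a b 1)) (+-comm (a + b) 1)) ⟩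
      ⌈ a + b /2⌉            ∎
      where open ≤-Reasoning

  1≤⌈log₂⌉ : ∀ {n} → 2 ≤ n → 1 ≤ ⌈log₂ n ⌉
  1≤⌈log₂⌉ = ⌈log₂⌉-mono-≤ {2}

  1≤⌊log₂⌋ : ∀ {n} → 2 ≤ n → 1 ≤ ⌊log₂ n ⌋
  1≤⌊log₂⌋ = ⌊log₂⌋-mono-≤ {2}

  private
    1≤size : ∀ {s} → BalancedTree s → 1 ≤ s
    1≤size t = >-nonZero⁻¹ _ {{size-nonZero t}}

  -- The larger child has at most ⌈s / 2⌉ points, and this halving lowers ⌈log₂⌉ by exactly one. The
  -- floor would be false: a tree over 3 points has depth 2.
  depth≤⌈log₂⌉ : ∀ {s} (t : BalancedTree s) → depth t ≤ ⌈log₂ s ⌉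
  depth≤⌈log₂⌉ leaf = z≤n
  depth≤⌈log₂⌉ (node {a} {b} p l r) = begin
    suc (depth l ⊔ depth r)           ≤⟨ s≤s (⊔-lub
      (≤-trans (depth≤⌈log₂⌉ l) (⌈log₂⌉-mono-≤ (half-bound a b p)))
      (≤-trans (depth≤⌈log₂⌉ r) (⌈log₂⌉-mono-≤ b≤))) ⟩
    suc ⌈log₂ ⌈ a + b /2⌉ ⌉         ≡⟨ ≡.cong suc (⌈log₂⌈n/2⌉⌉≡⌈log₂n⌉∸1 (a + b)) ⟩
    suc (⌈log₂ (a + b) ⌉ ∸ 1)       ≡⟨ m+[n∸m]≡n (1≤⌈log₂⌉ (+-mono-≤ (1≤size l) (1≤size r))) ⟩
    ⌈log₂ (a + b) ⌉                   ∎
    where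
    open ≤-Reasoning
    b≤ : b ≤ ⌈ a + b /2⌉
    b≤ = ≡.subst (λ n → b ≤ ⌈ n /2⌉) (+-comm b a) (half-bound b a (≡.subst (_≤ 1) (∣-∣-comm a b) p))

  -- Comparing n + 1 with n makes the induction by halving close: ⌈(n + 1) / 2⌉ = ⌊n / 2⌋ + 1, so
  -- the pair keeps its form while both logarithms drop by one.
  ⌈log₂1+n⌉≤1+⌊log₂n⌋ : ∀ n → 1 ≤ n → ⌈log₂ suc n ⌉ ≤ suc ⌊log₂ n ⌋
  ⌈log₂1+n⌉≤1+⌊log₂n⌋ = <-rec _ step
    where
    step : ∀ n → (∀ {k} → k < n → 1 ≤ k → ⌈log₂ suc k ⌉ ≤ suc ⌊log₂ k ⌋) →
           1 ≤ n → ⌈log₂ suc n ⌉ ≤ suc ⌊log₂ n ⌋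
    step (suc zero)      rec _ = ≤-refl
    step n@(suc (suc k)) rec _ = begin
      ⌈log₂ suc n ⌉                           ≤⟨ m≤n+m∸n _ 1 ⟩
      suc (⌈log₂ suc n ⌉ ∸ 1)               ≡⟨ ≡.cong suc (⌈log₂⌈n/2⌉⌉≡⌈log₂n⌉∸1 (suc n)) ⟨
      suc ⌈log₂ suc ⌊ n /2⌋ ⌉               ≤⟨ s≤s (rec (⌊n/2⌋<n (suc k)) (s≤s z≤n)) ⟩
      suc (suc ⌊log₂ ⌊ n /2⌋ ⌋)             ≡⟨ ≡.cong (suc ∘ suc) (⌊log₂⌊n/2⌋⌋≡⌊log₂n⌋∸1 n) ⟩
      suc (suc (⌊log₂ n ⌋ ∸ 1))             ≡⟨ ≡.cong suc (m+[n∸m]≡n (1≤⌊log₂⌋ {n} (s≤s (s≤s z≤n)))) ⟩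
      suc ⌊log₂ n ⌋                           ∎
      where open ≤-Reasoning

  ⌈log₂⌉≤1+⌊log₂⌋ : ∀ {n} → 1 ≤ n → ⌈log₂ n ⌉ ≤ suc ⌊log₂ n ⌋
  ⌈log₂⌉≤1+⌊log₂⌋ {n} 1≤n = ≤-trans (⌈log₂⌉-mono-≤ (n≤1+n n)) (⌈log₂1+n⌉≤1+⌊log₂n⌋ n 1≤n)

  depth≤2⌊log₂⌋ : ∀ {s} (t : BalancedTree s) → 2 ≤ s → depth t ≤ 2 * ⌊log₂ s ⌋
  depth≤2⌊log₂⌋ {s} t 2≤s = begin
    depth t                      ≤⟨ depth≤⌈log₂⌉ t ⟩
    ⌈log₂ s ⌉                    ≤⟨ ⌈log₂⌉≤1+⌊log₂⌋ (≤-trans (n≤1+n 1) 2≤s) ⟩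
    1 + ⌊log₂ s ⌋              ≤⟨ +-mono-≤ (1≤⌊log₂⌋ 2≤s) (≤-reflexive (≡.sym (+-identityʳ _))) ⟩
    2 * ⌊log₂ s ⌋              ∎
    where open ≤-Reasoning

-- Additive transcript costs that hold for every prover

module EventMeasure {{ℜ : RealField}} (N K : ℕ) .{{_ : NonZero K}} where

  open import Data.Nat.Base using (_+_)
  open import Data.Nat.Properties using (+-assoc; +-identityʳ)

  open RealField ℜ using (Rand; pure; choose; uniform; _>>=_; Always)
  open Model {{ℜ}} N K

  Always-bind : ∀ {A B : Set} {R : B → Set} (f : A → Rand B) r → Always (λ a → Always R (f a)) r → Always R
      (r >>= f)
  Always-bind f (pure a)      h = h
  Always-bind f (choose d k)  h = λ i → Always-bind f (k i) (h i)
  Always-bind f (uniform n k) h = λ i → Always-bind f (k i) (h i)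

  Always-map : ∀ {A : Set} {Q R : A → Set} → (∀ a → Q a → R a) → ∀ r → Always Q r → Always R r
  Always-map f (pure a)      h = f a h
  Always-map f (choose d k)  h = λ i → Always-map f (k i) (h i)
  Always-map f (uniform n k) h = λ i → Always-map f (k i) (h i)

  Always-× : ∀ {A : Set} {Q R : A → Set} r → Always Q r → Always R r → Always (λ a → Q a × R a) r
  Always-× (pure a)      h h′ = h , h′
  Always-× (choose d k)  h h′ = λ i → Always-× (k i) (h i) (h′ i)
  Always-× (uniform n k) h h′ = λ i → Always-× (k i) (h i) (h′ i)

  -- Since the prover's draws and queries count nothing, the cost can be followed along the verifier
  -- alone, over all possible replies; the resulting bound holds for every prover and every instance
  -- at once.
  record Measure : Set where
    field
      μ         : List Event → ℕ
      μ-[]      : μ [] ≡ 0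
      μ-++      : ∀ es es′ → μ (es ++ es′) ≡ μ es + μ es′
      P-draws≡0   : ∀ x → μ (P-draws x ∷ []) ≡ 0
      P-queries≡0 : ∀ x → μ (P-queries x ∷ []) ≡ 0

  module _ (M : Measure) where

    open Measure M

    -- c is the value that the measure has accumulated so far.
    Guarantees : (Bool → ℕ → Set) → ℕ → Verifier → Set
    Guarantees Q c (halt b)    = Q b c
    Guarantees Q c (draw k)    = ∀ x → Guarantees Q (c + μ (V-draws x ∷ [])) (k x)
    Guarantees Q c (coin n k)  = ∀ i → Guarantees Q c (k i)
    Guarantees Q c (query x k) = ∀ v → Guarantees Q (c + μ (V-queries x ∷ [])) (k v)
    Guarantees Q c (send ms v) = Guarantees Q (c + μ (V-sends ms ∷ [])) v
    Guarantees Q c (recv p k)  = ∀ r → Guarantees Q (c + μ (P-sends p r ∷ [])) (k r)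

    module _ (I : Instance) (P : Prover) where

      open Instance I
      open Prover P
      open Execution I P

      private
        Final : (Bool → ℕ → Set) → ℕ → Bool × List Event → Set
        Final Q c (b , es) = Q b (c + μ es)

        Silent : List Event → Set
        Silent es = μ es ≡ 0

        Always-log : ∀ Q c es r → Always (Final Q (c + μ es)) r → Always (Final Q c) (log es r)
        Always-log Q c es r h = Always-bind _ r (Always-map
          (λ (b , es′) → ≡.subst (Q b) (≡.trans (+-assoc c _ _) (≡.cong (c +_) (≡.sym (μ-++ es es′))))) r h)

        runComp-silent : ∀ {A : Set} (c : ProverComp A) → Always (λ (_ , es) → Silent es) (runComp c)
        runComp-silent (return a)  = μ-[]
        runComp-silent (draw k)    = λ x → Always-bind _ (runComp (k x)) (Always-map
          (λ (_ , es) h → ≡.trans (μ-++ (P-draws x ∷ []) es) (≡.cong₂ _+_ (P-draws≡0 x) h)) (runComp (k x))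
              (runComp-silent (k x)))
        runComp-silent (query x k) = Always-bind _ (runComp (k (f-P x))) (Always-map
          (λ (_ , es) h → ≡.trans (μ-++ (P-queries x ∷ []) es) (≡.cong₂ _+_ (P-queries≡0 x) h))
              (runComp (k (f-P x))) (runComp-silent (k (f-P x))))
        runComp-silent (toss d k)  = λ i → runComp-silent (k i)

      guaranteed : ∀ Q c v → Guarantees Q c v → ∀ st → Always (Final Q c) (run v st)
      guaranteed Q c (halt b)    h st = ≡.subst (Q b) (≡.sym (≡.trans (≡.cong (c +_) μ-[]) (+-identityʳ c))) h
      guaranteed Q c (draw k)    h st = λ x → Always-log Q c _ (run (k x) st) (guaranteed Q _ (k x) (h x) st)
      guaranteed Q c (coin n k)  h st = λ i → guaranteed Q c (k i) (h i) st
      guaranteed Q c (query x k) h st = Always-log Q c _ (run (k (f-V x)) st)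
          (guaranteed Q _ (k (f-V x)) (h (f-V x)) st)
      guaranteed Q c (send ms v) h st = Always-bind _ (runComp (observe ms st)) (Always-map
        (λ (st′ , es) silent → Always-log Q c (V-sends ms ∷ es) (run v st′) (guaranteed Q _ v
          (≡.subst (λ n → Guarantees Q (c + n) v)
            (≡.sym (≡.trans (μ-++ (V-sends ms ∷ []) es)
                (≡.trans (≡.cong (μ (V-sends ms ∷ []) +_) silent) (+-identityʳ _)))) h) st′))
        (runComp (observe ms st)) (runComp-silent (observe ms st)))
      guaranteed Q c (recv p k)  h st = Always-bind _ (runComp (answer p st)) (Always-map
        (λ ((st′ , r) , es) silent → Always-log Q c (es ++ P-sends p r ∷ []) (run (k r) st′)
            (guaranteed Q _ (k r)
          (≡.subst (λ n → Guarantees Q (c + n) (k r))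
            (≡.sym (≡.trans (μ-++ es (P-sends p r ∷ [])) (≡.cong (_+ μ (P-sends p r ∷ [])) silent))) (h r))
                st′))
        (runComp (answer p st)) (runComp-silent (answer p st)))

  drawnMeasure queriedMeasure roundsMeasure : Measure
  drawnMeasure   = record
    { μ = length ∘ V-drawn ; μ-[] = ≡.refl
    ; μ-++ = λ es es′ → ≡.trans (≡.cong length (List.mapMaybe-++ _ es es′)) (List.length-++ (V-drawn es))
    ; P-draws≡0 = λ _ → ≡.refl ; P-queries≡0 = λ _ → ≡.refl }
  queriedMeasure = record
    { μ = length ∘ V-queried ; μ-[] = ≡.refl
    ; μ-++ = λ es es′ → ≡.trans (≡.cong length (List.mapMaybe-++ _ es es′)) (List.length-++ (V-queried es))
    ; P-draws≡0 = λ _ → ≡.refl ; P-queries≡0 = λ _ → ≡.refl }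
  roundsMeasure  = record
    { μ = rounds ; μ-[] = ≡.refl
    ; μ-++ = λ es es′ → ≡.trans (≡.cong length (List.mapMaybe-++ (messageBits 0) es es′))
        (List.length-++ (mapMaybe (messageBits 0) es))
    ; P-draws≡0 = λ _ → ≡.refl ; P-queries≡0 = λ _ → ≡.refl }

  communicationMeasure : ℕ → Measure
  communicationMeasure ℓ = record
    { μ = communication ℓ ; μ-[] = ≡.refl
    ; μ-++ = λ es es′ → ≡.trans (≡.cong sumℕ (List.mapMaybe-++ (messageBits ℓ) es es′))
        (sumℕ-++ (mapMaybe (messageBits ℓ) es) _)
    ; P-draws≡0 = λ _ → ≡.refl ; P-queries≡0 = λ _ → ≡.refl }

-- Samples, queries, rounds and communication of the verifier

module ProtocolCost {{ℜ : RealField}} (N K : ℕ) .{{_ : NonZero K}} {{p : Parameters}}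
                    (tree : BalancedTree (Parameters.m p)) where

  open import Data.Nat.Base using (>-nonZero; >-nonZero⁻¹; _*_; _+_; _≤_; _⊔_; s≤s; z≤n)
  open import Data.Nat.Properties
    using (*-comm; *-distribˡ-+; *-identityʳ; *-identityˡ; *-mono-≤; *-monoʳ-≤; *-monoˡ-≤; *-zeroʳ
          ; +-assoc; +-comm; +-identityʳ; +-mono-≤; +-monoʳ-≤; +-monoˡ-≤; module ≤-Reasoning; m≤m+n
          ; m≤m⊔n; m≤n*m; m≤n+m; m≤n⊔m; n≤1+n; ≤-antisym; ≤-refl; ≤-reflexive; ≤-trans)

  open RealField ℜ using (Carrier)
  open Model {{ℜ}} N K
  open Parameters p using (m; q)
  open Protocol tree
  open EventMeasure N K
  open DescentShape N K
  open Soundness N K tree using (rootCheck; afterRoot; afterSample)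
  open TreeDepth
  open Data.Nat.Solver.+-*-Solver using (solve; _:=_; _:+_; _:*_; con)

  module _ (M : Measure) (level : ℕ)
           (level-≤ : ∀ lo a b r o → a + b ≤ m →
             Measure.μ M (P-sends (children lo a b) r ∷ []) + Measure.μ M (V-sends (reveal o) ∷ []) ≤ level) where

    open Measure M using (μ)

    private
      Between : ℕ → ℕ → ℕ → Set
      Between lo hi n = lo ≤ n × n ≤ hi

    descend-guarantees : ∀ Q {s} (t : BalancedTree s) lo j w k c → s ≤ m →
      (∀ A c′ → Between c (c + depth t * level) c′ → Guarantees M Q c′ (k A)) →
      (∀ c′ → Between c (c + depth t * level) c′ → Q false c′) →
      Guarantees M Q c (descend t lo j w k)
    descend-guarantees Q leaf lo j w k c s≤m cont fail = cont w c (≤-refl , m≤m+n c 0)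
    descend-guarantees Q (node {a} {b} p l r) lo j w k c s≤m cont fail (w₀ , w₁) =
      ≡.subst (Guarantees M Q (c + asked)) (≡.sym (descend-node l r lo w₀ w₁ k p w j))
          (checked (checks a b w₀ w₁ w) (splitAt a j))
      where
      open ≤-Reasoning
      asked : ℕ
      asked = μ (P-sends (children lo a b) (w₀ , w₁) ∷ [])
      rev : Bool → ℕ
      rev o = μ (V-sends (reveal o) ∷ [])
      round-≤ : ∀ o → asked + rev o ≤ level
      round-≤ o = level-≤ lo a b (w₀ , w₁) o s≤m
      asked≤level : asked ≤ level
      asked≤level = ≤-trans (m≤m+n asked (rev true)) (round-≤ true)
      widen : ∀ o d c′ → d ≤ depth l ⊔ depth r → Between (c + asked + rev o) (c + asked + rev o + d * level) c′
          →
              Between c (c + depth (node p l r) * level) c′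
      widen o d c′ d≤ (lo≤ , ≤hi) = ≤-trans (≤-trans (m≤m+n c asked) (m≤m+n _ (rev o))) lo≤ , (begin
        c′                                        ≤⟨ ≤hi ⟩
        c + asked + rev o + d * level         ≡⟨ ≡.cong (_+ d * level) (+-assoc c asked (rev o)) ⟩
        c + (asked + rev o) + d * level       ≤⟨ +-mono-≤ (+-monoʳ-≤ c (round-≤ o)) (*-monoˡ-≤ level d≤) ⟩
        c + level + (depth l ⊔ depth r) * level ≡⟨ +-assoc c level _ ⟩
        c + depth (node p l r) * level        ∎)
      checked : ∀ o i → Guarantees M Q (c + asked) (if o then descendChild l r lo w₀ w₁ k i else halt false)
      checked false _        = fail (c + asked)
          (m≤m+n c asked , +-monoʳ-≤ c (≤-trans asked≤level (m≤m+n level _)))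
      checked true  (inj₁ i) = descend-guarantees Q l lo i w₀ k _ (≤-trans (m≤m+n a b) s≤m)
        (λ A c′ h → cont A c′ (widen true (depth l) c′ (m≤m⊔n (depth l) (depth r)) h))
        (λ c′ h → fail c′ (widen true (depth l) c′ (m≤m⊔n (depth l) (depth r)) h))
      checked true  (inj₂ i) = descend-guarantees Q r (lo + a) i w₁ k _ (≤-trans (m≤n+m b a) s≤m)
        (λ A c′ h → cont A c′ (widen false (depth r) c′ (m≤n⊔m (depth l) (depth r)) h))
        (λ c′ h → fail c′ (widen false (depth r) c′ (m≤n⊔m (depth l) (depth r)) h))

    module _ (perDraw perQuery sampleCost rootCost : ℕ)
             (draw≡  : ∀ x → μ (V-draws x ∷ []) ≡ perDraw)
             (query≡ : ∀ x → μ (V-queries x ∷ []) ≡ perQuery)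
             (sample≡ : ∀ xs → length xs ≡ m → μ (V-sends (sample xs) ∷ []) ≡ sampleCost)
             (root≡  : ∀ W → μ (P-sends (root m) W ∷ []) ≡ rootCost) where

      perDescent drawn budget : ℕ
      perDescent = depth tree * level + perQuery
      drawn      = m * perDraw
      budget     = drawn + sampleCost + rootCost + q * perDescent

      -- Rejection may cut a run short after the sample is complete. The draws are therefore bounded
      -- below on every run, the queries only on accepting ones.
      Bounded : Bool → ℕ → Set
      Bounded b n = drawn ≤ n × n ≤ budget × (b ≡ true → q * perQuery ≤ n)

      private
        descents-guarantees : ∀ xs W t Z c →
          drawn ≤ c → c + t * perDescent ≤ budget → q * perQuery ≤ c + t * perQuery →
          Guarantees M Bounded c (descents xs W t Z)
        descents-guarantees xs W zero    Z c lo hi acc = lo , ≤-trans (m≤m+n c 0) hi , λ _ → ≤-trans acc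
            (≤-reflexive (+-identityʳ c))
        descents-guarantees xs W (suc t) Z c lo hi acc J = descend-guarantees Bounded tree 0 J W _ c ≤-refl
          (λ A c′ (c≤ , ≤c) v U → ≡.subst (λ n → Guarantees M Bounded (c′ + n) (descents xs W t (next A v U)))
              (≡.sym (query≡ _))
            (descents-guarantees xs W t (next A v U) (c′ + perQuery)
                (≤-trans lo (≤-trans c≤ (m≤m+n c′ perQuery)))
              (begin
                c′ + perQuery + t * perDescent
                  ≤⟨ +-monoˡ-≤ (t * perDescent) (+-monoˡ-≤ perQuery ≤c) ⟩
                c + depth tree * level + perQuery + t * perDescent
                  ≡⟨ ≡.trans (≡.cong (_+ t * perDescent) (+-assoc c _ perQuery)) (+-assoc c perDescent _) ⟩
                c + suc t * perDescent
                  ≤⟨ hi ⟩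
                budget ∎)
              (begin
                q * perQuery                                  ≤⟨ acc ⟩
                c + suc t * perQuery                        ≤⟨ +-monoˡ-≤ (suc t * perQuery) c≤ ⟩
                c′ + (perQuery + t * perQuery)            ≡⟨ +-assoc c′ perQuery _ ⟨
                c′ + perQuery + t * perQuery              ∎)))
          (λ c′ (c≤ , ≤c) → ≤-trans lo c≤ , ≤-trans ≤c
              (≤-trans (+-monoʳ-≤ c (≤-trans (m≤m+n _ perQuery) (m≤m+n perDescent _))) hi) , λ ())
          where
          open ≤-Reasoning
          next : Carrier → Fin (suc K) → Fin K → ℕ
          next A v U = if compare A (val v) U then suc Z else Z

        drawMany-guarantees : ∀ Q n k c → (∀ xs → Guarantees M Q (c + n * perDraw) (k xs)) → Guarantees M Q c
            (drawMany n k)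
        drawMany-guarantees Q zero    k c h = ≡.subst (λ n → Guarantees M Q n (k [])) (+-identityʳ c) (h [])
        drawMany-guarantees Q (suc n) k c h x = drawMany-guarantees Q n (λ xs → k (x ∷ xs)) _ λ xs →
          ≡.subst (λ n → Guarantees M Q n (k (x ∷ xs)))
              (≡.trans (≡.sym (+-assoc c perDraw _)) (≡.cong (λ d → c + d + n * perDraw) (≡.sym (draw≡ x))))
              (h (x ∷ xs))

      verifier-guarantees : ∀ σ → Guarantees M Bounded 0 (verifier σ)
      verifier-guarantees σ = drawMany-guarantees Bounded m (afterSample σ) 0 λ xs W →
        ≡.subst₂ (λ n n′ → Guarantees M Bounded (drawn + n + n′) (afterRoot σ xs W))
          (≡.sym (sample≡ (Vec.toList xs) (Vec.length-toList xs))) (≡.sym (root≡ W))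
              (checked xs W (rootCheck σ W))
        where
        drawn≤ : drawn ≤ drawn + sampleCost + rootCost
        drawn≤ = ≤-trans (m≤m+n drawn sampleCost) (m≤m+n _ rootCost)
        checked : ∀ xs W o → Guarantees M Bounded (drawn + sampleCost + rootCost)
            (if o then descents xs W q 0 else halt false)
        checked xs W true  = descents-guarantees xs W q 0 _ drawn≤ ≤-refl (m≤n+m _ _)
        checked xs W false = drawn≤ , m≤m+n _ _ , λ ()

      always-bounded : ∀ I P σ → RealField.Always ℜ (λ (b , es) → Bounded b (μ es)) (execute I (verifier σ) P)
      always-bounded I P σ = guaranteed M I P Bounded 0 (verifier σ) (verifier-guarantees σ) (Prover.start P)

  claimBits-mono : ∀ {s t} → s ≤ t → claimBits s ≤ claimBits t
  claimBits-mono s≤t = ⌈log₂⌉-mono-≤ (+-monoˡ-≤ 2 (*-monoʳ-≤ K s≤t))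

  always-drawn : ∀ I P σ → RealField.Always ℜ (λ (_ , es) → length (V-drawn es) ≡ m) (execute I (verifier σ) P)
  always-drawn I P σ = Always-map
      (λ _ (lo , hi , _) → ≤-antisym (≤-trans hi (≤-reflexive hi≡))
          (≤-trans (≤-reflexive (≡.sym (*-identityʳ m))) lo))
      (execute I (verifier σ) P)
      (always-bounded drawnMeasure 0 (λ _ _ _ _ _ _ → z≤n) 1 0 0 0 (λ _ → ≡.refl) (λ _ → ≡.refl)
          (λ _ _ → ≡.refl) (λ _ → ≡.refl) I P σ)
    where
    hi≡ : m * 1 + 0 + 0 + q * (depth tree * 0 + 0) ≡ m
    hi≡ rewrite *-zeroʳ (depth tree) | *-zeroʳ q | *-identityʳ m | +-identityʳ m | +-identityʳ m = +-identityʳ m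

  always-queried : ∀ I P σ → RealField.Always ℜ
    (λ (verdict , es) → length (V-queried es) ≤ q × (verdict ≡ true → length (V-queried es) ≡ q))
        (execute I (verifier σ) P)
  always-queried I P σ = Always-map
      (λ _ (lo , hi , acc) → ≤-trans hi (≤-reflexive hi≡) , λ v → ≤-antisym (≤-trans hi (≤-reflexive hi≡))
          (≤-trans (≤-reflexive (≡.sym (*-identityʳ q))) (acc v)))
      (execute I (verifier σ) P)
      (always-bounded queriedMeasure 0 (λ _ _ _ _ _ _ → z≤n) 0 1 0 0 (λ _ → ≡.refl) (λ _ → ≡.refl)
          (λ _ _ → ≡.refl) (λ _ → ≡.refl) I P σ)
    where
    hi≡ : m * 0 + 0 + 0 + q * (depth tree * 0 + 1) ≡ q
    hi≡ rewrite *-zeroʳ m | *-zeroʳ (depth tree) = *-identityʳ q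

  module _ (2≤m : 2 ≤ m) (1≤q : 1 ≤ q) where

    private
      Λm ΛmK : ℕ
      Λm  = ⌊log₂ m ⌋
      ΛmK = ⌊log₂ (m * K) ⌋

      1≤K : 1 ≤ K
      1≤K = >-nonZero⁻¹ K

      2≤mK : 2 ≤ m * K
      2≤mK = *-mono-≤ 2≤m 1≤K

      1≤Λm : 1 ≤ Λm
      1≤Λm = 1≤⌊log₂⌋ 2≤m

      1≤ΛmK : 1 ≤ ΛmK
      1≤ΛmK = 1≤⌊log₂⌋ 2≤mK

      depth≤ : depth tree ≤ 2 * Λm
      depth≤ = depth≤2⌊log₂⌋ tree 2≤m

      1≤qΛm : 1 ≤ q * Λm
      1≤qΛm = *-mono-≤ 1≤q 1≤Λm

      -- As m K ≥ 2, the number of codewords K m + 2 is at most 2 m K. Doubling costs one bit and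
      -- passing from ceiling to floor another, and both are absorbed by ΛmK ≥ 1.
      claimBits≤ : claimBits m ≤ 3 * ΛmK
      claimBits≤ = begin
        ⌈log₂ (K * m + 2) ⌉      ≤⟨ ⌈log₂⌉-mono-≤
            (+-mono-≤ (≤-reflexive (*-comm K m)) (≤-trans 2≤mK (≤-reflexive (≡.sym (+-identityʳ _))))) ⟩
        ⌈log₂ (2 * (m * K)) ⌉    ≡⟨ ⌈log₂2*n⌉≡1+⌈log₂n⌉ (m * K) {{>-nonZero (≤-trans (s≤s z≤n) 2≤mK)}} ⟩
        1 + ⌈log₂ (m * K) ⌉      ≤⟨ s≤s (⌈log₂⌉≤1+⌊log₂⌋ (≤-trans (n≤1+n 1) 2≤mK)) ⟩
        2 + ΛmK                    ≤⟨ +-monoˡ-≤ ΛmK (*-monoʳ-≤ 2 1≤ΛmK) ⟩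
        2 * ΛmK + ΛmK            ≡⟨ +-comm (2 * ΛmK) ΛmK ⟩
        3 * ΛmK                    ∎
        where open ≤-Reasoning

    -- The constant is 6 = 2 + 4: the two opening messages, and two messages on each of at most 2 Λm
    -- levels per descent.
    always-rounds : ∀ I P σ → RealField.Always ℜ (λ (_ , es) → rounds es ≤ 6 * (q * Λm))
        (execute I (verifier σ) P)
    always-rounds I P σ = Always-map (λ _ (_ , hi , _) → ≤-trans hi total≤) (execute I (verifier σ) P)
        (always-bounded roundsMeasure 2 (λ _ _ _ _ _ _ → ≤-refl) 0 0 1 1 (λ _ → ≡.refl) (λ _ → ≡.refl)
            (λ _ _ → ≡.refl) (λ _ → ≡.refl) I P σ)
      where
      open ≤-Reasoning
      total≤ : m * 0 + 1 + 1 + q * (depth tree * 2 + 0) ≤ 6 * (q * Λm)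
      total≤ = begin
        m * 0 + 1 + 1 + q * (depth tree * 2 + 0)
          ≡⟨ ≡.cong₂ (λ x y → x + 1 + 1 + q * y) (*-zeroʳ m) (+-identityʳ _) ⟩
        2 + q * (depth tree * 2)
          ≤⟨ +-mono-≤ (*-monoʳ-≤ 2 1≤qΛm) (*-monoʳ-≤ q (*-monoˡ-≤ 2 depth≤)) ⟩
        2 * (q * Λm) + q * (2 * Λm * 2)
          ≡⟨ solve 2 (λ q l → con 2 :* (q :* l) :+ q :* (con 2 :* l :* con 2) := con 6 :* (q :* l)) ≡.refl q Λm
              ⟩
        6 * (q * Λm) ∎

    -- The constant is 17 = 3 + 14: the root claim takes 3 ΛmK bits, and each of at most 2 Λm levels
    -- takes 7 ΛmK, namely two claims and the revealed bit.
    always-communication : ∀ ℓ I P σ → RealField.Always ℜ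
      (λ (_ , es) → communication ℓ es ≤ 17 * (m * ℓ + q * Λm * ΛmK)) (execute I (verifier σ) P)
    always-communication ℓ I P σ = Always-map (λ _ (_ , hi , _) → ≤-trans hi total≤) (execute I (verifier σ) P)
        (always-bounded (communicationMeasure ℓ) (7 * ΛmK) level≤ 0 0 (m * ℓ + 0) (claimBits m + 0)
            (λ _ → ≡.refl) (λ _ → ≡.refl)
          (λ _ len → ≡.cong (λ n → n * ℓ + 0) len) (λ _ → ≡.refl) I P σ)
      where
      open ≤-Reasoning
      level≤ : ∀ lo a b r o → a + b ≤ m → communication ℓ (P-sends (children lo a b) r ∷ []) + communication ℓ
          (V-sends (reveal o) ∷ []) ≤ 7 * ΛmK
      level≤ lo a b r o a+b≤m = begin
        claimBits a + claimBits b + 0 + 1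
          ≤⟨ +-mono-≤ (+-monoˡ-≤ 0 (+-mono-≤
               (≤-trans (claimBits-mono (≤-trans (m≤m+n a b) a+b≤m)) claimBits≤)
               (≤-trans (claimBits-mono (≤-trans (m≤n+m b a) a+b≤m)) claimBits≤))) 1≤ΛmK ⟩
        3 * ΛmK + 3 * ΛmK + 0 + ΛmK
          ≡⟨ solve 1 (λ l → con 3 :* l :+ con 3 :* l :+ con 0 :+ l := con 7 :* l) ≡.refl ΛmK ⟩
        7 * ΛmK ∎
      total≤ : m * 0 + (m * ℓ + 0) + (claimBits m + 0) + q * (depth tree * (7 * ΛmK) + 0)
               ≤ 17 * (m * ℓ + q * Λm * ΛmK)
      total≤ = begin
        m * 0 + (m * ℓ + 0) + (claimBits m + 0) + q * (depth tree * (7 * ΛmK) + 0)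
          ≤⟨ +-mono-≤ (+-monoʳ-≤ (m * 0 + (m * ℓ + 0)) (+-monoˡ-≤ 0 (≤-trans claimBits≤
               (≤-trans (≤-reflexive (≡.sym (*-identityˡ _))) (*-monoˡ-≤ (3 * ΛmK) 1≤qΛm)))))
               (*-monoʳ-≤ q (+-monoˡ-≤ 0 (*-monoˡ-≤ (7 * ΛmK) depth≤))) ⟩
        m * 0 + (m * ℓ + 0) + (q * Λm * (3 * ΛmK) + 0) + q * (2 * Λm * (7 * ΛmK) + 0)
          ≡⟨ solve 5 (λ m s q l k → m :* con 0 :+ (s :+ con 0) :+ (q :* l :* (con 3 :* k) :+ con 0)
                 :+ q :* (con 2 :* l :* (con 7 :* k) :+ con 0) := s :+ con 17 :* (q :* l :* k)) ≡.refl m (m * ℓ)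
                     q Λm ΛmK ⟩
        m * ℓ + 17 * (q * Λm * ΛmK)
          ≤⟨ +-monoˡ-≤ _ (m≤n*m (m * ℓ) 17) ⟩
        17 * (m * ℓ) + 17 * (q * Λm * ΛmK)
          ≡⟨ *-distribˡ-+ 17 (m * ℓ) _ ⟨
        17 * (m * ℓ + q * Λm * ΛmK) ∎

  always-cost : Admissible → ∀ {C} → 17 ≤ C → ∀ ℓ I σ P → RealField.Always ℜ
    (λ (verdict , es) → length (V-drawn es) ≡ m
      × length (V-queried es) ≤ q
      × (verdict ≡ true → length (V-queried es) ≡ q)
      × communication ℓ es ≤ C * (m * ℓ + q * ⌊log₂ m ⌋ * ⌊log₂ (m * K) ⌋)
      × rounds es ≤ C * (q * ⌊log₂ m ⌋))
    (execute I (verifier σ) P)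
  always-cost admissible {C} 17≤C ℓ I σ P = Always-map
    (λ (_ , es) ((drawn , (≤q , =q)) , (comm , rnds)) → drawn , ≤q , =q
      , ≤-trans comm (*-monoˡ-≤ commUnit 17≤C) , ≤-trans rnds (*-monoˡ-≤ (q * ⌊log₂ m ⌋) 6≤C))
    r (Always-× r (Always-× r (always-drawn I P σ) (always-queried I P σ))
        (Always-× r (always-communication 2≤m 1≤q ℓ I P σ) (always-rounds 2≤m 1≤q I P σ)))
    where
    r = execute I (verifier σ) P
    commUnit : ℕ
    commUnit = m * ℓ + q * ⌊log₂ m ⌋ * ⌊log₂ (m * K) ⌋
    6≤C : 6 ≤ C
    6≤C = ≤-trans (m≤m+n 6 11) 17≤C
    2≤m : 2 ≤ m
    2≤m = ≤-trans (m≤m+n 2 14) (ParameterBounds.16≤m admissible)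
    1≤q : 1 ≤ q
    1≤q = ParameterBounds.1≤q admissible

-- Draws and queries of the honest prover

module HonestQueries {{ℜ : RealField}} (N K : ℕ) .{{_ : NonZero K}} (I : Model.Instance {{ℜ}} N K) where

  open RealField ℜ using (Rand; pure; _>>=_; Always)
  open Model {{ℜ}} N K
  open Execution I honestProver
  open HonestRun N K I
  open DescentShape N K
  open EventMeasure N K using (Always-bind; Always-map)

  -- Distinct entries make indexing injective, which reduces the bound by N to the pigeonhole
  -- principle on `Fin`.
  lookup-injective : ∀ {A : Set} {xs : List A} → Unique xs → ∀ {i j} → List.lookup xs i ≡ List.lookup xs j → i ≡
      j
  lookup-injective (_ ∷ _)  {fzero}  {fzero}  _  = ≡.refl
  lookup-injective {xs = _ ∷ xs} (x∉ ∷ _) {fzero}  {fsuc j} eq = contradiction eq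
      (All.lookup x∉ (∈-lookup {xs = xs} j))
  lookup-injective {xs = _ ∷ xs} (x∉ ∷ _) {fsuc i} {fzero}  eq = contradiction (≡.sym eq)
      (All.lookup x∉ (∈-lookup {xs = xs} i))
  lookup-injective (_ ∷ u)  {fsuc i} {fsuc j} eq = ≡.cong fsuc (lookup-injective u eq)

  unique-length≤ : ∀ {xs : List (Fin N)} → Unique xs → length xs ℕ.≤ N
  unique-length≤ u = Fin.injective⇒≤ (lookup-injective u)

  Asks : List (Fin N) → Bool × List Event → Set
  Asks qs (_ , es) = P-drawn es ≡ [] × P-queried es ≡ qs

  -- The honest prover queries f-P only on receiving a sample, so what follows the single sample
  -- message triggers no further query, whatever the replies.
  SampleFree : Verifier → Set
  SampleFree (halt b)            = ⊤
  SampleFree (draw k)            = ∀ x → SampleFree (k x)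
  SampleFree (coin n k)          = ∀ i → SampleFree (k i)
  SampleFree (query x k)         = ∀ v → SampleFree (k v)
  SampleFree (send (sample _) v) = ⊥
  SampleFree (send (reveal _) v) = SampleFree v
  SampleFree (recv p k)          = ∀ r → SampleFree (k r)

  private
    Always-log : ∀ {qs} es r → P-drawn es ≡ [] → Always (Asks qs) r → Always (Asks (P-queried es ++ qs))
        (log es r)
    Always-log es r no-draws h = Always-bind _ r (Always-map
      (λ (_ , es′) (drawn , queried) → ≡.trans (List.mapMaybe-++ _ es es′) (≡.cong₂ _++_ no-draws drawn)
                                     , ≡.trans (List.mapMaybe-++ _ es es′) (≡.cong (P-queried es ++_) queried))
                                         r h)

  sampleFree-asks : ∀ v → SampleFree v → ∀ st → Always (Asks []) (run v st)
  sampleFree-asks (halt b)            h st = ≡.refl , ≡.refl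
  sampleFree-asks (draw k)            h st = λ x → Always-log _ (run (k x) st) ≡.refl
      (sampleFree-asks (k x) (h x) st)
  sampleFree-asks (coin n k)          h st = λ i → sampleFree-asks (k i) (h i) st
  sampleFree-asks (query x k)         h st = Always-log _ (run (k _) st) ≡.refl (sampleFree-asks (k _) (h _) st)
  sampleFree-asks (send (reveal _) v) h st = Always-log _ (run v st) ≡.refl (sampleFree-asks v h st)
  sampleFree-asks (recv (root n) k)   h st = Always-log _ (run (k _) st) ≡.refl (sampleFree-asks (k _) (h _) st)
  sampleFree-asks (recv (children _ _ _) k) h st = Always-log _ (run (k _) st) ≡.refl
      (sampleFree-asks (k _) (h _) st)

  sample-asks : ∀ xs v → SampleFree v → ∀ st → Always (Asks (List.deduplicate Fin._≟_ xs))
      (run (send (sample xs) v) st)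
  sample-asks xs v h st = ≡.subst
    (λ r → Always (Asks qs) (r >>= λ (st′ , es) → log (V-sends (sample xs) ∷ es) (run v st′)))
    (≡.sym (observe-sample xs st))
    (≡.subst (λ l → Always (Asks l) (log es (run v ps))) (≡.trans (List.++-identityʳ _) (queries qs))
      (Always-log es (run v ps) (no-draws qs) (sampleFree-asks v h ps)))
    where
    qs = List.deduplicate Fin._≟_ xs
    ps = honestState xs
    es = V-sends (sample xs) ∷ List.map P-queries qs
    no-draws : ∀ qs → P-drawn (List.map P-queries qs) ≡ []
    no-draws []       = ≡.refl
    no-draws (_ ∷ qs) = no-draws qs
    queries : ∀ qs → P-queried (List.map P-queries qs) ≡ qs
    queries []       = ≡.refl
    queries (q ∷ qs) = ≡.cong (q ∷_) (queries qs)

  descend-sampleFree : ∀ {s} (t : BalancedTree s) lo j w k → (∀ A → SampleFree (k A)) → SampleFree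
      (descend t lo j w k)
  descend-sampleFree leaf lo j w k h = h w
  descend-sampleFree (node {a} {b} p l r) lo j w k h (w₀ , w₁) =
    ≡.subst SampleFree (≡.sym (descend-node l r lo w₀ w₁ k p w j)) (checked (checks a b w₀ w₁ w) (splitAt a j))
    where
    checked : ∀ o i → SampleFree (if o then descendChild l r lo w₀ w₁ k i else halt false)
    checked false _        = _
    checked true  (inj₁ i) = descend-sampleFree l lo i w₀ k h
    checked true  (inj₂ i) = descend-sampleFree r (lo ℕ.+ a) i w₁ k h

  module _ {{p : Parameters}} (tree : BalancedTree (Parameters.m p)) where

    open Parameters p using (m; q)
    open Protocol tree
    open Soundness N K tree using (rootCheck; afterRoot; afterSample)

    FewQueries : Bool × List Event → Set
    FewQueries (_ , es) = P-drawn es ≡ [] × Unique (P-queried es) × length (P-queried es) ℕ.≤ m ⊓ N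

    private
      descents-sampleFree : ∀ xs W t Z → SampleFree (descents xs W t Z)
      descents-sampleFree xs W zero    Z   = _
      descents-sampleFree xs W (suc t) Z J = descend-sampleFree tree 0 J W _ λ A v U →
        descents-sampleFree xs W t (if compare A (val v) U then suc Z else Z)

      afterRoot-sampleFree : ∀ σ xs W → SampleFree (afterRoot σ xs W)
      afterRoot-sampleFree σ xs W = checked (rootCheck σ W)
        where
        checked : ∀ o → SampleFree (if o then descents xs W q 0 else halt false)
        checked true  = descents-sampleFree xs W q 0
        checked false = _

      drawMany-few : ∀ n k st → (∀ xs → Always FewQueries (run (k xs) st)) → Always FewQueries
          (run (drawMany n k) st)
      drawMany-few zero    k st h = h []
      drawMany-few (suc n) k st h = λ x → Always-bind _ (run (drawMany n λ xs → k (x ∷ xs)) st)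
        (drawMany-few n (λ xs → k (x ∷ xs)) st λ xs → h (x ∷ xs))

    always-few : ∀ σ → Always FewQueries (execute I (verifier σ) honestProver)
    always-few σ = drawMany-few m (afterSample σ) [] λ xs → Always-map
      (λ (_ , es) (drawn , queried) → drawn
        , ≡.subst Unique (≡.sym queried) (deduplicate-! Fin._≟_ (Vec.toList xs))
        , ≡.subst (λ qs → length qs ℕ.≤ m ⊓ N) (≡.sym queried) (ℕ.⊓-glb
            (ℕ.≤-trans (List.length-deduplicate Fin._≟_ (Vec.toList xs)) (ℕ.≤-reflexive (Vec.length-toList xs)))
            (unique-length≤ (deduplicate-! Fin._≟_ (Vec.toList xs)))))
      (run (afterSample σ xs) []) (sample-asks (Vec.toList xs) (recv (root m) (afterRoot σ xs))
          (afterRoot-sampleFree σ xs) [])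

-- The interactive proof together with its resource bounds

open RealField {{...}}
open Parameters {{...}}
open Model

theorem4p16 : ∃[ C ]
    ({{ℜ : RealField}} (N K : ℕ) .{{_ : NonZero K}} {{p : Parameters}} →
    0# ≤ ε-c → ε-c < ε-f → ε-f ≤ 1# →
    0# < δ → δ < 1# / fromℕ 3 →
    0# ≤ ρ → ρ ≤ 1# → 0# ≤ γ → γ ≤ 1# →
    0# < η →
    (T : BalancedTree m) →
    IsInteractiveProof N K (BoundedMismatch N K ρ γ) (Δ-mis N K) ε-c ε-f δ
    (Protocol.verifier N K T) (honestProver N K)
    × fromℕ m ≤ fromℕ C * (ln (1# / δ) / (η ^ 2))
    × fromℕ q ≤ fromℕ C * (g * ln (1# / δ) / (η ^ 2))
    × ((ℓ : ℕ) → Fin N ↣ Vec Bool ℓ →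
    (I : Instance N K) → BoundedMismatch N K ρ γ I →
    (σ : Carrier) → 0# ≤ σ → σ ≤ 1# →
    ((P : Prover N K) → Always
    (λ (verdict , events) →
    length (V-drawn N K events) ≡ m
    × length (V-queried N K events) ℕ.≤ q
    × (verdict ≡ true → length (V-queried N K events) ≡ q)
    × communication N K ℓ events ℕ.≤
    C ℕ.* (m ℕ.* ℓ ℕ.+ q ℕ.* ⌊log₂ m ⌋ ℕ.* ⌊log₂ (m ℕ.* K) ⌋)
    × rounds N K events ℕ.≤ C ℕ.* (q ℕ.* ⌊log₂ m ⌋))
    (execute N K I (Protocol.verifier N K T σ) P))
    × Always
    (λ (verdict , events) →
    P-drawn N K events ≡ []
    × Unique (P-queried N K events)
    × length (P-queried N K events) ℕ.≤ m ⊓ N)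
    (execute N K I (Protocol.verifier N K T σ) (honestProver N K))))
-- 130 = 32 * 4 + 2 comes from `m`: L is at most 4 ln (1 / δ), and rounding up adds at most 2 ln (1
-- / δ) / η². It dominates 98 = 24 * 4 + 2 for `q`, 17 for the communication and 6 for the rounds.
theorem4p16 = 130 , λ {{ℜ}} N K {{_}} {{p}} 0≤ε-c _ ε-f≤1 0<δ δ<⅓ 0≤ρ ρ≤1 0≤γ γ≤1 0<η tree →
  let admissible : Admissible {{ℜ}} {{p}}
      admissible = record
        { 0≤ε-c = 0≤ε-c ; ε-f≤1 = ε-f≤1 ; 0<δ = 0<δ ; δ<⅓ = δ<⅓ ; 0≤ρ = 0≤ρ ; ρ≤1 = ρ≤1
        ; 0≤γ = 0≤γ ; γ≤1 = γ≤1 ; 0<η = 0<η }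
  in (λ I bm σ _ _ → Completeness.completeness {{ℜ}} N K {{p = p}} tree I bm admissible σ
                   , λ ε-f<Δ P → Soundness.soundness {{ℜ}} N K {{p = p}} tree I P bm admissible σ ε-f<Δ)
   , ParameterBounds.m-upper {{ℜ}} {{p}} admissible
   , ParameterBounds.q-upper {{ℜ}} {{p}} admissible
   , λ ℓ _ I _ σ _ _ → ProtocolCost.always-cost {{ℜ}} N K {{p = p}} tree admissible (ℕ.m≤m+n 17 113) ℓ I σ
                     , HonestQueries.always-few {{ℜ}} N K I {{p = p}} tree σ
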